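{- Let $n\ge t\ge 1$ be integers. Then $$M(n,t)=\max_{0\le r\le \lfloor (n-t)/2\rfloor}\Bigl|\bigl\{p\in\Pi(n):\ \bigl|[t+2r]\cap f(p)\bigr|\ge t+r\bigr\}\Bigr|,$$ where $r$ ranges over integers.
   Context: $[m]=\{1,\dots,m\}$. $\Pi(n)$ is the set of all set partitions of $[n]$; the parts (blocks) of a partition are nonempty. For $p_1,p_2\in\Pi(n)$ the intersection $p_1\cap p_2$ is the set of common blocks of $p_1$ and $p_2$. A family $\mathcal A\subseteq\Pi(n)$ is $t$-intersecting if $|p_1\cap p_2|\ge t$ for all $p_1,p_2\in\mathcal A$. $M(n,t)$ is the maximum size $|\mathcal A|$ of a $t$-intersecting family $\mathcal A\subseteq \Pi(n)$. For $p\in\Pi(n)$, $f(p)=\{i\in[n]:\{i\}\text{ is a block of }p\}$ is the set of points fixed by $p$. -}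

module Defs where

open import Data.Bool.Base using (true; false)
open import Data.Empty using (⊥-elim)
open import Data.Fin.Base using (Fin; toℕ)
import Data.Fin.Properties as Fin
open import Data.Fin.Subset using (Subset; inside; outside; ⁅_⁆; ∣_∣; _∩_; Nonempty; Empty)
import Data.Fin.Subset as Subset
import Data.Fin.Subset.Properties as Subset
open import Data.List.Base using (List; []; _∷_; [_]; _++_; map; filter; length; mapMaybe; removeAt)
open import Data.List.Extrema.Nat using (max)
import Data.List.Extrema.Nat as Extrema
import Data.List.Membership.DecSetoid as DecMembership
import Data.List.Membership.DecPropositional as DecPropositionalMembership
open import Data.List.Membership.Propositional using (_∈_; find; lose)
open import Data.List.Membership.Propositional.Properties using (∈-map⁺; ∈-map⁻; ∈-++⁺ˡ; ∈-++⁺ʳ; ∈-++⁻; ∈-filter⁺; ∈-filter⁻)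
import Data.List.Membership.Setoid as SetoidMembership
import Data.List.Membership.Setoid.Properties as SetoidMembershipₚ
open import Data.List.Properties using (length-removeAt′)
import Data.List.Relation.Binary.Subset.DecPropositional as DecSubset
import Data.List.Relation.Binary.Subset.Setoid as SetoidSubset
open import Data.List.Relation.Unary.All as All using (All; []; _∷_)
import Data.List.Relation.Unary.All.Properties as All
open import Data.List.Relation.Unary.AllPairs as AllPairs using (AllPairs; []; _∷_; allPairs?)
import Data.List.Relation.Unary.AllPairs.Properties as AllPairs
open import Data.List.Relation.Unary.Any as Any using (Any; here; there; index)
import Data.List.Relation.Unary.Unique.Propositional as Propositional
import Data.List.Relation.Unary.Unique.Setoid as SetoidUnique
open import Data.Maybe.Base using (Maybe; just; nothing)
open import Data.Nat.Base using (ℕ; zero; suc; _+_; _*_; _≤_; z≤n; s≤s)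
open import Data.Nat.Properties using (_≤?_; _<?_; ≤-trans)
open import Data.Product.Base using (∃-syntax; _×_; _,_; proj₂; swap)
open import Data.Sum.Base using (inj₁; inj₂)
open import Data.Vec.Base using ([]; _∷_; tabulate)
import Data.Vec.Properties as Vec
import Data.Bool.Properties as Bool
open import Function.Base using (_∘_; id)
open import Level using (0ℓ)
open import Relation.Binary.Bundles using (Setoid; DecSetoid)
open import Relation.Binary.Definitions using (DecidableEquality)
open import Relation.Binary.PropositionalEquality using (_≡_; _≢_; refl; sym; subst; setoid)
open import Relation.Nullary using (¬_; yes; no; does)
open import Relation.Nullary.Decidable using (map′; _×-dec_; ¬?)
open import Relation.Unary using (Pred; Decidable)

private
  variable
    n : ℕ
    A : Set

_≟ˢ_ : DecidableEquality (Subset n)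
_≟ˢ_ = Vec.≡-dec Bool._≟_

-- The ground set [n] = {1, …, n} is Fin n, with i ∈ Fin n standing for the
-- point i + 1.
record IsPartition {n : ℕ} (bs : List (Subset n)) : Set where
  constructor mkIsPartition
  field
    nonempty : All Nonempty bs
    disjoint : AllPairs (λ b c → Empty (b ∩ c)) bs
    covering : ∀ i → Any (i Subset.∈_) bs

record Partition (n : ℕ) : Set where
  constructor mkPartition
  field
    blocks      : List (Subset n)
    isPartition : IsPartition blocks

  open IsPartition isPartition public

open Partition public using (blocks)

-- A partition is the set of its blocks, so the order in which they are listed
-- is irrelevant.
infix 4 _≈_
_≈_ : Partition n → Partition n → Set
p ≈ q = blocks p ⊆ blocks q × blocks q ⊆ blocks p
  where open DecSubset _≟ˢ_

Partition-decSetoid : ℕ → DecSetoid 0ℓ 0ℓ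
Partition-decSetoid n = record
  { Carrier          = Partition n
  ; _≈_              = _≈_
  ; isDecEquivalence = record
    { isEquivalence = record
      { refl  = id , id
      ; sym   = swap
      ; trans = λ (p⊆q , q⊆p) (q⊆r , r⊆q) → q⊆r ∘ p⊆q , q⊆p ∘ r⊆q
      }
    ; _≟_ = λ p q → (blocks p ⊆? blocks q) ×-dec (blocks q ⊆? blocks p)
    }
  }
  where open DecSubset _≟ˢ_

Partition-setoid : ℕ → Setoid 0ℓ 0ℓ
Partition-setoid n = DecSetoid.setoid (Partition-decSetoid n)

-- The set of common blocks; its length is its cardinality, since the blocks of
-- a partition are distinct (blocks-unique below).
infixl 7 _∩ᵖ_
_∩ᵖ_ : Partition n → Partition n → List (Subset n)
p ∩ᵖ q = filter (_∈? blocks q) (blocks p)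
  where open DecPropositionalMembership _≟ˢ_ using (_∈?_)

fixed : Partition n → Subset n
fixed p = tabulate λ i → does (⁅ i ⁆ ∈? blocks p)
  where open DecPropositionalMembership _≟ˢ_ using (_∈?_)

-- The point i + 1 lies in [k] iff i < k, so this is [k] whenever k ≤ n.
initial : ∀ {n} → ℕ → Subset n
initial k = tabulate λ i → does (toℕ i <? k)

-- A finite set of partitions is a list without repetitions up to _≈_, and its
-- size is the length of that list.
UniqueFamily : List (Partition n) → Set
UniqueFamily {n} = SetoidUnique.Unique (Partition-setoid n)

Intersecting : ℕ → List (Partition n) → Set
Intersecting t 𝒜 = All (λ p → All (λ q → t ≤ length (p ∩ᵖ q)) 𝒜) 𝒜

intersecting? : ∀ t → Decidable (Intersecting {n} t)
intersecting? t 𝒜 = All.all? (λ p → All.all? (λ q → t ≤? length (p ∩ᵖ q)) 𝒜) 𝒜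

sublists : List A → List (List A)
sublists []       = [ [] ]
sublists (x ∷ xs) = map (x ∷_) (sublists xs) ++ sublists xs

subsets : ∀ n → List (Subset n)
subsets zero    = [ [] ]
subsets (suc n) = map (inside ∷_) (subsets n) ++ map (outside ∷_) (subsets n)

isPartition? : Decidable (IsPartition {n})
isPartition? bs =
  map′ (λ (ne , dj , cv) → mkIsPartition ne dj cv)
       (λ (mkIsPartition ne dj cv) → ne , dj , cv)
       (All.all? Subset.nonempty? bs
         ×-dec allPairs? (λ b c → ¬? (Subset.nonempty? (b ∩ c))) bs
         ×-dec Fin.all? (λ i → Any.any? (i Subset.∈?_) bs))

toPartition : List (Subset n) → Maybe (Partition n)
toPartition bs with isPartition? bs
... | yes isP = just (mkPartition bs isP)
... | no  _   = nothing

-- Π(n): complete and without repetitions, by partitions-complete and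
-- partitions-unique below.
partitions : ∀ n → List (Partition n)
partitions n = mapMaybe toPartition (sublists (subsets n))

-- The empty family is t-intersecting, hence the default value 0.  That M n t
-- is the maximum over all families is shown by M-attained and M-upper below.
M : ℕ → ℕ → ℕ
M n t = max 0 (map length (filter (intersecting? t) (sublists (partitions n))))

-- | [t + 2r] ∩ f(p) | ≥ t + r
FixesMany : (t r : ℕ) → Partition n → Set
FixesMany t r p = t + r ≤ ∣ initial (t + 2 * r) ∩ fixed p ∣

fixesMany? : ∀ t r → Decidable (FixesMany {n} t r)
fixesMany? t r p = t + r ≤? ∣ initial (t + 2 * r) ∩ fixed p ∣

∣FixesMany∣ : (n t r : ℕ) → ℕ
∣FixesMany∣ n t r = length (filter (fixesMany? t r) (partitions n))

module _ (S : Setoid 0ℓ 0ℓ) where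

  private
    module S = Setoid S
    module ∈ = SetoidMembership S
    module ⊆ = SetoidSubset S
    open SetoidUnique S using (Unique)

  ∈-removeAt : ∀ {x y ys} (x∈ys : x ∈.∈ ys) → y ∈.∈ ys → ¬ (x S.≈ y) →
               y ∈.∈ removeAt ys (index x∈ys)
  ∈-removeAt (here x≈z)   (here y≈z)   x≉y = ⊥-elim (x≉y (S.trans x≈z (S.sym y≈z)))
  ∈-removeAt (here x≈z)   (there y∈ys) x≉y = y∈ys
  ∈-removeAt (there x∈ys) (here y≈z)   x≉y = here y≈z
  ∈-removeAt (there x∈ys) (there y∈ys) x≉y = there (∈-removeAt x∈ys y∈ys x≉y)

  ∈⇒All≉ : ∀ {x y xs} → All (λ z → ¬ (x S.≈ z)) xs → y ∈.∈ xs → ¬ (x S.≈ y)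
  ∈⇒All≉ (x≉z ∷ _)  (here y≈z)   x≈y = x≉z (S.trans x≈y y≈z)
  ∈⇒All≉ (_ ∷ x≉xs) (there y∈xs) x≈y = ∈⇒All≉ x≉xs y∈xs x≈y

  unique-⊆⇒length≤ : ∀ {xs ys} → Unique xs → xs ⊆.⊆ ys → length xs ≤ length ys
  unique-⊆⇒length≤ [] _ = z≤n
  unique-⊆⇒length≤ {x ∷ xs} {ys} (x≉xs ∷ xs!) xs⊆ys =
    subst (suc (length xs) ≤_) (sym (length-removeAt′ ys (index x∈ys)))
      (s≤s (unique-⊆⇒length≤ xs! λ y∈xs →
        ∈-removeAt x∈ys (xs⊆ys (there y∈xs)) (∈⇒All≉ x≉xs y∈xs)))
    where x∈ys = xs⊆ys (here S.refl)

module _ {P : Pred A 0ℓ} (P? : Decidable P) where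

  filter∈sublists : ∀ xs → filter P? xs ∈ sublists xs
  filter∈sublists []       = here refl
  filter∈sublists (x ∷ xs) with does (P? x)
  ... | true  = ∈-++⁺ˡ (∈-map⁺ (x ∷_) (filter∈sublists xs))
  ... | false = ∈-++⁺ʳ (map (x ∷_) (sublists xs)) (filter∈sublists xs)

∈-sublists⇒⊆ : ∀ (xs : List A) {ys} → ys ∈ sublists xs → ∀ {x} → x ∈ ys → x ∈ xs
∈-sublists⇒⊆ []       (here refl) ()
∈-sublists⇒⊆ (x ∷ xs) ys∈ z∈ys with ∈-++⁻ (map (x ∷_) (sublists xs)) ys∈
... | inj₂ ys∈′ = there (∈-sublists⇒⊆ xs ys∈′ z∈ys)
... | inj₁ ys∈′ with ∈-map⁻ (x ∷_) ys∈′
...   | zs , zs∈ , refl with z∈ys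
...     | here refl  = here refl
...     | there z∈zs = there (∈-sublists⇒⊆ xs zs∈ z∈zs)

sublists-allPairs : ∀ {R : A → A → Set} {xs} → AllPairs R xs → All (AllPairs R) (sublists xs)
sublists-allPairs []                     = [] ∷ []
sublists-allPairs {xs = x ∷ xs} (Rx ∷ R) =
  All.++⁺ (All.map⁺ (All.tabulate λ {ys} ys∈ →
             All.tabulate (λ y∈ys → All.lookup Rx (∈-sublists⇒⊆ xs ys∈ y∈ys))
             ∷ All.lookup IH ys∈))
          IH
  where IH = sublists-allPairs R

infix 4 _≋_
_≋_ : List A → List A → Set
xs ≋ ys = (∀ {x} → x ∈ xs → x ∈ ys) × (∀ {x} → x ∈ ys → x ∈ xs)

AllPairs-∈ : ∀ {B : Set} {R T : B → B → Set} {xs : List B} →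
             (∀ {x y} → x ∈ xs → y ∈ xs → R x y → T x y) → AllPairs R xs → AllPairs T xs
AllPairs-∈ f []       = []
AllPairs-∈ f (Rx ∷ R) =
  All.tabulate (λ y∈ → f (here refl) (there y∈) (All.lookup Rx y∈))
  ∷ AllPairs-∈ (λ x∈ y∈ → f (there x∈) (there y∈)) R

sublists-unique : ∀ {xs : List A} → Propositional.Unique xs →
                  AllPairs (λ ys zs → ¬ (ys ≋ zs)) (sublists xs)
sublists-unique [] = [] ∷ []
sublists-unique {xs = x ∷ xs} (x≢xs ∷ xs!) =
  AllPairs.++⁺
    (AllPairs.map⁺ (AllPairs-∈ (λ ys∈ zs∈ ¬ys≋zs (⊆ , ⊇) →
      ¬ys≋zs (drop ys∈ ⊆ , drop zs∈ ⊇)) IH))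
    IH
    (All.map⁺ (All.tabulate λ _ → All.tabulate λ zs∈ (⊆ , _) →
      x∉ zs∈ (⊆ (here refl))))
  where
  IH = sublists-unique xs!

  x∉ : ∀ {zs} → zs ∈ sublists xs → ¬ (x ∈ zs)
  x∉ zs∈ x∈zs = All.lookup x≢xs (∈-sublists⇒⊆ xs zs∈ x∈zs) refl

  drop : ∀ {ys zs} → ys ∈ sublists xs → (∀ {y} → y ∈ x ∷ ys → y ∈ x ∷ zs) →
         ∀ {y} → y ∈ ys → y ∈ zs
  drop ys∈ f y∈ys with f (there y∈ys)
  ... | here refl  = ⊥-elim (x∉ ys∈ y∈ys)
  ... | there y∈zs = y∈zs

subsets-complete : ∀ (b : Subset n) → b ∈ subsets n
subsets-complete []            = here refl
subsets-complete (inside ∷ b)  = ∈-++⁺ˡ (∈-map⁺ (inside ∷_) (subsets-complete b))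
subsets-complete (outside ∷ b) = ∈-++⁺ʳ (map (inside ∷_) (subsets _)) (∈-map⁺ (outside ∷_) (subsets-complete b))

subsets-unique : ∀ n → Propositional.Unique (subsets n)
subsets-unique zero    = [] ∷ []
subsets-unique (suc n) = AllPairs.++⁺
  (AllPairs.map⁺ (AllPairs.map (λ b≢c → b≢c ∘ Vec.∷-injectiveʳ) (subsets-unique n)))
  (AllPairs.map⁺ (AllPairs.map (λ b≢c → b≢c ∘ Vec.∷-injectiveʳ) (subsets-unique n)))
  (All.map⁺ (All.tabulate λ _ → All.map⁺ (All.tabulate λ _ ())))

blocks-unique : ∀ (p : Partition n) → Propositional.Unique (blocks p)
blocks-unique p = AllPairs-∈
  (λ {b} b∈ _ b∩c=∅ b≡c → let (i , i∈b) = All.lookup nonempty b∈ in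
    b∩c=∅ (i , Subset.x∈p∩q⁺ (i∈b , subst (i Subset.∈_) b≡c i∈b)))
  disjoint
  where open Partition p using (nonempty; disjoint)

AllPairs-lookup : ∀ {R : A → A → Set} {xs} → (∀ {x y} → R x y → R y x) → AllPairs R xs →
                  ∀ {x y} → x ∈ xs → y ∈ xs → x ≢ y → R x y
AllPairs-lookup Rsym (Rx ∷ _) (here refl) (here refl) x≢y = ⊥-elim (x≢y refl)
AllPairs-lookup Rsym (Rx ∷ _) (here refl) (there y∈)  x≢y = All.lookup Rx y∈
AllPairs-lookup Rsym (Rx ∷ _) (there x∈)  (here refl) x≢y = Rsym (All.lookup Rx x∈)
AllPairs-lookup Rsym (_ ∷ R)  (there x∈)  (there y∈)  x≢y = AllPairs-lookup Rsym R x∈ y∈ x≢y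

isPartition-resp-≋ : ∀ {bs cs : List (Subset n)} → Propositional.Unique cs → bs ≋ cs →
                     IsPartition bs → IsPartition cs
isPartition-resp-≋ cs! (bs⊆cs , cs⊆bs) (mkIsPartition ne dj cv) = mkIsPartition
  (All.tabulate (All.lookup ne ∘ cs⊆bs))
  (AllPairs-∈ (λ b∈ c∈ b≢c → AllPairs-lookup
    (λ {b} {c} → subst Empty (Subset.∩-comm b c)) dj (cs⊆bs b∈) (cs⊆bs c∈) b≢c) cs!)
  (λ i → let (b , b∈ , i∈b) = find (cv i) in lose (bs⊆cs b∈) i∈b)

∈-mapMaybe-toPartition : ∀ {bs} (bss : List (List (Subset n))) → bs ∈ bss → IsPartition bs →
                         Any (λ p → blocks p ≡ bs) (mapMaybe toPartition bss)
∈-mapMaybe-toPartition (bs ∷ bss) (here refl) isP with isPartition? bs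
... | yes _    = here refl
... | no  ¬isP = ⊥-elim (¬isP isP)
∈-mapMaybe-toPartition (bs ∷ bss) (there bs∈) isP with isPartition? bs
... | yes _ = there (∈-mapMaybe-toPartition bss bs∈ isP)
... | no  _ = ∈-mapMaybe-toPartition bss bs∈ isP

partitions-complete : ∀ (p : Partition n) → Any (p ≈_) (partitions n)
partitions-complete {n} p =
  Any.map (λ { refl → bs≋cs })
    (∈-mapMaybe-toPartition (sublists (subsets n)) (filter∈sublists (_∈? blocks p) (subsets n))
      (isPartition-resp-≋ (AllPairs.filter⁺ (_∈? blocks p) (subsets-unique n)) bs≋cs
        (Partition.isPartition p)))
  where
  open DecPropositionalMembership _≟ˢ_ using (_∈?_)
  bs≋cs : blocks p ≋ filter (_∈? blocks p) (subsets n)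
  bs≋cs = (λ {b} b∈ → ∈-filter⁺ (_∈? blocks p) (subsets-complete b) b∈)
        , (λ b∈ → proj₂ (∈-filter⁻ (_∈? blocks p) {xs = subsets n} b∈))

mapMaybe-toPartition-allPairs : ∀ {R : List (Subset n) → List (Subset n) → Set} bss → AllPairs R bss →
  AllPairs (λ p q → R (blocks p) (blocks q)) (mapMaybe toPartition bss)
mapMaybe-toPartition-allPairs []         []       = []
mapMaybe-toPartition-allPairs {R = R} (bs ∷ bss) (Rb ∷ Rs) with isPartition? bs
... | no  _ = mapMaybe-toPartition-allPairs bss Rs
... | yes _ = lift bss Rb ∷ mapMaybe-toPartition-allPairs bss Rs
  where
  lift : ∀ css → All (R bs) css → All (λ q → R bs (blocks q)) (mapMaybe toPartition css)
  lift []         []       = []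
  lift (cs ∷ css) (r ∷ rs) with isPartition? cs
  ... | yes _ = r ∷ lift css rs
  ... | no  _ = lift css rs

partitions-unique : ∀ n → UniqueFamily (partitions n)
partitions-unique n =
  mapMaybe-toPartition-allPairs (sublists (subsets n)) (sublists-unique (subsets-unique n))

∩ᵖ-mono : ∀ {p p′ q q′ : Partition n} → p ≈ p′ → q ≈ q′ → length (p ∩ᵖ q) ≤ length (p′ ∩ᵖ q′)
∩ᵖ-mono {n} {p} {p′} {q} {q′} (p⊆p′ , _) (q⊆q′ , _) =
  unique-⊆⇒length≤ (setoid (Subset n)) (AllPairs.filter⁺ (_∈? blocks q) (blocks-unique p))
    λ b∈ → let (b∈p , b∈q) = ∈-filter⁻ (_∈? blocks q) {xs = blocks p} b∈ in
      ∈-filter⁺ (_∈? blocks q′) (p⊆p′ b∈p) (q⊆q′ b∈q)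
  where
  open DecPropositionalMembership _≟ˢ_ using (_∈?_)

M-attained : ∀ n t → ∃[ 𝒜 ] UniqueFamily {n} 𝒜 × Intersecting t 𝒜 × length 𝒜 ≡ M n t
M-attained n t with Extrema.argmax-sel id 0 (map length (filter (intersecting? t) (sublists (partitions n))))
... | inj₁ M≡0 = [] , [] , [] , sym M≡0
... | inj₂ M∈ with ∈-map⁻ length M∈
...   | 𝒜 , 𝒜∈ , M≡ with ∈-filter⁻ (intersecting? t) {xs = sublists (partitions n)} 𝒜∈
...     | 𝒜∈′ , int = 𝒜 , All.lookup (sublists-allPairs (partitions-unique n)) 𝒜∈′ , int , sym M≡

M-upper : ∀ n t {𝒜 : List (Partition n)} → UniqueFamily 𝒜 → Intersecting t 𝒜 → length 𝒜 ≤ M n t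
M-upper n t {𝒜} 𝒜! int = ≤-trans
  (unique-⊆⇒length≤ (Partition-setoid n) {𝒜} {ℬ} 𝒜! λ {p} p∈𝒜 →
    SetoidMembershipₚ.∈-filter⁺ (Partition-setoid n) (_∈? 𝒜) (λ {p} {q} → resp {p} {q}) {p} (partitions-complete p) p∈𝒜)
  (All.lookup (Extrema.xs≤max 0 _)
    (∈-map⁺ length (∈-filter⁺ (intersecting? t) (filter∈sublists (_∈? 𝒜) (partitions n)) int′)))
  where
  open DecMembership (Partition-decSetoid n) using (_∈?_) renaming (_∈_ to _∈ᵖ_)
  resp : ∀ {p q} → p ≈ q → p ∈ᵖ 𝒜 → q ∈ᵖ 𝒜
  resp {p} {q} = SetoidMembershipₚ.∈-resp-≈ (Partition-setoid n) {𝒜} {p} {q}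
  ℬ = filter (_∈? 𝒜) (partitions n)
  rep : ∀ {p} → p ∈ ℬ → ∃[ q ] q ∈ 𝒜 × p ≈ q
  rep p∈ = find
    (proj₂ (∈-filter⁻ (_∈? 𝒜) {xs = partitions n} p∈))
  int′ : Intersecting t ℬ
  int′ = All.tabulate λ {p} p∈ → All.tabulate λ {q} q∈ →
    let (p₀ , p₀∈ , p≈p₀) = rep p∈ ; (q₀ , q₀∈ , q≈q₀) = rep q∈ in
    ≤-trans (All.lookup (All.lookup int p₀∈) q₀∈)
            (∩ᵖ-mono {p = p₀} {p} {q₀} {q} (swap p≈p₀) (swap q≈q₀))

module Submission where

open import Data.Bool.Base using (Bool; true; false; not; _∧_; _∨_; _xor_; if_then_else_)
import Data.Bool.Base as Bool
import Data.Bool.Properties as Bool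
open import Data.Empty using (⊥; ⊥-elim)
open import Data.Fin.Base using (Fin; zero; suc; toℕ; fromℕ<)
import Data.Fin.Properties as Fin
open import Data.Fin.Subset using (Subset; inside; outside; ⁅_⁆; ∣_∣; _∩_; Empty)
import Data.Fin.Subset as Subset
import Data.Fin.Subset.Properties as Subset
open import Data.List.Base using (List; []; _∷_; map; filter; length; upTo)
open import Data.List.Extrema.Nat using (max)
import Data.List.Extrema.Nat as Extrema
import Data.List.Membership.DecPropositional as DecPropositionalMembership
open import Data.List.Membership.Propositional using (_∈_; find; lose)
open import Data.List.Membership.Propositional.Properties using (∈-map⁺; ∈-map⁻; ∈-filter⁺; ∈-filter⁻; ∈-upTo⁺)
import Data.List.Membership.Setoid.Properties as SetoidMembershipₚ
open import Data.List.Properties using (length-map; filter-all; filter-none)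
open import Data.List.Relation.Unary.All as All using (All; []; _∷_)
import Data.List.Relation.Unary.All.Properties as All
open import Data.List.Relation.Unary.AllPairs as AllPairs using (AllPairs; []; _∷_)
import Data.List.Relation.Unary.AllPairs.Properties as AllPairs
open import Data.List.Relation.Unary.Any as Any using (Any; here; there)
open import Data.List.Relation.Unary.Unique.Propositional using (Unique)
open import Data.Nat.Base using (ℕ; zero; suc; _+_; _*_; _∸_; _≤_; _<_; z≤n; s≤s; s≤s⁻¹; _≤ᵇ_; _≡ᵇ_; _<ᵇ_; ⌊_/2⌋; >-nonZero)
open import Data.Nat.Induction using (<-rec; <-wellFounded; Acc; acc)
open import Data.Nat.Properties
open import Data.Nat.Tactic.RingSolver using (solve-∀)
open import Data.Product.Base using (∃-syntax; _×_; _,_; proj₁; proj₂)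
open import Data.Sum.Base using (_⊎_; inj₁; inj₂)
open import Data.Unit.Base using (⊤; tt)
open import Data.Vec.Base using ([]; _∷_; lookup; tabulate; tail; zipWith; _[_]≔_)
open import Data.Vec.Properties using ([]=⇒lookup; lookup⇒[]=; lookup∘tabulate; lookup∘updateAt; lookup∘updateAt′; lookup-zipWith)
import Data.Vec.Properties as Vec
open import Data.Vec.Relation.Binary.Pointwise.Extensional using (ext; Pointwise-≡⇒≡)
open import Function.Base using (_∘_; id)
open import Relation.Binary.Bundles using (DecSetoid)
open import Relation.Binary.Definitions using (tri<; tri≈; tri>)
open import Relation.Binary.PropositionalEquality
open import Relation.Nullary using (¬_; Dec; yes; no; does)
open import Relation.Nullary.Decidable using (¬?; _×-dec_; _→-dec_; from-yes)
open import Relation.Unary using (Decidable)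
open import Defs

-- Breaking the non-singleton blocks of a t-intersecting family of partitions one
-- after the other ends in a family of the same size in which the sets of points
-- fixed by any two members share t points. As D(n − |S|) partitions have the fixed
-- set S, where D(x) counts the partitions of x points without singletons, it
-- remains to find the heaviest t-intersecting families of subsets of [n], a set S
-- having weight a(n − |S|) for a = D: a weighted complete intersection theorem.
--
-- An optimal family is taken, compressed towards one end. At the other end is a
-- point z. Either averaging over the pivots, the members that need z, shows that z
-- can be made irrelevant; then z is dropped, a(x) is replaced by a(x) + a(x + 1),
-- and n decreases. Or all pivots miss the same number r of points and
-- n = t + 2r. In this case pushing and pulling, applied to the members that
-- prevent the invariance under all permutations, shows the family to be invariant,
-- so that it is a Frankl family. The pulling step requires
-- j a(x + 1) < (t − 1 + j) a(x) for suitable j and x. These inequalities hold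
-- because after iterated replacements a is a sequence of moments of a Poisson
-- variable with T(x)/x! log-concave, by induction from E[X f(X)] = E[f(X + 1)];
-- only the irregular small values of D have to be treated separately.

-- Why one of the two ways always works: put R x = a(x + 1) / a(x). Averaging over pivots that miss
-- r points succeeds if r (R r - 1) ≥ t - 1, whereas pulling asks for j (R x - 1) < t - 1 with j < x
-- and j + x < 2r. So it is enough that j (R x - 1) ≤ r (R r - 1), the inequality `Gap`. For x ≤ r
-- it follows once R increases, which is Cauchy-Schwarz for moments. For x ≥ r it follows once (R x
-- - 1) / x decreases, since j x ≤ r²; this is the harder fact, and the reason for the detour
-- through random partitions. The obstacle is D itself, the sequence of central moments
-- E[(X - 1)^x]: it starts 1, 0, 1, 1, 4, so neither monotonicity nor positivity nor log-convexity
-- of the weights holds from the start. Hence the bounds 1 ≤ x and 2 ≤ x, the restriction to sets of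
-- positive weight, and the special role of sets that miss at most one point.

private
  variable
    n : ℕ

⟦_⟧ : Bool → ℕ
⟦ true ⟧  = 1
⟦ false ⟧ = 0

-- Reduces linear consequences of p ≤ q to semiring identities, with slack s.
≤-from : ∀ {p q L R} s → p ≤ q → R + p ≡ L + q + s → L ≤ R
≤-from {p} {q} {L} {R} s p≤q eq = +-cancelʳ-≤ q L R (begin
  L + q ≤⟨ m≤m+n (L + q) s ⟩
  L + q + s ≡⟨ eq ⟨
  R + p ≤⟨ +-monoʳ-≤ R p≤q ⟩
  R + q ∎)
  where open ≤-Reasoning

interchange : ∀ a b c d → (a + b) + (c + d) ≡ (a + c) + (b + d)
interchange = solve-∀

Bool-ext : ∀ {a b} → (a ≡ true → b ≡ true) → (b ≡ true → a ≡ true) → a ≡ b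
Bool-ext {false} {false} f g = refl
Bool-ext {false} {true}  f g = g refl
Bool-ext {true}  {b}     f g = sym (f refl)

true≢false : ∀ {b} → b ≡ true → b ≡ false → ⊥
true≢false refl ()

∧-split : ∀ {a b} → a ∧ b ≡ true → a ≡ true × b ≡ true
∧-split {true} {true} refl = refl , refl

vec-ext : {A B : Subset n} → (∀ e → lookup A e ≡ lookup B e) → A ≡ B
vec-ext h = Pointwise-≡⇒≡ (ext h)

-- Sums over points

opaque

  Σᶠ : (Fin n → ℕ) → ℕ
  Σᶠ {zero}  f = 0
  Σᶠ {suc n} f = f zero + Σᶠ (f ∘ suc)

  Σᶠ-suc : (f : Fin (suc n) → ℕ) → Σᶠ f ≡ f zero + Σᶠ (f ∘ suc)
  Σᶠ-suc f = refl

  Σᶠ-cong : {f g : Fin n → ℕ} → (∀ e → f e ≡ g e) → Σᶠ f ≡ Σᶠ g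
  Σᶠ-cong {zero}  h = refl
  Σᶠ-cong {suc n} h = cong₂ _+_ (h zero) (Σᶠ-cong (h ∘ suc))

  Σᶠ-mono : {f g : Fin n → ℕ} → (∀ e → f e ≤ g e) → Σᶠ f ≤ Σᶠ g
  Σᶠ-mono {zero}  h = z≤n
  Σᶠ-mono {suc n} h = +-mono-≤ (h zero) (Σᶠ-mono (h ∘ suc))

  Σᶠ-mono-< : {f g : Fin n → ℕ} → (∀ e → f e ≤ g e) → ∀ e → f e < g e → Σᶠ f < Σᶠ g
  Σᶠ-mono-< h zero    lt = +-mono-<-≤ lt (Σᶠ-mono (h ∘ suc))
  Σᶠ-mono-< h (suc e) lt = +-mono-≤-< (h zero) (Σᶠ-mono-< (h ∘ suc) e lt)

  Σᶠ-+ : (f g : Fin n → ℕ) → Σᶠ (λ e → f e + g e) ≡ Σᶠ f + Σᶠ g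
  Σᶠ-+ {zero}  f g = refl
  Σᶠ-+ {suc n} f g rewrite Σᶠ-+ (f ∘ suc) (g ∘ suc) = interchange (f zero) (g zero) _ _

  Σᶠ-*ʳ : (f : Fin n → ℕ) (c : ℕ) → Σᶠ (λ e → f e * c) ≡ Σᶠ f * c
  Σᶠ-*ʳ {zero}  f c = refl
  Σᶠ-*ʳ {suc n} f c rewrite Σᶠ-*ʳ (f ∘ suc) c = sym (*-distribʳ-+ c (f zero) _)

  Σᶠ-const : ∀ n c → Σᶠ {n} (λ _ → c) ≡ n * c
  Σᶠ-const zero    c = refl
  Σᶠ-const (suc n) c = cong (c +_) (Σᶠ-const n c)

  Σᶠ-comm : ∀ {m} (f : Fin n → Fin m → ℕ) → Σᶠ (λ i → Σᶠ (f i)) ≡ Σᶠ (λ j → Σᶠ (λ i → f i j))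
  Σᶠ-comm {zero}  {m} f = sym (trans (Σᶠ-const m 0) (*-zeroʳ m))
  Σᶠ-comm {suc n} f rewrite Σᶠ-comm (f ∘ suc) = sym (Σᶠ-+ (f zero) _)

  Σᶠ-average : Fin n → (g : Fin n → ℕ) → ∃[ e ] Σᶠ g ≤ n * g e
  Σᶠ-average {suc zero}    e g = zero , ≤-refl
  Σᶠ-average {suc (suc n)} e g with Σᶠ-average {suc n} zero (g ∘ suc)
  ... | e′ , h with ≤-total (g zero) (g (suc e′))
  ...   | inj₁ le = suc e′ , +-mono-≤ le h
  ...   | inj₂ ge = zero , +-monoʳ-≤ (g zero) (≤-trans h (*-monoʳ-≤ (suc n) ge))

Σᶠ-balance : {f g h k : Fin n → ℕ} → (∀ e → f e + g e ≡ h e + k e) → Σᶠ f + Σᶠ g ≡ Σᶠ h + Σᶠ k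
Σᶠ-balance {f = f} {g} {h} {k} eq =
  trans (sym (Σᶠ-+ f g)) (trans (Σᶠ-cong eq) (Σᶠ-+ h k))

Σᶠ-0 : {f : Fin n → ℕ} → (∀ e → f e ≡ 0) → Σᶠ f ≡ 0
Σᶠ-0 {n} {f} h = trans (Σᶠ-cong h) (trans (Σᶠ-const n 0) (*-zeroʳ n))

-- Linear functionals of a subset

⟦∧⟧ : ∀ a b → ⟦ a ∧ b ⟧ ≡ ⟦ a ⟧ * ⟦ b ⟧
⟦∧⟧ true  b = sym (+-identityʳ _)
⟦∧⟧ false b = refl

⟦not⟧ : ∀ a → ⟦ a ⟧ + ⟦ not a ⟧ ≡ 1
⟦not⟧ true  = refl
⟦not⟧ false = refl

⟦⟧≤1 : ∀ a → ⟦ a ⟧ ≤ 1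
⟦⟧≤1 true  = ≤-refl
⟦⟧≤1 false = z≤n

infix 4 _⊑_
_⊑_ : Subset n → Subset n → Set
A ⊑ B = ∀ e → lookup A e ≡ true → lookup B e ≡ true

⟦⟧-mono : ∀ {a b} → (a ≡ true → b ≡ true) → ⟦ a ⟧ ≤ ⟦ b ⟧
⟦⟧-mono {true}  h rewrite h refl = ≤-refl
⟦⟧-mono {false} h = z≤n

opaque

  -- Sizes, intersections with a fixed set and `position` are all instances, so the effect of a swap
  -- on each of them is computed once, in `lin-swap`.
  lin : (Fin n → ℕ) → Subset n → ℕ
  lin c A = Σᶠ λ e → ⟦ lookup A e ⟧ * c e

  sz co : Subset n → ℕ
  sz A = Σᶠ λ e → ⟦ lookup A e ⟧
  co A = Σᶠ λ e → ⟦ not (lookup A e) ⟧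

  I : Subset n → Subset n → ℕ
  I A B = Σᶠ λ e → ⟦ lookup A e ⟧ * ⟦ lookup B e ⟧

opaque
  unfolding lin sz co I

  sz+co : (A : Subset n) → sz A + co A ≡ n
  sz+co {n} A = trans (sym (Σᶠ-+ (λ e → ⟦ lookup A e ⟧) _))
    (trans (Σᶠ-cong (λ e → ⟦not⟧ (lookup A e))) (trans (Σᶠ-const n 1) (*-identityʳ n)))

  I-comm : (A B : Subset n) → I A B ≡ I B A
  I-comm A B = Σᶠ-cong λ e → *-comm ⟦ lookup A e ⟧ _

  sz≡lin : (A : Subset n) → lin (λ _ → 1) A ≡ sz A
  sz≡lin A = Σᶠ-cong λ e → *-identityʳ _

  I-self : (A : Subset n) → I A A ≡ sz A
  I-self A = Σᶠ-cong λ e → f (lookup A e)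
    where
    f : ∀ b → ⟦ b ⟧ * ⟦ b ⟧ ≡ ⟦ b ⟧
    f true  = refl
    f false = refl

  I≤sz : (A B : Subset n) → I A B ≤ sz A
  I≤sz A B = Σᶠ-mono λ e → ≤-trans (*-monoʳ-≤ ⟦ lookup A e ⟧ (⟦⟧≤1 (lookup B e))) (≤-reflexive (*-identityʳ _))

  sz≤n : (A : Subset n) → sz A ≤ n
  sz≤n A = subst (sz A ≤_) (sz+co A) (m≤m+n _ _)

opaque
  unfolding sz I

  sz-mono : {A B : Subset n} → A ⊑ B → sz A ≤ sz B
  sz-mono h = Σᶠ-mono λ e → ⟦⟧-mono (h e)

  sz-mono-< : {A B : Subset n} → A ⊑ B → ∀ e → lookup A e ≡ false → lookup B e ≡ true → sz A < sz B
  sz-mono-< {A = A} {B} h e Ae Be = Σᶠ-mono-< (λ e → ⟦⟧-mono (h e)) e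
    (subst₂ (λ a b → ⟦ a ⟧ < ⟦ b ⟧) (sym Ae) (sym Be) ≤-refl)

  I-monoˡ : {A B : Subset n} (C : Subset n) → A ⊑ B → I A C ≤ I B C
  I-monoˡ C h = Σᶠ-mono λ e → *-monoˡ-≤ ⟦ lookup C e ⟧ (⟦⟧-mono (h e))

opaque
  unfolding Σᶠ lin sz co I

  ∣∩∣≡I : (A B : Subset n) → ∣ A ∩ B ∣ ≡ I A B
  ∣∩∣≡I []      []      = refl
  ∣∩∣≡I (true ∷ A) (true ∷ B) = cong suc (∣∩∣≡I A B)
  ∣∩∣≡I (true ∷ A) (false ∷ B) = ∣∩∣≡I A B
  ∣∩∣≡I (false ∷ A) (b ∷ B) = ∣∩∣≡I A B

  co-[] : co [] ≡ 0
  co-[] = refl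

  co-in : (A : Subset n) → co (true ∷ A) ≡ co A
  co-in A = refl

  co-out : (A : Subset n) → co (false ∷ A) ≡ suc (co A)
  co-out A = refl

  sz-in : (A : Subset n) → sz (true ∷ A) ≡ suc (sz A)
  sz-in A = refl

  sz-out : (A : Subset n) → sz (false ∷ A) ≡ sz A
  sz-out A = refl

  I-in-in : (A B : Subset n) → I (true ∷ A) (true ∷ B) ≡ suc (I A B)
  I-in-in A B = refl

  I-in-out : (A B : Subset n) → I (true ∷ A) (false ∷ B) ≡ I A B
  I-in-out A B = refl

  I-out : (A : Subset n) (b : Bool) (B : Subset n) → I (false ∷ A) (b ∷ B) ≡ I A B
  I-out A b B = refl

  lin-upd : (c : Fin n → ℕ) (A : Subset n) (x : Fin n) (v : Bool) →
            lin c (A [ x ]≔ v) + ⟦ lookup A x ⟧ * c x ≡ lin c A + ⟦ v ⟧ * c x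
  lin-upd c (a ∷ A) zero    v = sw (⟦ v ⟧ * c zero) _ (⟦ a ⟧ * c zero)
    where
    sw : ∀ p q r → p + q + r ≡ r + q + p
    sw = solve-∀
  lin-upd c (a ∷ A) (suc x) v =
    trans (+-assoc (⟦ a ⟧ * c zero) _ _)
      (trans (cong (⟦ a ⟧ * c zero +_) (lin-upd (c ∘ suc) A x v)) (sym (+-assoc (⟦ a ⟧ * c zero) _ _)))

  between : {L U : Subset n} (k : ℕ) → L ⊑ U → sz L ≤ k → k ≤ sz U →
            ∃[ S ] L ⊑ S × S ⊑ U × sz S ≡ k
  between {L = []} {[]} zero h lo hi = [] , (λ ()) , (λ ()) , refl
  between {L = true ∷ L} {u ∷ U} k h lo hi with h zero refl
  between {L = true ∷ L} {u ∷ U} (suc k) h (s≤s lo) (s≤s hi) | refl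
    with between {L = L} {U} k (h ∘ suc) lo hi
  ... | S , a , b , c = true ∷ S , (λ { zero _ → refl ; (suc e) → a e }) , (λ { zero _ → refl ; (suc e) → b e }) , cong suc c
  between {L = false ∷ L} {false ∷ U} k h lo hi with between {L = L} {U} k (h ∘ suc) lo hi
  ... | S , a , b , c = false ∷ S , (λ { zero () ; (suc e) → a e }) , (λ { zero () ; (suc e) → b e }) , c
  between {L = false ∷ L} {true ∷ U} k h lo hi with k ≤? sz U
  ... | yes k≤ with between {L = L} {U} k (h ∘ suc) lo k≤
  ...   | S , a , b , c = false ∷ S , (λ { zero () ; (suc e) → a e }) , (λ { zero () ; (suc e) → b e }) , c
  between {L = false ∷ L} {true ∷ U} k h lo hi | no k≰ with between {L = L} {U} (sz U) (h ∘ suc) (sz-mono {A = L} {U} (h ∘ suc)) ≤-refl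
  ... | S , a , b , c = true ∷ S , (λ { zero _ → refl ; (suc e) → a e }) , (λ { zero _ → refl ; (suc e) → b e })
                      , trans (cong suc c) (≤-antisym (≰⇒> k≰) hi)

lookup-upd : (A : Subset n) (x : Fin n) (v : Bool) → lookup (A [ x ]≔ v) x ≡ v
lookup-upd A x v = lookup∘updateAt x A

lookup-upd′ : (A : Subset n) {x y : Fin n} (v : Bool) → y ≢ x → lookup (A [ x ]≔ v) y ≡ lookup A y
lookup-upd′ A {x} {y} v y≢x = lookup∘updateAt′ y x y≢x A

opaque

  swap : Fin n → Fin n → Subset n → Subset n
  swap i j A = (A [ i ]≔ lookup A j) [ j ]≔ lookup A i

module _ {i j : Fin n} (i≢j : i ≢ j) where

  opaque
    unfolding swap

    swap-i : ∀ A → lookup (swap i j A) i ≡ lookup A j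
    swap-i A = trans (lookup-upd′ (A [ i ]≔ lookup A j) _ i≢j) (lookup-upd A i _)

    swap-j : ∀ A → lookup (swap i j A) j ≡ lookup A i
    swap-j A = lookup-upd (A [ i ]≔ lookup A j) j _

    swap-o : ∀ A {e} → e ≢ i → e ≢ j → lookup (swap i j A) e ≡ lookup A e
    swap-o A e≢i e≢j = trans (lookup-upd′ (A [ i ]≔ lookup A j) _ e≢j) (lookup-upd′ A _ e≢i)

    lin-swap : ∀ c A → lin c (swap i j A) + (⟦ lookup A i ⟧ * c i + ⟦ lookup A j ⟧ * c j)
                     ≡ lin c A + (⟦ lookup A j ⟧ * c i + ⟦ lookup A i ⟧ * c j)
    lin-swap c A = f {s = lin c (swap i j A)} {lin c (A [ i ]≔ lookup A j)} {lin c A}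
        {⟦ lookup A i ⟧ * c i} {⟦ lookup A j ⟧ * c i} {⟦ lookup A j ⟧ * c j} {⟦ lookup A i ⟧ * c j}
      (lin-upd c A i (lookup A j))
      (subst (λ b → lin c (swap i j A) + ⟦ b ⟧ * c j ≡ lin c (A [ i ]≔ lookup A j) + ⟦ lookup A i ⟧ * c j)
        (lookup-upd′ A _ (i≢j ∘ sym)) (lin-upd c (A [ i ]≔ lookup A j) j (lookup A i)))
      where
      f : ∀ {s u l p q r t} → u + p ≡ l + q → s + r ≡ u + t → s + (p + r) ≡ l + (q + t)
      f {s} {u} {l} {p} {q} {r} {t} e₁ e₂ = begin
        s + (p + r) ≡⟨ g s p r ⟩
        (s + r) + p ≡⟨ cong (_+ p) e₂ ⟩
        (u + t) + p ≡⟨ h u t p ⟩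
        (u + p) + t ≡⟨ cong (_+ t) e₁ ⟩
        (l + q) + t ≡⟨ +-assoc l q t ⟩
        l + (q + t) ∎
        where
        open ≡-Reasoning
        g : ∀ s p r → s + (p + r) ≡ (s + r) + p
        g = solve-∀
        h : ∀ u t p → (u + t) + p ≡ (u + p) + t
        h = solve-∀

  swap-involutive : ∀ A → swap i j (swap i j A) ≡ A
  swap-involutive A = vec-ext go
    where
    go : ∀ e → lookup (swap i j (swap i j A)) e ≡ lookup A e
    go e with e Fin.≟ i | e Fin.≟ j
    ... | yes refl | _        = trans (swap-i (swap i j A)) (swap-j A)
    ... | no  _    | yes refl = trans (swap-j (swap i j A)) (swap-i A)
    ... | no  e≢i  | no  e≢j  = trans (swap-o (swap i j A) e≢i e≢j) (swap-o A e≢i e≢j)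

  sz-swap : ∀ A → sz (swap i j A) ≡ sz A
  sz-swap A = +-cancelʳ-≡ (⟦ lookup A i ⟧ * 1 + ⟦ lookup A j ⟧ * 1) _ _
    (trans (cong (_+ (⟦ lookup A i ⟧ * 1 + ⟦ lookup A j ⟧ * 1)) (sym (sz≡lin (swap i j A))))
      (trans (lin-swap (λ _ → 1) A)
        (cong₂ _+_ (sz≡lin A) (+-comm (⟦ lookup A j ⟧ * 1) _))))

  co-swap : ∀ A → co (swap i j A) ≡ co A
  co-swap A = +-cancelˡ-≡ (sz A) _ _
    (trans (cong (_+ co (swap i j A)) (sym (sz-swap A))) (trans (sz+co (swap i j A)) (sym (sz+co A))))

  lin-move : ∀ c A → lookup A i ≡ true → lookup A j ≡ false → lin c (swap i j A) + c i ≡ lin c A + c j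
  lin-move c A Ai Aj with lin-swap c A
  ... | eq rewrite Ai | Aj | +-identityʳ (c i) | +-identityʳ (c j) | +-identityʳ (c i) = eq

swap-sym : {i j : Fin n} → i ≢ j → ∀ A → swap j i A ≡ swap i j A
swap-sym {i = i} {j} i≢j A = vec-ext go
  where
  j≢i : j ≢ i
  j≢i = i≢j ∘ sym
  go : ∀ e → lookup (swap j i A) e ≡ lookup (swap i j A) e
  go e with e Fin.≟ i | e Fin.≟ j
  ... | yes refl | _        = trans (swap-j j≢i A) (sym (swap-i i≢j A))
  ... | no  _    | yes refl = trans (swap-i j≢i A) (sym (swap-j i≢j A))
  ... | no  e≢i  | no  e≢j  = trans (swap-o j≢i A e≢j e≢i) (sym (swap-o i≢j A e≢i e≢j))

opaque

  flip : Subset n → Subset n → Subset n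
  flip M A = zipWith _xor_ M A

  lookup-flip : (M A : Subset n) (e : Fin n) → lookup (flip M A) e ≡ (lookup M e) xor (lookup A e)
  lookup-flip M A e = lookup-zipWith _xor_ e M A

flip-involutive : (M A : Subset n) → flip M (flip M A) ≡ A
flip-involutive M A = vec-ext λ e →
  trans (lookup-flip M (flip M A) e) (trans (cong (lookup M e xor_) (lookup-flip M A e)) (f (lookup M e) (lookup A e)))
  where
  f : ∀ m a → m xor (m xor a) ≡ a
  f true  true  = refl
  f true  false = refl
  f false a     = refl

infixl 6 _∖_
_∖_ : Subset n → Subset n → Subset n
K ∖ A = zipWith (λ x y → x ∧ not y) K A

lookup-∖ : (K A : Subset n) (e : Fin n) → lookup (K ∖ A) e ≡ lookup K e ∧ not (lookup A e)
lookup-∖ K A e = lookup-zipWith _ e K A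

⊥ˢ : Subset n
⊥ˢ {n} = tabulate {n = n} λ _ → false

opaque
  unfolding sz I

  -- The points of K outside A are used first. Either they suffice and S avoids A, or S contains all
  -- of them and its overlap with A is determined by sizes.
  minimal-overlap : (K A : Subset n) (k : ℕ) → k ≤ sz K →
    ∃[ S ] S ⊑ K × sz S ≡ k × (I S A ≡ 0 ⊎ I S A + sz K ≡ k + I A K)
  minimal-overlap K A k k≤ with sz (K ∖ A) ≤? k
  ... | yes ≤k with between {L = K ∖ A} {K} k (λ e → proj₁ ∘ ∧-split ∘ trans (sym (lookup-∖ K A e))) ≤k k≤
  ...   | S , D⊑S , S⊑K , eq = S , S⊑K , eq , inj₂ (trans (Σᶠ-balance {h = λ e → ⟦ lookup S e ⟧} λ e →
            f (lookup S e) (lookup A e) (lookup K e) (S⊑K e) (λ kt af → D⊑S e (trans (lookup-∖ K A e) (g kt af))))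
            (cong (_+ I A K) eq))
    where
    g : ∀ {k a} → k ≡ true → a ≡ false → k ∧ not a ≡ true
    g refl refl = refl
    f : ∀ s a k → (s ≡ true → k ≡ true) → (k ≡ true → a ≡ false → s ≡ true) →
        ⟦ s ⟧ * ⟦ a ⟧ + ⟦ k ⟧ ≡ ⟦ s ⟧ + ⟦ a ⟧ * ⟦ k ⟧
    f false a     false p q = sym (*-zeroʳ ⟦ a ⟧)
    f true  a     false p q with () ← p refl
    f false true  true  p q = refl
    f true  true  true  p q = refl
    f true  false true  p q = refl
    f false false true  p q with () ← q refl refl
  minimal-overlap {n} K A k k≤ | no ≰k with between {L = ⊥ˢ} {K ∖ A} k (λ e h → ⊥-elim (true≢false h (lookup∘tabulate _ e)))
        (≤-trans (≤-reflexive (Σᶠ-0 λ e → cong ⟦_⟧ (lookup∘tabulate _ e))) z≤n) (<⇒≤ (≰⇒> ≰k))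
  ...   | S , _ , S⊑D , eq = S , (λ e h → proj₁ (d e h)) , eq , inj₁ (Σᶠ-0 λ e → f (lookup S e) (lookup A e) (λ h → proj₂ (d e h)))
    where
    d : ∀ e → lookup S e ≡ true → lookup K e ≡ true × not (lookup A e) ≡ true
    d e h = ∧-split (trans (sym (lookup-∖ K A e)) (S⊑D e h))
    f : ∀ s a → (s ≡ true → not a ≡ true) → ⟦ s ⟧ * ⟦ a ⟧ ≡ 0
    f false a p = refl
    f true true p with () ← p refl
    f true false p = refl

-- Sums over subsets

infix 5 _==_
_==_ : Subset n → Subset n → Bool
[]      == []      = true
(a ∷ A) == (b ∷ B) = not (a xor b) ∧ (A == B)

==-refl : (A : Subset n) → A == A ≡ true
==-refl []          = refl
==-refl (true ∷ A)  = ==-refl A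
==-refl (false ∷ A) = ==-refl A

==-sound : (A B : Subset n) → A == B ≡ true → A ≡ B
==-sound []          []          _ = refl
==-sound (true ∷ A)  (true ∷ B)  h = cong (true ∷_) (==-sound A B h)
==-sound (false ∷ A) (false ∷ B) h = cong (false ∷_) (==-sound A B h)

opaque

  Σˢ : (Subset n → ℕ) → ℕ
  Σˢ {zero}  f = f []
  Σˢ {suc n} f = Σˢ (λ A → f (inside ∷ A)) + Σˢ (λ A → f (outside ∷ A))

  Σˢ-cong : {f g : Subset n → ℕ} → (∀ A → f A ≡ g A) → Σˢ f ≡ Σˢ g
  Σˢ-cong {zero}  h = h []
  Σˢ-cong {suc n} h = cong₂ _+_ (Σˢ-cong (h ∘ (inside ∷_))) (Σˢ-cong (h ∘ (outside ∷_)))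

  Σˢ-mono : {f g : Subset n → ℕ} → (∀ A → f A ≤ g A) → Σˢ f ≤ Σˢ g
  Σˢ-mono {zero}  h = h []
  Σˢ-mono {suc n} h = +-mono-≤ (Σˢ-mono (h ∘ (inside ∷_))) (Σˢ-mono (h ∘ (outside ∷_)))

  Σˢ-mono-< : {f g : Subset n → ℕ} → (∀ A → f A ≤ g A) → ∀ A → f A < g A → Σˢ f < Σˢ g
  Σˢ-mono-< h []          lt = lt
  Σˢ-mono-< h (true ∷ A)  lt = +-mono-<-≤ (Σˢ-mono-< (h ∘ (inside ∷_)) A lt) (Σˢ-mono (h ∘ (outside ∷_)))
  Σˢ-mono-< h (false ∷ A) lt = +-mono-≤-< (Σˢ-mono (h ∘ (inside ∷_))) (Σˢ-mono-< (h ∘ (outside ∷_)) A lt)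

  Σˢ-+ : (f g : Subset n → ℕ) → Σˢ (λ A → f A + g A) ≡ Σˢ f + Σˢ g
  Σˢ-+ {zero}  f g = refl
  Σˢ-+ {suc n} f g = trans
    (cong₂ _+_ (Σˢ-+ (f ∘ (inside ∷_)) (g ∘ (inside ∷_))) (Σˢ-+ (f ∘ (outside ∷_)) (g ∘ (outside ∷_))))
    (interchange (Σˢ (f ∘ (inside ∷_))) (Σˢ (g ∘ (inside ∷_))) _ _)

  Σˢ-*ˡ : ∀ c (f : Subset n → ℕ) → Σˢ (λ A → c * f A) ≡ c * Σˢ f
  Σˢ-*ˡ {zero}  c f = refl
  Σˢ-*ˡ {suc n} c f = trans (cong₂ _+_ (Σˢ-*ˡ c (f ∘ (inside ∷_))) (Σˢ-*ˡ c (f ∘ (outside ∷_))))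
    (sym (*-distribˡ-+ c (Σˢ (f ∘ (inside ∷_))) _))

  Σˢ-0 : {f : Subset n → ℕ} → (∀ A → f A ≡ 0) → Σˢ f ≡ 0
  Σˢ-0 {zero}  h = h []
  Σˢ-0 {suc n} h = cong₂ _+_ (Σˢ-0 (h ∘ (inside ∷_))) (Σˢ-0 (h ∘ (outside ∷_)))

  Σˢ-comm : ∀ {m} (f : Subset n → Subset m → ℕ) → Σˢ (λ A → Σˢ (f A)) ≡ Σˢ (λ B → Σˢ (λ A → f A B))
  Σˢ-comm {m = zero}  f = refl
  Σˢ-comm {m = suc m} f = trans (Σˢ-+ (λ A → Σˢ (f A ∘ (inside ∷_))) _) (cong₂ _+_ (Σˢ-comm (λ A → f A ∘ (inside ∷_))) (Σˢ-comm (λ A → f A ∘ (outside ∷_))))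

  Σˢ-term : (f : Subset n → ℕ) (A : Subset n) → f A ≤ Σˢ f
  Σˢ-term f []          = ≤-refl
  Σˢ-term f (true ∷ A)  = ≤-trans (Σˢ-term (f ∘ (inside ∷_)) A) (m≤m+n _ _)
  Σˢ-term f (false ∷ A) = ≤-trans (Σˢ-term (f ∘ (outside ∷_)) A) (m≤n+m _ _)

  Σˢ-== : (A : Subset n) (c : ℕ) → Σˢ (λ B → ⟦ B == A ⟧ * c) ≡ c
  Σˢ-== []          c = +-identityʳ c
  Σˢ-== {suc n} (true ∷ A)  c = trans (cong₂ _+_ (Σˢ-== A c) (Σˢ-0 {n} {f = λ _ → 0} (λ _ → refl))) (+-identityʳ c)
  Σˢ-== {suc n} (false ∷ A) c = cong₂ _+_ (Σˢ-0 {n} {f = λ _ → 0} (λ _ → refl)) (Σˢ-== A c)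


  Σˢ-Σᶠ : ∀ {m} (f : Subset n → Fin m → ℕ) → Σˢ (λ A → Σᶠ (f A)) ≡ Σᶠ (λ e → Σˢ (λ A → f A e))
  Σˢ-Σᶠ {zero}  f = refl
  Σˢ-Σᶠ {suc n} f = trans (cong₂ _+_ (Σˢ-Σᶠ (f ∘ (inside ∷_))) (Σˢ-Σᶠ (f ∘ (outside ∷_)))) (sym (Σᶠ-+ (λ e → Σˢ (λ A → f (inside ∷ A) e)) _))

  Σˢ-suc : (f : Subset (suc n) → ℕ) → Σˢ f ≡ Σˢ (λ A → f (inside ∷ A)) + Σˢ (λ A → f (outside ∷ A))
  Σˢ-suc f = refl

  Σˢ-[] : (f : Subset 0 → ℕ) → Σˢ f ≡ f []
  Σˢ-[] f = refl

Σˢ-select : (f : Subset n → ℕ) (A : Subset n) → Σˢ (λ B → ⟦ B == A ⟧ * f B) ≡ f A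
Σˢ-select f A = trans (Σˢ-cong λ B → g B (B == A) refl) (Σˢ-== A (f A))
  where
  g : ∀ B b → B == A ≡ b → ⟦ b ⟧ * f B ≡ ⟦ b ⟧ * f A
  g B true  eq rewrite ==-sound B A eq = refl
  g B false eq = refl

-- Both sides are sums of f B over the pairs with B = π A, a relation that the involution makes
-- symmetric. Swaps, flips and the toggling of zero are reindexed this way.
Σˢ-involution : (π : Subset n → Subset n) → (∀ A → π (π A) ≡ A) → (f : Subset n → ℕ) → Σˢ (f ∘ π) ≡ Σˢ f
Σˢ-involution π inv f = begin
  Σˢ (λ A → f (π A)) ≡⟨ Σˢ-cong (λ A → sym (Σˢ-select f (π A))) ⟩
  Σˢ (λ A → Σˢ (λ B → ⟦ B == π A ⟧ * f B)) ≡⟨ Σˢ-comm (λ A B → ⟦ B == π A ⟧ * f B) ⟩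
  Σˢ (λ B → Σˢ (λ A → ⟦ B == π A ⟧ * f B)) ≡⟨ Σˢ-cong (λ B → Σˢ-cong (λ A → cong (λ b → ⟦ b ⟧ * f B) (flp A B))) ⟩
  Σˢ (λ B → Σˢ (λ A → ⟦ A == π B ⟧ * f B)) ≡⟨ Σˢ-cong (λ B → Σˢ-== (π B) (f B)) ⟩
  Σˢ f ∎
  where
  open ≡-Reasoning
  half : ∀ A B → A == π B ≡ true → B == π A ≡ true
  half A B h rewrite ==-sound A (π B) h | inv B = ==-refl B
  flp : ∀ A B → (B == π A) ≡ (A == π B)
  flp A B = Bool-ext (half B A) (half A B)

-- For shifting, which moves weight inside an orbit {A, π A} and so is monotone only on the orbit as
-- a whole.
Σˢ-pair-mono : (π : Subset n → Subset n) → (∀ A → π (π A) ≡ A) → {f g : Subset n → ℕ} →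
  (∀ A → f A + f (π A) ≤ g A + g (π A)) → Σˢ f ≤ Σˢ g
Σˢ-pair-mono π inv {f} {g} h = *-cancelˡ-≤ 2 (begin
  2 * Σˢ f ≡⟨ dbl f ⟩
  Σˢ (λ A → f A + f (π A)) ≤⟨ Σˢ-mono h ⟩
  Σˢ (λ A → g A + g (π A)) ≡⟨ dbl g ⟨
  2 * Σˢ g ∎)
  where
  open ≤-Reasoning
  dbl : ∀ f → 2 * Σˢ f ≡ Σˢ (λ A → f A + f (π A))
  dbl f = trans (cong (Σˢ f +_) (trans (+-identityʳ _) (sym (Σˢ-involution π inv f)))) (sym (Σˢ-+ f (f ∘ π)))

Σˢ-pair-mono-< : (π : Subset n → Subset n) → (∀ A → π (π A) ≡ A) → {f g : Subset n → ℕ} →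
  (∀ A → f A + f (π A) ≤ g A + g (π A)) → ∀ A → f A + f (π A) < g A + g (π A) → Σˢ f < Σˢ g
Σˢ-pair-mono-< π inv {f} {g} h A lt = *-cancelˡ-< 2 (Σˢ f) (Σˢ g) (begin-strict
  2 * Σˢ f ≡⟨ dbl f ⟩
  Σˢ (λ A → f A + f (π A)) <⟨ Σˢ-mono-< h A lt ⟩
  Σˢ (λ A → g A + g (π A)) ≡⟨ dbl g ⟨
  2 * Σˢ g ∎)
  where
  open ≤-Reasoning
  dbl : ∀ f → 2 * Σˢ f ≡ Σˢ (λ A → f A + f (π A))
  dbl f = trans (cong (Σˢ f +_) (trans (+-identityʳ _) (sym (Σˢ-involution π inv f)))) (sym (Σˢ-+ f (f ∘ π)))

-- Binomial transform

-- Pascal's form of Σⱼ (x choose j) f(j).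
bt : (ℕ → ℕ) → ℕ → ℕ
bt f zero    = f zero
bt f (suc x) = bt f x + bt (f ∘ suc) x

bt-cong : ∀ {f g} → (∀ j → f j ≡ g j) → ∀ x → bt f x ≡ bt g x
bt-cong h zero    = h zero
bt-cong h (suc x) = cong₂ _+_ (bt-cong h x) (bt-cong (h ∘ suc) x)

bt-+ : ∀ f g x → bt (λ j → f j + g j) x ≡ bt f x + bt g x
bt-+ f g zero    = refl
bt-+ f g (suc x) = trans (cong₂ _+_ (bt-+ f g x) (bt-+ (f ∘ suc) (g ∘ suc) x))
  (interchange (bt f x) (bt g x) (bt (f ∘ suc) x) (bt (g ∘ suc) x))

bt-* : ∀ c f x → bt (λ j → c * f j) x ≡ c * bt f x
bt-* c f zero    = refl
bt-* c f (suc x) = trans (cong₂ _+_ (bt-* c f x) (bt-* c (f ∘ suc) x)) (sym (*-distribˡ-+ c (bt f x) _))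

f0≤bt : ∀ f x → f 0 ≤ bt f x
f0≤bt f zero    = ≤-refl
f0≤bt f (suc x) = ≤-trans (f0≤bt f x) (m≤m+n _ _)

-- The transform only adds values, so it preserves any relation closed under addition. The bound j ≤
-- x leaves room for an induction on x.
bt-cone : (P : ℕ → ℕ → ℕ → Set) →
  (∀ {p q s p′ q′ s′} → P p q s → P p′ q′ s′ → P (p + p′) (q + q′) (s + s′)) →
  ∀ x {f g h} → (∀ j → j ≤ x → P (f j) (g j) (h j)) → P (bt f x) (bt g x) (bt h x)
bt-cone P P+ zero    H = H 0 z≤n
bt-cone P P+ (suc x) H = P+ (bt-cone P P+ x (λ j j≤x → H j (m≤n⇒m≤1+n j≤x)))
                            (bt-cone P P+ x (λ j j≤x → H (suc j) (s≤s j≤x)))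

-- Telescoping for a decreasing quotient g / f, cross-multiplied. Only f is cancelled: g may vanish,
-- as the differences Δ in `T-gap` may.
ratio-mono : ∀ (f g : ℕ → ℕ) x d → (∀ j → x ≤ j → 0 < f j) →
  (∀ j → x ≤ j → j < d + x → f j * g (suc j) ≤ f (suc j) * g j) →
  f x * g (d + x) ≤ f (d + x) * g x
ratio-mono f g x zero    pos adj = ≤-refl
ratio-mono f g x (suc d) pos adj = *-cancelˡ-≤ (f (d + x)) {{>-nonZero (pos (d + x) (m≤n+m x d))}} (begin
  f (d + x) * (f x * g (suc d + x)) ≡⟨ e₁ (f (d + x)) (f x) (g (suc d + x)) ⟩
  f x * (f (d + x) * g (suc d + x)) ≤⟨ *-monoʳ-≤ (f x) (adj (d + x) (m≤n+m x d) ≤-refl) ⟩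
  f x * (f (suc d + x) * g (d + x)) ≡⟨ e₁ (f x) (f (suc d + x)) (g (d + x)) ⟩
  f (suc d + x) * (f x * g (d + x)) ≤⟨ *-monoʳ-≤ (f (suc d + x)) (ratio-mono f g x d pos (λ j a b → adj j a (m≤n⇒m≤1+n b))) ⟩
  f (suc d + x) * (f (d + x) * g x) ≡⟨ e₁ (f (suc d + x)) (f (d + x)) (g x) ⟩
  f (d + x) * (f (suc d + x) * g x) ∎)
  where
  open ≤-Reasoning
  e₁ : ∀ a b c → a * (b * c) ≡ b * (a * c)
  e₁ = solve-∀

square-AMGM : ∀ a b → 2 * (a * b) ≤ a * a + b * b
square-AMGM a b with ≤-total a b
... | inj₁ a≤b = subst (λ b → 2 * (a * b) ≤ a * a + b * b) (m+[n∸m]≡n a≤b) (≤-from (d * d) (z≤n {0}) (e a d))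
  where
  d = b ∸ a
  e : ∀ a d → a * a + (a + d) * (a + d) + 0 ≡ 2 * (a * (a + d)) + 0 + d * d
  e = solve-∀
... | inj₂ b≤a = subst (λ a → 2 * (a * b) ≤ a * a + b * b) (m+[n∸m]≡n b≤a) (≤-from (d * d) (z≤n {0}) (e b d))
  where
  d = a ∸ b
  e : ∀ b d → (b + d) * (b + d) + b * b + 0 ≡ 2 * ((b + d) * b) + 0 + d * d
  e = solve-∀

-- For p, q, s the mass and the first two moments of a measure, this says that the variance s / p -
-- (q / p)² is at least 1.
Cone : ℕ → ℕ → ℕ → Set
Cone p q s = 0 < p × q * q + p * p ≤ p * s

-- The variance of a mixture is the mean of the variances plus the variance of the means; after
-- clearing denominators the latter is the square of q p′ - q′ p.
Cone-+ : ∀ {p q s p′ q′ s′} → Cone p q s → Cone p′ q′ s′ → Cone (p + p′) (q + q′) (s + s′)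
Cone-+ {p} {q} {s} {p′} {q′} {s′} (0<p , h) (0<p′ , h′) = ≤-trans 0<p (m≤m+n p p′) ,
  *-cancelˡ-≤ (p * p′) {{m*n≢0 p p′ {{>-nonZero 0<p}} {{>-nonZero 0<p′}}}}
    (≤-from {p = (q * q + p * p) * (p * p′ + p′ * p′) + (q′ * q′ + p′ * p′) * (p * p′ + p * p) + 2 * ((q * p′) * (q′ * p))}
            {q = (p * s) * (p * p′ + p′ * p′) + (p′ * s′) * (p * p′ + p * p) + ((q * p′) * (q * p′) + (q′ * p) * (q′ * p))}
      0 (+-mono-≤ (+-mono-≤ (*-monoˡ-≤ (p * p′ + p′ * p′) h) (*-monoˡ-≤ (p * p′ + p * p) h′)) (square-AMGM (q * p′) (q′ * p)))
      (e p q s p′ q′ s′))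
  where
  e : ∀ p q s p′ q′ s′ →
    p * p′ * ((p + p′) * (s + s′)) + ((q * q + p * p) * (p * p′ + p′ * p′) + (q′ * q′ + p′ * p′) * (p * p′ + p * p) + 2 * ((q * p′) * (q′ * p)))
    ≡ p * p′ * ((q + q′) * (q + q′) + (p + p′) * (p + p′)) + ((p * s) * (p * p′ + p′ * p′) + (p′ * s′) * (p * p′ + p * p) + ((q * p′) * (q * p′) + (q′ * p) * (q′ * p))) + 0
  e = solve-∀

-- Binomial coefficients and the transform as a sum

bin : ℕ → ℕ → ℕ
bin n       zero    = 1
bin zero    (suc k) = 0
bin (suc n) (suc k) = bin n k + bin n (suc k)

bin-absorb : ∀ n k → suc k * bin (suc n) (suc k) ≡ suc n * bin n k
bin-absorb zero    zero    = refl
bin-absorb zero    (suc k) = *-zeroʳ (suc (suc k))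
bin-absorb (suc n) zero    = trans (*-identityˡ (bin (suc (suc n)) 1))
  (cong suc (trans (sym (*-identityˡ (bin (suc n) 1))) (bin-absorb n zero)))
bin-absorb (suc n) (suc k) = f (bin n k) (bin n (suc k)) (bin n (suc (suc k))) n k (bin-absorb n k) (bin-absorb n (suc k))
  where
  f : ∀ a b c n k → suc k * (a + b) ≡ suc n * a → suc (suc k) * (b + c) ≡ suc n * b →
      suc (suc k) * ((a + b) + (b + c)) ≡ suc (suc n) * (a + b)
  f a b c n k h₁ h₂ = trans (g a b c k) (trans (cong₂ (λ u v → u + v + (a + b)) h₁ h₂) (i a b n))
    where
    g : ∀ a b c k → suc (suc k) * ((a + b) + (b + c)) ≡ suc k * (a + b) + suc (suc k) * (b + c) + (a + b)
    g = solve-∀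
    i : ∀ a b n → suc n * a + suc n * b + (a + b) ≡ suc (suc n) * (a + b)
    i = solve-∀

bin-absorb′ : ∀ m k → suc m * bin (suc (m + k)) k ≡ suc (m + k) * bin (m + k) k
bin-absorb′ m zero    rewrite +-identityʳ m = refl
bin-absorb′ m (suc k) = +-cancelˡ-≡ (suc (m + suc k) * bin (m + suc k) k) _ _ (begin
  N * bin (m + suc k) k + suc m * (bin (m + suc k) k + bin (m + suc k) (suc k))
    ≡⟨ cong (_+ suc m * (bin (m + suc k) k + bin (m + suc k) (suc k))) (bin-absorb (m + suc k) k) ⟨
  suc k * (bin (m + suc k) k + bin (m + suc k) (suc k)) + suc m * (bin (m + suc k) k + bin (m + suc k) (suc k))
    ≡⟨ e m k (bin (m + suc k) k + bin (m + suc k) (suc k)) ⟩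
  suc (m + suc k) * (bin (m + suc k) k + bin (m + suc k) (suc k))
    ≡⟨ *-distribˡ-+ N (bin (m + suc k) k) _ ⟩
  N * bin (m + suc k) k + N * bin (m + suc k) (suc k) ∎)
  where
  open ≡-Reasoning
  N = suc (m + suc k)
  e : ∀ m k b → suc k * b + suc m * b ≡ suc (m + suc k) * b
  e = solve-∀

bin-0 : ∀ n k → n < k → bin n k ≡ 0
bin-0 zero    (suc k) _         = refl
bin-0 (suc n) (suc k) (s≤s n<k) rewrite bin-0 n k n<k | bin-0 n (suc k) (m≤n⇒m≤1+n n<k) = refl

∑ : ℕ → (ℕ → ℕ) → ℕ
∑ N f = Σᶠ {N} (f ∘ toℕ)

∑-suc : ∀ N f → ∑ (suc N) f ≡ f 0 + ∑ N (f ∘ suc)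
∑-suc N f = Σᶠ-suc (f ∘ toℕ)

-- The range N is left free so that `Mean` can compare X with X + 1 over a common range. For k > X
-- the coefficient vanishes, which makes the truncated subtraction harmless.
bt-∑ : ∀ A X N → X < N → bt A X ≡ ∑ N (λ k → bin X k * A (X ∸ k))
bt-∑ A zero    (suc N) _         = sym (trans (∑-suc N (λ k → bin 0 k * A (0 ∸ k)))
  (trans (cong (A 0 + 0 +_) (Σᶠ-0 {N} (λ _ → refl))) (trans (+-identityʳ _) (+-identityʳ _))))
bt-∑ A (suc X) (suc N) (s≤s X<N) = sym (begin
  ∑ (suc N) (λ k → bin (suc X) k * A (suc X ∸ k))
    ≡⟨ ∑-suc N (λ k → bin (suc X) k * A (suc X ∸ k)) ⟩
  1 * A (suc X) + ∑ N (λ k → (bin X k + bin X (suc k)) * A (X ∸ k))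
    ≡⟨ cong (1 * A (suc X) +_) (trans (Σᶠ-cong (λ e → *-distribʳ-+ (A (X ∸ toℕ e)) (bin X (toℕ e)) _)) (Σᶠ-+ {N} _ _)) ⟩
  1 * A (suc X) + (∑ N (λ k → bin X k * A (X ∸ k)) + ∑ N (λ k → bin X (suc k) * A (X ∸ k)))
    ≡⟨ e (1 * A (suc X)) (∑ N (λ k → bin X k * A (X ∸ k))) _ ⟩
  ∑ N (λ k → bin X k * A (X ∸ k)) + (1 * A (suc X) + ∑ N (λ k → bin X (suc k) * A (X ∸ k)))
    ≡⟨ cong₂ _+_ (sym (bt-∑ A X N X<N)) (sym (∑-suc N (λ k → bin X k * A (suc X ∸ k)))) ⟩
  bt A X + ∑ (suc N) (λ k → bin X k * A (suc X ∸ k))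
    ≡⟨ cong (bt A X +_) (Σᶠ-cong {suc N} (λ k → g (toℕ k))) ⟩
  bt A X + ∑ (suc N) (λ k → bin X k * A (suc (X ∸ k)))
    ≡⟨ cong (bt A X +_) (bt-∑ (A ∘ suc) X (suc N) (m≤n⇒m≤1+n X<N)) ⟨
  bt A X + bt (A ∘ suc) X ∎)
  where
  open ≡-Reasoning
  e : ∀ a b c → a + (b + c) ≡ b + (a + c)
  e = solve-∀
  g : ∀ k → bin X k * A (suc X ∸ k) ≡ bin X k * A (suc (X ∸ k))
  g k with k ≤? X
  ... | yes k≤X rewrite +-∸-assoc 1 k≤X = refl
  ... | no  k≰X rewrite bin-0 X k (≰⇒> k≰X) = refl

bt-∑-proper : ∀ A X N → X < N → bt A (suc X) ≡ A (suc X) + ∑ N (λ k → bin (suc X) (suc k) * A (X ∸ k))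
bt-∑-proper A X N X<N = trans (bt-∑ A (suc X) (suc N) (s≤s X<N))
  (trans (∑-suc N (λ k → bin (suc X) k * A (suc X ∸ k))) (cong (_+ ∑ N (λ k → bin (suc X) (suc k) * A (X ∸ k))) (*-identityˡ (A (suc X)))))

Σᶠ-product : ∀ {n} (f g : Fin n → ℕ) → Σᶠ f * Σᶠ g ≡ Σᶠ (λ i → Σᶠ (λ j → f i * g j))
Σᶠ-product f g = trans (sym (Σᶠ-*ʳ f (Σᶠ g))) (Σᶠ-cong λ i →
  trans (*-comm (f i) (Σᶠ g)) (trans (sym (Σᶠ-*ʳ g (f i))) (Σᶠ-cong λ j → *-comm (g j) (f i))))

Σᶠ-transpose : ∀ {n} (f : Fin n → Fin n → ℕ) → Σᶠ (λ i → Σᶠ (λ j → f i j + f j i)) ≡ 2 * Σᶠ (λ i → Σᶠ (f i))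
Σᶠ-transpose f = trans (Σᶠ-cong λ i → Σᶠ-+ (f i) (λ j → f j i))
  (trans (Σᶠ-+ (λ i → Σᶠ (f i)) _)
    (cong (Σᶠ (λ i → Σᶠ (f i)) +_) (trans (sym (Σᶠ-comm f)) (sym (+-identityʳ _)))))

-- The symmetrisation of Chebyshev's sum inequality: only the two terms of each unordered pair have
-- to be compared.
Σᶠ-pairwise : ∀ {n} (f g : Fin n → Fin n → ℕ) → (∀ i j → f i j + f j i ≤ g i j + g j i) →
              Σᶠ (λ i → Σᶠ (f i)) ≤ Σᶠ (λ i → Σᶠ (g i))
Σᶠ-pairwise f g h = *-cancelˡ-≤ 2 (subst₂ _≤_ (Σᶠ-transpose f) (Σᶠ-transpose g)
  (Σᶠ-mono λ i → Σᶠ-mono λ j → h i j))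

-- In exponential generating function terms, A/i! is log-concave, and the claim
-- compares the coefficients of (eᵘ − 1) A and eᵘ A: the mean of 1/(k + 1) over the
-- weights (X choose k) A(X ∸ k) decreases with X, these weights having monotone
-- likelihood ratio.
module Mean (A : ℕ → ℕ) (A>0 : ∀ j → 0 < A j) (X : ℕ)
            (H : ∀ m → m < X → suc m * A m * A (suc (suc m)) ≤ suc (suc m) * A (suc m) * A (suc m)) where

  p q P Q : ℕ → ℕ
  p k = bin X k * A (X ∸ k)
  q k = bin (suc X) k * A (suc X ∸ k)
  P k = bin (suc X) (suc k) * A (X ∸ k)
  Q k = bin (suc (suc X)) (suc k) * A (suc X ∸ k)

  N : ℕ
  N = suc (suc X)

  P-absorb : ∀ k → suc k * P k ≡ suc X * p k
  P-absorb k = trans (sym (*-assoc (suc k) (bin (suc X) (suc k)) _))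
    (trans (cong (_* A (X ∸ k)) (bin-absorb X k)) (*-assoc (suc X) (bin X k) _))

  Q-absorb : ∀ k → suc k * Q k ≡ suc (suc X) * q k
  Q-absorb k = trans (sym (*-assoc (suc k) (bin (suc (suc X)) (suc k)) _))
    (trans (cong (_* A (suc X ∸ k)) (bin-absorb (suc X) k)) (*-assoc (suc (suc X)) (bin (suc X) k) _))

  chain : ∀ m m′ → m ≤ m′ → m′ ≤ X → suc m * A m * A (suc m′) ≤ suc m′ * A m′ * A (suc m)
  chain m m′ m≤m′ m′≤X = subst (λ m′ → suc m * A m * A (suc m′) ≤ suc m′ * A m′ * A (suc m)) (m∸n+n≡m m≤m′)
    (ratio-mono (λ m → suc m * A m) (A ∘ suc) m (m′ ∸ m)
      (λ j _ → *-mono-≤ (s≤s (z≤n {j})) (A>0 j))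
      (λ j _ j< → H j (≤-trans (subst (suc j ≤_) (m∸n+n≡m m≤m′) j<) m′≤X)))

  -- By absorption q i / p i is X + 1 times A (m + 1) / ((m + 1) A m) at m = X - i. The hypothesis
  -- `H` makes this decrease in m, hence increase in i.
  likelihood : ∀ i j → i ≤ j → q i * p j ≤ p i * q j
  likelihood i j i≤j with j ≤? X
  ... | no j≰X rewrite bin-0 X j (≰⇒> j≰X) | *-zeroʳ (q i) = z≤n
  ... | yes j≤X = subst₂ (λ x y → bin (suc X) i * A y * (bin X j * A (X ∸ j)) ≤ bin X i * A (X ∸ i) * (bin (suc X) j * A x))
        (sym (+-∸-assoc 1 j≤X)) (sym (+-∸-assoc 1 i≤X))
        (*-cancelˡ-≤ (suc m′ * suc m) {{m*n≢0 (suc m′) (suc m)}} (begin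
          suc m′ * suc m * (bin (suc X) i * A (suc m′) * (bin X j * A m))
            ≡⟨ e₁ (suc m′) (suc m) (bin (suc X) i) (A (suc m′)) (bin X j) (A m) ⟩
          (suc m′ * bin (suc X) i) * (bin X j * (suc m * A m * A (suc m′)))
            ≡⟨ cong (_* (bin X j * (suc m * A m * A (suc m′)))) (absorb i i≤X) ⟩
          (suc X * bin X i) * (bin X j * (suc m * A m * A (suc m′)))
            ≤⟨ *-monoʳ-≤ (suc X * bin X i) (*-monoʳ-≤ (bin X j) (chain m m′ (∸-monoʳ-≤ X i≤j) (m∸n≤m X i))) ⟩
          (suc X * bin X i) * (bin X j * (suc m′ * A m′ * A (suc m)))
            ≡⟨ e₂ (suc X) (bin X i) (bin X j) (suc m′) (A m′) (A (suc m)) ⟩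
          (suc X * bin X j) * (suc m′ * (bin X i * A m′ * A (suc m)))
            ≡⟨ cong (_* (suc m′ * (bin X i * A m′ * A (suc m)))) (absorb j j≤X) ⟨
          (suc m * bin (suc X) j) * (suc m′ * (bin X i * A m′ * A (suc m)))
            ≡⟨ e₃ (suc m) (bin (suc X) j) (suc m′) (bin X i) (A m′) (A (suc m)) ⟩
          suc m′ * suc m * (bin X i * A m′ * (bin (suc X) j * A (suc m))) ∎))
    where
    open ≤-Reasoning
    i≤X = ≤-trans i≤j j≤X
    m = X ∸ j
    m′ = X ∸ i
    absorb : ∀ k → k ≤ X → suc (X ∸ k) * bin (suc X) k ≡ suc X * bin X k
    absorb k k≤X = subst (λ x → suc (X ∸ k) * bin (suc x) k ≡ suc x * bin x k) (m∸n+n≡m k≤X) (bin-absorb′ (X ∸ k) k)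
    e₁ : ∀ a b c d f g → a * b * (c * d * (f * g)) ≡ (a * c) * (f * (b * g * d))
    e₁ = solve-∀
    e₂ : ∀ x b c m a d → (x * b) * (c * (m * a * d)) ≡ (x * c) * (m * (b * a * d))
    e₂ = solve-∀
    e₃ : ∀ m b m′ c a d → (m * b) * (m′ * (c * a * d)) ≡ m′ * m * (c * a * (b * d))
    e₃ = solve-∀

  pair-ordered : ∀ i j → i ≤ j →
    suc X * (Q i * p j) + suc X * (Q j * p i) ≤ suc (suc X) * (P i * q j) + suc (suc X) * (P j * q i)
  pair-ordered i j i≤j = *-cancelˡ-≤ (suc i * suc j) {{m*n≢0 (suc i) (suc j)}} (begin
    suc i * suc j * (suc X * (Q i * p j) + suc X * (Q j * p i))
      ≡⟨ e₁ (suc i) (suc j) (suc X) (Q i) (p j) (Q j) (p i) ⟩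
    suc X * (suc j * ((suc i * Q i) * p j) + suc i * ((suc j * Q j) * p i))
      ≡⟨ cong₂ (λ u v → suc X * (suc j * (u * p j) + suc i * (v * p i))) (Q-absorb i) (Q-absorb j) ⟩
    suc X * (suc j * (suc (suc X) * q i * p j) + suc i * (suc (suc X) * q j * p i))
      ≡⟨ e₂ (suc X) (suc (suc X)) (suc i) (suc j) (q i) (p j) (q j) (p i) ⟩
    suc X * suc (suc X) * (suc j * (q i * p j) + suc i * (p i * q j))
      ≤⟨ *-monoʳ-≤ (suc X * suc (suc X)) rearr ⟩
    suc X * suc (suc X) * (suc j * (p i * q j) + suc i * (q i * p j))
      ≡⟨ e₃ (suc X) (suc (suc X)) (suc i) (suc j) (q i) (p j) (q j) (p i) ⟩
    suc (suc X) * (suc j * ((suc X * p i) * q j) + suc i * ((suc X * p j) * q i))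
      ≡⟨ cong₂ (λ u v → suc (suc X) * (suc j * (u * q j) + suc i * (v * q i))) (P-absorb i) (P-absorb j) ⟨
    suc (suc X) * (suc j * ((suc i * P i) * q j) + suc i * ((suc j * P j) * q i))
      ≡⟨ e₁ (suc i) (suc j) (suc (suc X)) (P i) (q j) (P j) (q i) ⟨
    suc i * suc j * (suc (suc X) * (P i * q j) + suc (suc X) * (P j * q i)) ∎)
    where
    open ≤-Reasoning
    e₁ : ∀ i j x a b c d → i * j * (x * (a * b) + x * (c * d)) ≡ x * (j * ((i * a) * b) + i * ((j * c) * d))
    e₁ = solve-∀
    e₂ : ∀ x y i j a b c d → x * (j * (y * a * b) + i * (y * c * d)) ≡ x * y * (j * (a * b) + i * (d * c))
    e₂ = solve-∀
    e₃ : ∀ x y i j a b c d → x * y * (j * (d * c) + i * (a * b)) ≡ y * (j * ((x * d) * c) + i * ((x * b) * a))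
    e₃ = solve-∀
    -- Rearrangement: the right-hand side gives the larger factor suc j to the larger of the two
    -- products.
    rearr : suc j * (q i * p j) + suc i * (p i * q j) ≤ suc j * (p i * q j) + suc i * (q i * p j)
    rearr = subst (λ j′ → suc j′ * (q i * p j) + suc i * (p i * q j) ≤ suc j′ * (p i * q j) + suc i * (q i * p j))
      (m+[n∸m]≡n i≤j) (≤-from 0 (*-monoʳ-≤ (j ∸ i) (likelihood i j i≤j)) (e i (j ∸ i) (q i * p j) (p i * q j)))
      where
      e : ∀ i d u v → suc (i + d) * v + suc i * u + d * u ≡ suc (i + d) * u + suc i * v + d * v + 0
      e = solve-∀

  mean-decreases : suc X * (∑ N Q * ∑ N p) ≤ suc (suc X) * (∑ N P * ∑ N q)
  mean-decreases = subst₂ _≤_ (eq (suc X) (Q ∘ toℕ) (p ∘ toℕ)) (eq (suc (suc X)) (P ∘ toℕ) (q ∘ toℕ))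
    (Σᶠ-pairwise (λ i j → suc X * (Q (toℕ i) * p (toℕ j))) (λ i j → suc (suc X) * (P (toℕ i) * q (toℕ j)))
      λ i j → pair (toℕ i) (toℕ j))
    where
    pair : ∀ i j → suc X * (Q i * p j) + suc X * (Q j * p i) ≤ suc (suc X) * (P i * q j) + suc (suc X) * (P j * q i)
    pair i j with ≤-total i j
    ... | inj₁ i≤j = pair-ordered i j i≤j
    ... | inj₂ j≤i = subst₂ _≤_ (+-comm (suc X * (Q j * p i)) _) (+-comm (suc (suc X) * (P j * q i)) _) (pair-ordered j i j≤i)
    eq : ∀ c (f g : Fin N → ℕ) → Σᶠ (λ i → Σᶠ (λ j → c * (f i * g j))) ≡ c * (Σᶠ f * Σᶠ g)
    eq c f g = trans (Σᶠ-cong λ i → trans (Σᶠ-cong λ j → *-comm c (f i * g j)) (Σᶠ-*ʳ (λ j → f i * g j) c))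
      (trans (Σᶠ-*ʳ (λ i → Σᶠ (λ j → f i * g j)) c)
        (trans (*-comm _ c) (cong (c *_) (sym (Σᶠ-product f g)))))

  mean≤1 : ∑ N P ≤ suc X * ∑ N p
  mean≤1 = begin
    ∑ N P ≤⟨ Σᶠ-mono (λ e → ≤-trans (m≤m+n (P (toℕ e)) _)
                                           (≤-reflexive (trans (P-absorb (toℕ e)) (*-comm (suc X) (p (toℕ e)))))) ⟩
    Σᶠ (λ e → p (toℕ e) * suc X) ≡⟨ Σᶠ-*ʳ {N} (p ∘ toℕ) (suc X) ⟩
    ∑ N p * suc X ≡⟨ *-comm (∑ N p) (suc X) ⟩
    suc X * ∑ N p ∎
    where open ≤-Reasoning

LogConvex : (ℕ → ℕ) → Set
LogConvex f = ∀ x → f (suc x) * f (suc x) ≤ f (suc (suc x)) * f x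

ratio-mono-≤ : ∀ (f g : ℕ → ℕ) → (∀ j → 0 < f j) → (∀ j → f j * g (suc j) ≤ f (suc j) * g j) →
  ∀ x y → x ≤ y → f x * g y ≤ f y * g x
ratio-mono-≤ f g pos adj x y x≤y = subst (λ y → f x * g y ≤ f y * g x) (m∸n+n≡m x≤y)
  (ratio-mono f g x (y ∸ x) (λ j _ → pos j) (λ j _ _ → adj j))

logConvex-ratio : ∀ f → (∀ j → 0 < f j) → LogConvex f → ∀ x y → x ≤ y → f (suc x) * f y ≤ f (suc y) * f x
logConvex-ratio f pos lc = ratio-mono-≤ (f ∘ suc) f (pos ∘ suc) lc

product-+ : ∀ j d x → j + x ≤ suc ((j + d) + (j + d)) → j * x ≤ (j + d) * suc (j + d)
product-+ j d x h = begin
  j * x ≤⟨ *-monoʳ-≤ j (+-cancelˡ-≤ j x _ (≤-trans h (≤-reflexive (e₁ j d)))) ⟩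
  j * suc (d + (j + d)) ≤⟨ m≤m+n _ (d * suc d) ⟩
  j * suc (d + (j + d)) + d * suc d ≡⟨ e₂ j d ⟩
  (j + d) * suc (j + d) ∎
  where
  open ≤-Reasoning
  e₁ : ∀ j d → suc ((j + d) + (j + d)) ≡ j + suc (d + (j + d))
  e₁ = solve-∀
  e₂ : ∀ j d → j * suc (d + (j + d)) + d * suc d ≡ (j + d) * suc (j + d)
  e₂ = solve-∀

-- The product of two integers whose sum is odd is largest when they differ by one. With r = s + 1
-- it turns j + x < r + r into j x ≤ (r - 1) r.
product≤ : ∀ s j x → j + x ≤ suc (s + s) → j * x ≤ s * suc s
product≤ s j x h with ≤-total j s
... | inj₁ j≤s = subst (λ s → j * x ≤ s * suc s) (m+[n∸m]≡n j≤s)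
  (product-+ j (s ∸ j) x (subst (λ s → j + x ≤ suc (s + s)) (sym (m+[n∸m]≡n j≤s)) h))
... | inj₂ s≤j with ≤-total x s
...   | inj₁ x≤s = subst₂ _≤_ (*-comm x j) refl (subst (λ s → x * j ≤ s * suc s) (m+[n∸m]≡n x≤s)
  (product-+ x (s ∸ x) j (subst (λ s → x + j ≤ suc (s + s)) (sym (m+[n∸m]≡n x≤s)) (subst (_≤ suc (s + s)) (+-comm j x) h))))
...   | inj₂ s≤x with m≤n⇒m<n∨m≡n s≤j
...     | inj₂ refl = *-monoʳ-≤ s (+-cancelˡ-≤ s x (suc s) (subst (s + x ≤_) (sym (+-suc s s)) h))
...     | inj₁ s<j = subst₂ _≤_ refl (*-comm (suc s) s)
  (*-mono-≤ {j} {suc s} {x} {s}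
    (+-cancelʳ-≤ s j (suc s) (≤-trans (+-monoʳ-≤ j s≤x) h))
    (+-cancelˡ-≤ (suc s) x s (≤-trans (+-monoˡ-≤ x s<j) h)))

-- Bell numbers, Poisson moments and the weights.

module Sequences (D : ℕ → ℕ) (D0 : D 0 ≡ 1) (D-rec : ∀ x → D (suc x) + D x ≡ bt D x) where

  -- The Bell numbers: once its singletons are chosen, a partition is a partition of the other
  -- points without singletons.
  B : ℕ → ℕ
  B = bt D

  B-rec : ∀ x → B (suc x) ≡ bt B x
  B-rec x = trans (sym (bt-+ D (D ∘ suc) x)) (bt-cong (λ j → trans (+-comm (D j) _) (D-rec j)) x)

  B>0 : ∀ x → 0 < B x
  B>0 x = ≤-trans (≤-reflexive (sym D0)) (f0≤bt D x)

  D1 : D 1 ≡ 0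
  D1 = +-cancelʳ-≡ (D 0) (D 1) 0 (D-rec 0)

  D2 : D 2 ≡ 1
  D2 = +-cancelʳ-≡ (D 1) (D 2) 1 (trans (D-rec 1) (cong (_+ D 1) D0))

  -- The variance of the tilted Poisson measure with moments B is at least 1.
  B-variance : ∀ x → B (suc x) * B (suc x) + B x * B x ≤ B x * B (suc (suc x))
  B-variance = <-rec _ go
    where
    go : ∀ x → (∀ {j} → j < x → B (suc j) * B (suc j) + B j * B j ≤ B j * B (suc (suc j))) →
         B (suc x) * B (suc x) + B x * B x ≤ B x * B (suc (suc x))
    go zero    rec rewrite D0 | D1 | D2 = ≤-refl
    -- The numbers p, q, s are the first moments of a mixture of earlier cases; B at x + 1, x + 2, x
    -- + 3 gives the moments of the same measure translated by 1, and translation keeps the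
    -- variance.
    go (suc x) rec = subst₂ _≤_ (cong₂ (λ u v → u * u + v * v) (sym b₂) (sym b₁)) (cong₂ _*_ (sym b₁) (sym b₃))
      (≤-from 0 (proj₂ (bt-cone Cone (λ {p} {q} {s} {p′} {q′} {s′} → Cone-+ {p} {q} {s} {p′} {q′} {s′}) x {B} {λ j → B (suc j)} {λ j → B (suc (suc j))} (λ j j≤x → B>0 j , rec (s≤s j≤x))))
        (e p q s))
      where
      p q s : ℕ
      p = bt B x
      q = bt (λ j → B (suc j)) x
      s = bt (λ j → B (suc (suc j))) x
      b₁ : B (suc x) ≡ p
      b₁ = B-rec x
      b₂ : B (suc (suc x)) ≡ p + q
      b₂ = B-rec (suc x)
      b₃ : B (suc (suc (suc x))) ≡ (p + q) + (q + s)
      b₃ = B-rec (suc (suc x))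
      e : ∀ p q s → p * ((p + q) + (q + s)) + (q * q + p * p) ≡ (p + q) * (p + q) + p * p + p * s + 0
      e = solve-∀

  B-logConvex : LogConvex B
  B-logConvex x = ≤-trans (m≤m+n _ _) (≤-trans (B-variance x) (≤-reflexive (*-comm (B x) _)))

  -- T c g x = E[X^x (X + c)^g] for a Poisson variable X of mean 1.
  T : ℕ → ℕ → ℕ → ℕ
  T c zero    x = B x
  T c (suc g) x = T c g (suc x) + c * T c g x

  T>0 : ∀ c g x → 0 < T c g x
  T>0 c zero    x = B>0 x
  T>0 c (suc g) x = ≤-trans (T>0 c g (suc x)) (m≤m+n _ _)

  -- E[X f(X)] = E[f(X + 1)]
  T-rec : ∀ c g x → T c g (suc x) ≡ bt (T (suc c) g) x
  T-rec c zero    x = B-rec x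
  T-rec c (suc g) x = begin
    T c g (suc (suc x)) + c * T c g (suc x) ≡⟨ cong₂ (λ u v → u + c * v) (T-rec c g (suc x)) (T-rec c g x) ⟩
    bt A x + bt (A ∘ suc) x + c * bt A x ≡⟨ e (bt A x) _ c ⟩
    bt (A ∘ suc) x + suc c * bt A x ≡⟨ cong (bt (A ∘ suc) x +_) (bt-* (suc c) A x) ⟨
    bt (A ∘ suc) x + bt (λ j → suc c * A j) x ≡⟨ bt-+ (A ∘ suc) _ x ⟨
    bt (λ j → A (suc j) + suc c * A j) x ∎
    where
    open ≡-Reasoning
    A = T (suc c) g
    e : ∀ a b c → a + b + c * a ≡ b + suc c * a
    e = solve-∀

  -- Cauchy-Schwarz for the moments of the Poisson law with density (X + c)^g, obtained here by
  -- adding one factor X + c at a time.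
  T-logConvex : ∀ c g → LogConvex (T c g)
  T-logConvex c zero    x = B-logConvex x
  T-logConvex c (suc g) x = ≤-from 0
      (+-mono-≤ (+-mono-≤ (lc (suc x)) (*-monoʳ-≤ c (logConvex-ratio f (T>0 c g) lc x (suc (suc x)) (m≤n⇒m≤1+n (n≤1+n x))))) (*-monoʳ-≤ (c * c) (lc x)))
      (e (f x) (f (suc x)) (f (suc (suc x))) (f (suc (suc (suc x)))) c)
    where
    f = T c g
    lc = T-logConvex c g
    e : ∀ f₀ f₁ f₂ f₃ c → (f₃ + c * f₂) * (f₁ + c * f₀) + (f₂ * f₂ + c * (f₁ * f₂) + c * c * (f₁ * f₁))
      ≡ (f₂ + c * f₁) * (f₂ + c * f₁) + (f₃ * f₁ + c * (f₃ * f₀) + c * c * (f₂ * f₀)) + 0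
    e = solve-∀

  -- The quotient of consecutive terms is a mean of X. Going from c to c + 1 multiplies the density
  -- by ((X + c + 1) / (X + c))^g, which decreases in X and so lowers the mean.
  T-shift-ratio : ∀ c g x → T c g x * T (suc c) g (suc x) ≤ T c g (suc x) * T (suc c) g x
  T-shift-ratio c zero    x = ≤-reflexive (*-comm (B x) _)
  T-shift-ratio c (suc g) x = ≤-from 0
      (+-mono-≤ (+-mono-≤ (ih (suc x)) (*-monoʳ-≤ (c * suc c) (ih x)))
        (+-mono-≤ (*-monoʳ-≤ c (ratio-mono-≤ f h (T>0 c g) ih x (suc (suc x)) (m≤n⇒m≤1+n (n≤1+n x)))) f₁h₁≤f₂h₀))
      (e (f x) (f (suc x)) (f (suc (suc x))) (h x) (h (suc x)) (h (suc (suc x))) c)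
    where
    f = T c g
    h = T (suc c) g
    ih = T-shift-ratio c g
    f₁h₁≤f₂h₀ : f (suc x) * h (suc x) ≤ f (suc (suc x)) * h x
    f₁h₁≤f₂h₀ = *-cancelʳ-≤ _ _ (f x) {{>-nonZero (T>0 c g x)}} (begin
      f (suc x) * h (suc x) * f x ≡⟨ i₁ (f (suc x)) (h (suc x)) (f x) ⟩
      f (suc x) * (f x * h (suc x)) ≤⟨ *-monoʳ-≤ (f (suc x)) (ih x) ⟩
      f (suc x) * (f (suc x) * h x) ≡⟨ *-assoc (f (suc x)) (f (suc x)) (h x) ⟨
      f (suc x) * f (suc x) * h x ≤⟨ *-monoˡ-≤ (h x) (T-logConvex c g x) ⟩
      f (suc (suc x)) * f x * h x ≡⟨ i₂ (f (suc (suc x))) (f x) (h x) ⟩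
      f (suc (suc x)) * h x * f x ∎)
      where
      open ≤-Reasoning
      i₁ : ∀ a b c → a * b * c ≡ a * (c * b)
      i₁ = solve-∀
      i₂ : ∀ a b c → a * b * c ≡ a * c * b
      i₂ = solve-∀
    e : ∀ f₀ f₁ f₂ h₀ h₁ h₂ c →
      (f₂ + c * f₁) * (h₁ + suc c * h₀) + (f₁ * h₂ + c * suc c * (f₀ * h₁) + (c * (f₀ * h₂) + f₁ * h₁))
      ≡ (f₁ + c * f₀) * (h₂ + suc c * h₁) + (f₂ * h₁ + c * suc c * (f₁ * h₀) + (c * (f₂ * h₀) + f₂ * h₀)) + 0
    e = solve-∀

  T-c-mono : ∀ c g x → T c g x ≤ T (suc c) g x
  T-c-mono c zero    x = ≤-refl
  T-c-mono c (suc g) x = +-mono-≤ (T-c-mono c g (suc x)) (*-mono-≤ (n≤1+n c) (T-c-mono c g x))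

  -- With R the ratio of consecutive terms, Factorial says that R x / (x + 1)
  -- decreases (T / x! is log-concave), and Excess that (R x − 1) / x decreases.
  Factorial Excess : ℕ → ℕ → ℕ → Set
  Factorial c g x = suc x * T c g x * T c g (suc (suc x)) ≤ suc (suc x) * T c g (suc x) * T c g (suc x)
  Excess c g x = x * (T c g (suc (suc x)) * T c g x) + suc x * (T c g x * T c g (suc x))
               ≤ suc x * (T c g (suc x) * T c g (suc x)) + x * (T c g (suc x) * T c g x)

  -- R x − 1 is the expected number of blocks in a random partition; the blocks
  -- counted by m₁ contribute x times the mean of 1/|block of a point|, the others
  -- form the quotient of T (suc c) by T c.
  module Step (c g X : ℕ) (H : ∀ m → m < X → Factorial (suc c) g m) where

    A = T (suc c) g
    open Mean A (T>0 (suc c) g) X H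

    x = suc X
    a a′ a″ A₀ A₁ m₁ m₂ : ℕ
    a = T c g x
    a′ = T c g (suc x)
    a″ = T c g (suc (suc x))
    A₀ = A x
    A₁ = A (suc x)
    m₁ = ∑ N P
    m₂ = ∑ N Q

    a≡ : a ≡ ∑ N p
    a≡ = trans (T-rec c g X) (bt-∑ A X N (s≤s (n≤1+n X)))

    a′≡ : a′ ≡ ∑ N q
    a′≡ = trans (T-rec c g (suc X)) (bt-∑ A (suc X) N ≤-refl)

    a′-split : a′ ≡ A₀ + m₁
    a′-split = trans (T-rec c g (suc X)) (bt-∑-proper A X N (s≤s (n≤1+n X)))

    a″-split : a″ ≡ A₁ + m₂
    a″-split = trans (T-rec c g (suc (suc X))) (bt-∑-proper A (suc X) N ≤-refl)

    mean : x * (m₂ * a) ≤ suc x * (m₁ * a′)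
    mean = subst₂ (λ u v → x * (m₂ * u) ≤ suc x * (m₁ * v)) (sym a≡) (sym a′≡) mean-decreases

    m₁≤ : m₁ ≤ x * a
    m₁≤ = subst (λ u → m₁ ≤ x * u) (sym a≡) mean≤1

    pure : a * A₁ ≤ a′ * A₀
    pure = T-shift-ratio c g x

    a≤A₀ : a ≤ A₀
    a≤A₀ = T-c-mono c g x

    excess : Excess c g x
    excess = subst₂ (λ u v → x * (u * a) + suc x * (a * a′) ≤ suc x * (v * a′) + x * (a′ * a))
      (sym a″-split) (sym a′-split)
      (≤-from 0 (+-mono-≤ (+-mono-≤ (*-monoʳ-≤ x pure) mean) (*-monoˡ-≤ a′ a≤A₀))
        (e x a a′ A₀ A₁ m₁ m₂))
      where
      e : ∀ x a a′ A₀ A₁ m₁ m₂ →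
        suc x * ((A₀ + m₁) * a′) + x * (a′ * a) + (x * (a * A₁) + x * (m₂ * a) + a * a′)
        ≡ x * ((A₁ + m₂) * a) + suc x * (a * a′) + (x * (a′ * A₀) + suc x * (m₁ * a′) + A₀ * a′) + 0
      e = solve-∀

    factorial : Factorial c g x
    factorial = subst₂ (λ u v → suc x * a * u ≤ suc (suc x) * v * v) (sym a″-split) (sym a′-split)
      (*-cancelˡ-≤ x (subst (λ a′ → x * (suc x * a * (A₁ + m₂)) ≤ x * (suc (suc x) * (A₀ + m₁) * a′)) a′-split
        (≤-from 0 (+-mono-≤ (+-mono-≤ (*-monoʳ-≤ (x * suc x) pure) (*-monoʳ-≤ (suc x) mean))
                            (+-mono-≤ (*-monoˡ-≤ a′ m₁≤) (*-monoʳ-≤ x (*-monoˡ-≤ a′ a≤A₀))))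
          (e x a a′ A₀ A₁ m₁ m₂))))
      where
      e : ∀ x a a′ A₀ A₁ m₁ m₂ →
        x * (suc (suc x) * (A₀ + m₁) * a′) + (x * suc x * (a * A₁) + suc x * (x * (m₂ * a)) + (m₁ * a′ + x * (a * a′)))
        ≡ x * (suc x * a * (A₁ + m₂)) + (x * suc x * (a′ * A₀) + suc x * (suc x * (m₁ * a′)) + (x * a * a′ + x * (A₀ * a′))) + 0
      e = solve-∀

  factorial-0 : ∀ c g → Factorial c g 0
  factorial-0 c g = subst₂ (λ u v → 1 * T c g 0 * u ≤ 2 * v * v) (sym (T-rec c g 1)) (sym (T-rec c g 0))
    (≤-from 0 (+-mono-≤ (subst (λ v → T c g 0 * A 1 ≤ v * A 0) (T-rec c g 0) (T-shift-ratio c g 0))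
                        (*-monoˡ-≤ (A 0) (T-c-mono c g 0)))
      (e (T c g 0) (A 0) (A 1)))
    where
    A = T (suc c) g
    e : ∀ a A₀ A₁ → 2 * A₀ * A₀ + (a * A₁ + a * A₀) ≡ 1 * a * (A₀ + A₁) + (A₀ * A₀ + A₀ * A₀) + 0
    e = solve-∀

  -- The induction on x is for all c at once, because the step for c uses smaller arguments of
  -- `T (suc c) g`.
  factorial : ∀ x c g → Factorial c g x
  factorial = <-rec (λ x → ∀ c g → Factorial c g x) go
    where
    go : ∀ x → (∀ {y} → y < x → ∀ c g → Factorial c g y) → ∀ c g → Factorial c g x
    go zero    rec c g = factorial-0 c g
    go (suc X) rec c g = Step.factorial c g X (λ m m<X → rec (m≤n⇒m≤1+n m<X) (suc c) g)

  excess : ∀ c g X → Excess c g (suc X)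
  excess c g X = Step.excess c g X (λ m _ → factorial m (suc c) g)

  T-mono : ∀ c g x → T c g (suc x) ≤ T c g (suc (suc x))
  T-mono c g x = subst₂ _≤_ (sym (T-rec c g x)) (sym (T-rec c g (suc x))) (m≤m+n _ _)

  -- With R y = a (y + 1) / a y this is j (R x - 1) ≤ r (R u - 1), freed of division and
  -- subtraction.
  Gap : (ℕ → ℕ) → ℕ → ℕ → ℕ → ℕ → Set
  Gap a u r j x = j * (a (suc x) * a u) + r * (a u * a x) ≤ r * (a (suc u) * a x) + j * (a x * a u)

  -- For x ≤ u, log-convexity gives R x ≤ R u, and j ≤ r does the rest. For u ≤ x, `excess` says
  -- that (R y - 1) / y decreases, so R x - 1 is at most x / u times R u - 1, and j x ≤ u r absorbs
  -- the factor.
  T-gap : ∀ c g u r j x → 1 ≤ u → 1 ≤ x → j ≤ r → j * x ≤ u * r → Gap (T c g) u r j x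
  T-gap c g u@(suc u′) r j x@(suc x′) _ _ j≤r jx≤ur with ≤-total x u
  ... | inj₁ x≤u = subst (λ r → Gap (T c g) u r j x) (m+[n∸m]≡n j≤r)
    (≤-from 0 (+-mono-≤ (*-monoʳ-≤ j (logConvex-ratio (T c g) (T>0 c g) (T-logConvex c g) x u x≤u))
                        (*-monoʳ-≤ (r ∸ j) (*-monoˡ-≤ (T c g x) (T-mono c g u′))))
      (e j (r ∸ j) (T c g x) (T c g (suc x)) (T c g u) (T c g (suc u))))
    where
    e : ∀ j s a a′ b b′ → (j + s) * (b′ * a) + j * (a * b) + (j * (a′ * b) + s * (b * a))
      ≡ j * (a′ * b) + (j + s) * (b * a) + (j * (b′ * a) + s * (b′ * a)) + 0
    e = solve-∀
  ... | inj₂ u≤x = subst₂ (λ v w → j * (v * T c g u) + r * (T c g u * T c g x) ≤ r * (w * T c g x) + j * (T c g x * T c g u))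
      (split x′) (split u′) (≤-from 0 (*-cancelˡ-≤ u cancelled) (e j r (T c g x) (Δ x) (T c g u) (Δ u)))
    where
    Δ : ℕ → ℕ
    Δ x = T c g (suc x) ∸ T c g x
    split : ∀ x → T c g (suc x) + Δ (suc x) ≡ T c g (suc (suc x))
    split x = m+[n∸m]≡n (T-mono c g x)
    adj : ∀ y → suc y * T c g (suc y) * Δ (suc (suc y)) ≤ suc (suc y) * T c g (suc (suc y)) * Δ (suc y)
    adj y = ≤-from 0
      (subst (λ v → suc y * (v * a) + suc (suc y) * (a * a₁) ≤ suc (suc y) * (a₁ * a₁) + suc y * (a₁ * a)) (sym (split (suc y))) (excess c g y))
      (subst (λ v → suc (suc y) * a₁ * Δ (suc y) + (suc y * ((a₁ + Δ (suc (suc y))) * a) + suc (suc y) * (a * a₁))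
                  ≡ suc y * a * Δ (suc (suc y)) + (suc (suc y) * (a₁ * v) + suc y * (a₁ * a)) + 0) (split y)
        (i (suc y) a a₁ (Δ (suc y)) (Δ (suc (suc y)))))
      where
      a = T c g (suc y)
      a₁ = T c g (suc (suc y))
      i : ∀ y a a₁ d d₁ → suc y * a₁ * d + (y * ((a₁ + d₁) * a) + suc y * (a * a₁))
                        ≡ y * a * d₁ + (suc y * (a₁ * (a + d)) + y * (a₁ * a)) + 0
      i = solve-∀
    chain : u * T c g u * Δ x ≤ x * T c g x * Δ u
    chain = subst (λ x → u * T c g u * Δ x ≤ x * T c g x * Δ u) (m∸n+n≡m u≤x)
      (ratio-mono (λ x → x * T c g x) Δ u (x ∸ u)
        (λ { (suc y) _ → *-mono-≤ (s≤s (z≤n {y})) (T>0 c g (suc y)) })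
        (λ { (suc y) _ _ → adj y }))
    cancelled : u * (j * (T c g u * Δ x)) ≤ u * (r * (T c g x * Δ u))
    cancelled = begin
      u * (j * (T c g u * Δ x)) ≡⟨ k₁ u j (T c g u) (Δ x) ⟩
      j * (u * T c g u * Δ x) ≤⟨ *-monoʳ-≤ j chain ⟩
      j * (x * T c g x * Δ u) ≡⟨ k₂ j x (T c g x) (Δ u) ⟩
      j * x * (T c g x * Δ u) ≤⟨ *-monoˡ-≤ (T c g x * Δ u) jx≤ur ⟩
      u * r * (T c g x * Δ u) ≡⟨ *-assoc u r _ ⟩
      u * (r * (T c g x * Δ u)) ∎
      where
      open ≤-Reasoning
      k₁ : ∀ u j a d → u * (j * (a * d)) ≡ j * (u * a * d)
      k₁ = solve-∀
      k₂ : ∀ j x a d → j * (x * a * d) ≡ j * x * (a * d)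
      k₂ = solve-∀
    e : ∀ j r a d b d′ → r * ((b + d′) * a) + j * (a * b) + j * (b * d) ≡ j * ((a + d) * b) + r * (b * a) + r * (a * d′) + 0
    e = solve-∀

  -- The inequality D (x + 1)² ≤ D x D (x + 2) fails for x = 1 and x = 3, hence the
  -- table.
  small : ℕ → ℕ
  small 0 = 1
  small 2 = 1
  small 3 = 1
  small 4 = 4
  small 5 = 11
  small 6 = 41
  small 7 = 162
  small _ = 0

  small-rec : ∀ {x} → x < 7 → small (suc x) + small x ≡ bt small x
  small-rec = from-yes (allUpTo? (λ x → small (suc x) + small x ≟ bt small x) 7)

  bt-cong≤ : ∀ {f g} x → (∀ j → j ≤ x → f j ≡ g j) → bt f x ≡ bt g x
  bt-cong≤ zero    h = h 0 z≤n
  bt-cong≤ (suc x) h = cong₂ _+_ (bt-cong≤ x (λ j j≤x → h j (m≤n⇒m≤1+n j≤x))) (bt-cong≤ x (λ j j≤x → h (suc j) (s≤s j≤x)))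

  D-small : ∀ k → k < 8 → D k ≡ small k
  D-small = <-rec (λ k → k < 8 → D k ≡ small k) go
    where
    go : ∀ k → (∀ {j} → j < k → j < 8 → D j ≡ small j) → k < 8 → D k ≡ small k
    go zero    rec _         = D0
    go (suc x) rec (s≤s x<7) = +-cancelʳ-≡ (D x) (D (suc x)) (small (suc x))
      (trans (D-rec x) (trans (bt-cong≤ x (λ j j≤x → rec (s≤s j≤x) (≤-trans (s≤s j≤x) (m≤n⇒m≤1+n x<7))))
        (trans (sym (small-rec x<7)) (cong (small (suc x) +_) (sym (rec ≤-refl (m≤n⇒m≤1+n x<7)))))))

  D3 : D 3 ≡ 1
  D3 = D-small 3 (≤ᵇ⇒≤ 4 8 tt)

  D4 : D 4 ≡ 4
  D4 = D-small 4 (≤ᵇ⇒≤ 5 8 tt)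

  D5 : D 5 ≡ 11
  D5 = D-small 5 (≤ᵇ⇒≤ 6 8 tt)

  D6 : D 6 ≡ 41
  D6 = D-small 6 (≤ᵇ⇒≤ 7 8 tt)

  D7 : D 7 ≡ 162
  D7 = D-small 7 (≤ᵇ⇒≤ 8 8 tt)

  B3 : B 3 ≡ 5
  B3 = bt-cong≤ 3 λ j j≤3 → D-small j (≤-trans (s≤s j≤3) (≤ᵇ⇒≤ 4 8 tt))

  B4 : B 4 ≡ 15
  B4 = bt-cong≤ 4 λ j j≤4 → D-small j (≤-trans (s≤s j≤4) (≤ᵇ⇒≤ 5 8 tt))

  B5 : B 5 ≡ 52
  B5 = bt-cong≤ 5 λ j j≤5 → D-small j (≤-trans (s≤s j≤5) (≤ᵇ⇒≤ 6 8 tt))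

  -- `Factorial` lets the ratio grow from y + 3 to y + 4 at most by the factor (y + 5) / (y + 4),
  -- and (y + 5)(y + 3) ≤ (y + 4)². The start 15 = 3 · 5 is an equality.
  B-ratio≤ : ∀ y → B (4 + y) ≤ (3 + y) * B (3 + y)
  B-ratio≤ zero    = ≤-reflexive (trans B4 (cong (3 *_) (sym B3)))
  B-ratio≤ (suc y) = *-cancelˡ-≤ (4 + y) (*-cancelˡ-≤ b₀ {{>-nonZero (B>0 (3 + y))}} (begin
    b₀ * ((4 + y) * b₂) ≡⟨ i₁ b₀ (4 + y) b₂ ⟩
    (4 + y) * b₀ * b₂ ≤⟨ factorial (3 + y) 0 0 ⟩
    (5 + y) * b₁ * b₁ ≤⟨ *-monoʳ-≤ ((5 + y) * b₁) (B-ratio≤ y) ⟩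
    (5 + y) * b₁ * ((3 + y) * b₀) ≤⟨ m≤m+n _ (b₁ * b₀) ⟩
    (5 + y) * b₁ * ((3 + y) * b₀) + b₁ * b₀ ≡⟨ i₂ y b₀ b₁ ⟩
    b₀ * ((4 + y) * ((4 + y) * b₁)) ∎))
    where
    open ≤-Reasoning
    b₀ = B (3 + y)
    b₁ = B (4 + y)
    b₂ = B (5 + y)
    i₁ : ∀ b c d → b * (c * d) ≡ c * b * d
    i₁ = solve-∀
    i₂ : ∀ y b c → (5 + y) * c * ((3 + y) * b) + c * b ≡ b * ((4 + y) * ((4 + y) * c))
    i₂ = solve-∀

  -- In the notation of `D-logConvex-suc²` this is b₂² / (b₂ + b₃) ≤ b₁² / (b + b₁), the part of the
  -- step there that concerns Bell numbers alone.
  B-convexity : ∀ y → B (4 + y) * B (4 + y) * (B (2 + y) + B (3 + y)) ≤ B (3 + y) * B (3 + y) * (B (4 + y) + B (5 + y))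
  B-convexity y = *-cancelˡ-≤ (3 + y)
    (≤-from 0 (+-mono-≤ (+-mono-≤ (*-monoʳ-≤ (B (4 + y)) (factorial (2 + y) 0 0))
                                  (*-monoʳ-≤ ((3 + y) * B (3 + y)) (B-variance (3 + y))))
                        (*-monoʳ-≤ (B (3 + y) * B (3 + y)) (B-ratio≤ y)))
      (e (3 + y) (B (2 + y)) (B (3 + y)) (B (4 + y)) (B (5 + y))))
    where
    e : ∀ y b b₁ b₂ b₃ → y * (b₁ * b₁ * (b₂ + b₃)) + (b₂ * (y * b * b₂) + y * b₁ * (b₂ * b₂ + b₁ * b₁) + b₁ * b₁ * b₂)
      ≡ y * (b₂ * b₂ * (b + b₁)) + (b₂ * (suc y * b₁ * b₁) + y * b₁ * (b₁ * b₃) + b₁ * b₁ * (y * b₁)) + 0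
    e = solve-∀

  B-split : ∀ x → B x ≡ D x + D (suc x)
  B-split x = trans (sym (D-rec x)) (+-comm (D (suc x)) (D x))

  D-logConvexAt : ℕ → Set
  D-logConvexAt x = D (suc x) * D (suc x) ≤ D (suc (suc x)) * D x

  -- As B x = D x + D (x + 1), log-convexity at x is the lower bound B x² ≤ D x (B x + B (x + 1)) on
  -- D x. The identity D (x + 2) = D x + B (x + 1) - B x carries lower bounds to lower bounds, while
  -- a single step, D (x + 1) = B x - D x, would reverse them.
  D-logConvex-suc² : ∀ x → D-logConvexAt (2 + x) → D-logConvexAt (4 + x)
  D-logConvex-suc² x lc = upper⁻ (*-cancelʳ-≤ _ _ (b + b₁) {{>-nonZero (≤-trans (B>0 (2 + x)) (m≤m+n b b₁))}} (begin
    b₂ * b₂ * (b + b₁) ≤⟨ B-convexity x ⟩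
    b₁ * b₁ * (b₂ + b₃) ≤⟨ *-monoˡ-≤ (b₂ + b₃) step ⟩
    d₂ * (b + b₁) * (b₂ + b₃) ≡⟨ i d₂ (b + b₁) (b₂ + b₃) ⟩
    d₂ * (b₂ + b₃) * (b + b₁) ∎))
    where
    open ≤-Reasoning
    b = B (2 + x)
    b₁ = B (3 + x)
    b₂ = B (4 + x)
    b₃ = B (5 + x)
    d₀ = D (2 + x)
    d₂ = D (4 + x)
    i : ∀ a b c → a * b * c ≡ a * c * b
    i = solve-∀
    upper : b * b ≤ d₀ * (b + b₁)
    upper = subst₂ (λ u v → u * u ≤ d₀ * (u + v)) (sym (B-split (2 + x))) (sym (B-split (3 + x)))
      (≤-from 0 lc (e d₀ (D (3 + x)) d₂))
      where
      e : ∀ d₀ d₁ d₂ → d₀ * ((d₀ + d₁) + (d₁ + d₂)) + d₁ * d₁ ≡ (d₀ + d₁) * (d₀ + d₁) + d₂ * d₀ + 0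
      e = solve-∀
    upper⁻ : b₂ * b₂ ≤ d₂ * (b₂ + b₃) → D-logConvexAt (4 + x)
    upper⁻ h = ≤-from 0 (subst₂ (λ u v → u * u ≤ d₂ * (u + v)) (B-split (4 + x)) (B-split (5 + x)) h) (e d₂ (D (5 + x)) (D (6 + x)))
      where
      e : ∀ d₀ d₁ d₂ → d₂ * d₀ + (d₀ + d₁) * (d₀ + d₁) ≡ d₁ * d₁ + d₀ * ((d₀ + d₁) + (d₁ + d₂)) + 0
      e = solve-∀
    bd : b + d₂ ≡ b₁ + d₀
    bd = trans (cong (_+ d₂) (B-split (2 + x))) (trans (e d₀ (D (3 + x)) d₂) (cong (_+ d₀) (sym (B-split (3 + x)))))
      where
      e : ∀ d₀ d₁ d₂ → d₀ + d₁ + d₂ ≡ d₁ + d₂ + d₀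
      e = solve-∀
    step : b₁ * b₁ ≤ d₂ * (b + b₁)
    step = ≤-from 0 upper (e (b + d₂) bd)
      where
      e : ∀ s → s ≡ b₁ + d₀ → d₂ * (b + b₁) + b * b ≡ b₁ * b₁ + d₀ * (b + b₁) + 0
      e _ _ = +-cancelʳ-≡ (b * b₁) _ _ (trans (k₁ d₂ b b₁) (trans (cong (_* (b + b₁)) bd) (k₂ d₀ b b₁)))
        where
        k₁ : ∀ d b c → d * (b + c) + b * b + b * c ≡ (b + d) * (b + c)
        k₁ = solve-∀
        k₂ : ∀ d b c → (c + d) * (b + c) ≡ c * c + d * (b + c) + 0 + b * c
        k₂ = solve-∀

  -- The step by two needs a start in each parity class, taken from the table.
  D-logConvex : ∀ x → D-logConvexAt (4 + x)
  D-logConvex zero          = subst₂ _≤_ (sym (cong₂ _*_ D5 D5)) (sym (cong₂ _*_ D6 D4)) (≤ᵇ⇒≤ 121 164 tt)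
  D-logConvex (suc zero)    = subst₂ _≤_ (sym (cong₂ _*_ D6 D6)) (sym (cong₂ _*_ D7 D5)) (≤ᵇ⇒≤ 1681 1782 tt)
  D-logConvex (suc (suc x)) = D-logConvex-suc² (2 + x) (D-logConvex x)

  D-pos-mono : ∀ x → 0 < D (4 + x) × D (4 + x) ≤ D (5 + x)
  D-pos-mono zero    = subst (0 <_) (sym D4) (s≤s z≤n) , subst₂ _≤_ (sym D4) (sym D5) (≤ᵇ⇒≤ 4 11 tt)
  D-pos-mono (suc x) with D-pos-mono x
  ... | pos , le = ≤-trans pos le , *-cancelʳ-≤ _ _ (D (4 + x)) {{>-nonZero pos}}
    (≤-trans (*-monoʳ-≤ (D (5 + x)) le) (D-logConvex x))

  -- Not from 0, as D 0 = 1 exceeds D 1 = 0. From 4 on, a log-convex sequence that has risen once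
  -- goes on rising.
  D-mono : ∀ x → 1 ≤ x → D x ≤ D (suc x)
  D-mono 1 _ rewrite D1 = z≤n
  D-mono 2 _ rewrite D2 | D3 = ≤-refl
  D-mono 3 _ rewrite D3 | D4 = s≤s z≤n
  D-mono (suc (suc (suc (suc x)))) _ = proj₂ (D-pos-mono x)

  D>0 : ∀ x → 2 ≤ x → 0 < D x
  D>0 1 (s≤s ())
  D>0 2 _ rewrite D2 = ≤-refl
  D>0 3 _ rewrite D3 = ≤-refl
  D>0 (suc (suc (suc (suc x)))) _ = proj₁ (D-pos-mono x)

  -- A ratio of B is a mediant of two consecutive ratios of D and lies between them. This bound and
  -- `B-ratio≤D` are the two halves of the sandwich that transfers `T-gap` from B to D.
  D-ratio≤B : ∀ x → D (5 + x) * B (4 + x) ≤ B (5 + x) * D (4 + x)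
  D-ratio≤B x = subst₂ (λ u v → D (5 + x) * u ≤ v * D (4 + x)) (sym (B-split (4 + x))) (sym (B-split (5 + x)))
    (≤-from 0 (D-logConvex x) (e (D (4 + x)) (D (5 + x)) (D (6 + x))))
    where
    e : ∀ d₀ d₁ d₂ → (d₁ + d₂) * d₀ + d₁ * d₁ ≡ d₁ * (d₀ + d₁) + d₂ * d₀ + 0
    e = solve-∀

  B-ratio≤D : ∀ u → B (5 + u) * D (5 + u) ≤ D (6 + u) * B (4 + u)
  B-ratio≤D u = subst₂ (λ x y → y * D (5 + u) ≤ D (6 + u) * x) (sym (B-split (4 + u))) (sym (B-split (5 + u)))
    (≤-from 0 (D-logConvex u) (e (D (4 + u)) (D (5 + u)) (D (6 + u))))
    where
    e : ∀ d₀ d₁ d₂ → d₂ * (d₀ + d₁) + d₁ * d₁ ≡ (d₁ + d₂) * d₁ + d₂ * d₀ + 0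
    e = solve-∀

  -- The sandwich costs one index on the right, D at r being compared with B at r - 1. The loss is
  -- affordable because j x is at most (r - 1) r and not merely r².
  D-gap-large : ∀ u j x → j ≤ 5 + u → j * (4 + x) ≤ (4 + u) * (5 + u) → Gap D (5 + u) (5 + u) j (4 + x)
  D-gap-large u j x j≤r jx≤ = *-cancelˡ-≤ (b * v) {{m*n≢0 b v {{>-nonZero (B>0 (4 + x))}} {{>-nonZero (B>0 (4 + u))}}}} (begin
    b * v * (j * (d′ * e) + r * (e * d)) ≡⟨ k₁ b v j d′ e r d ⟩
    j * (e * v) * (d′ * b) + d * e * r * (v * b) ≤⟨ +-monoˡ-≤ _ (*-monoʳ-≤ (j * (e * v)) (D-ratio≤B x)) ⟩
    j * (e * v) * (b′ * d) + d * e * r * (v * b) ≡⟨ k₂ b v j b′ e r d ⟩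
    d * e * (j * (b′ * v) + r * (v * b)) ≤⟨ *-monoʳ-≤ (d * e) (T-gap 0 0 (4 + u) r j (4 + x) (s≤s z≤n) (s≤s z≤n) j≤r jx≤) ⟩
    d * e * (r * (v′ * b) + j * (b * v)) ≡⟨ k₃ b v j v′ e r d ⟩
    r * b * d * (v′ * e) + d * e * j * (b * v) ≤⟨ +-monoˡ-≤ _ (*-monoʳ-≤ (r * b * d) (B-ratio≤D u)) ⟩
    r * b * d * (e′ * v) + d * e * j * (b * v) ≡⟨ k₄ b v j e′ e r d ⟩
    b * v * (r * (e′ * d) + j * (d * e)) ∎)
    where
    open ≤-Reasoning
    r = 5 + u
    d = D (4 + x)
    d′ = D (5 + x)
    e = D (5 + u)
    e′ = D (6 + u)
    b = B (4 + x)
    b′ = B (5 + x)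
    v = B (4 + u)
    v′ = B (5 + u)
    k₁ : ∀ b v j d′ e r d → b * v * (j * (d′ * e) + r * (e * d)) ≡ j * (e * v) * (d′ * b) + d * e * r * (v * b)
    k₁ = solve-∀
    k₂ : ∀ b v j b′ e r d → j * (e * v) * (b′ * d) + d * e * r * (v * b) ≡ d * e * (j * (b′ * v) + r * (v * b))
    k₂ = solve-∀
    k₃ : ∀ b v j v′ e r d → d * e * (r * (v′ * b) + j * (b * v)) ≡ r * b * d * (v′ * e) + d * e * j * (b * v)
    k₃ = solve-∀
    k₄ : ∀ b v j e′ e r d → r * b * d * (e′ * v) + d * e * j * (b * v) ≡ b * v * (r * (e′ * d) + j * (d * e))
    k₄ = solve-∀

  -- The constant 11 / 5 is what the exceptional x = 3 demands: there R x - 1 = 3, j ≤ 2 and r ≥ 5,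
  -- so R r - 1 ≥ 6 / 5 is enough. It is available since already B 5 / B 4 = 52 / 15 exceeds 33 /
  -- 15.
  D-ratio≥ : ∀ u → 11 * D (5 + u) ≤ 5 * D (6 + u)
  D-ratio≥ u = *-cancelʳ-≤ _ _ v {{>-nonZero (B>0 (4 + u))}} (begin
    11 * e * v ≡⟨ k₁ e v ⟩
    e * (11 * v) ≤⟨ *-monoʳ-≤ e B-ratio≥ ⟩
    e * (5 * v′) ≡⟨ k₂ e v′ ⟩
    5 * (v′ * e) ≤⟨ *-monoʳ-≤ 5 (B-ratio≤D u) ⟩
    5 * (e′ * v) ≡⟨ *-assoc 5 e′ v ⟨
    5 * e′ * v ∎)
    where
    open ≤-Reasoning
    e = D (5 + u)
    e′ = D (6 + u)
    v = B (4 + u)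
    v′ = B (5 + u)
    k₁ : ∀ e v → 11 * e * v ≡ e * (11 * v)
    k₁ = solve-∀
    k₂ : ∀ e v → e * (5 * v) ≡ 5 * (v * e)
    k₂ = solve-∀
    B-ratio≥ : 11 * v ≤ 5 * v′
    B-ratio≥ = *-cancelˡ-≤ 3 (begin
      3 * (11 * v) ≡⟨ *-assoc 3 11 v ⟨
      33 * v ≤⟨ *-monoˡ-≤ v (≤ᵇ⇒≤ 33 52 tt) ⟩
      52 * v ≤⟨ subst₂ (λ p q → p * v ≤ v′ * q) B5 B4 (logConvex-ratio B B>0 B-logConvex 4 (4 + u) (m≤m+n 4 u)) ⟩
      v′ * 15 ≡⟨ k v′ ⟩
      3 * (5 * v′) ∎)
      where
      k : ∀ v → v * 15 ≡ 3 * (5 * v)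
      k = solve-∀

  -- For r ≤ 4 the condition j + x < 2r leaves finitely many cases, all decided by evaluation.
  small-gap : ∀ {r} → r < 5 → ∀ {j} → j < 8 → ∀ {x} → x < 8 → 1 ≤ j → j < x → j + x < r + r → Gap small r r j x
  small-gap = from-yes (allUpTo? (λ r → allUpTo? (λ j → allUpTo? (λ x →
    (1 ≤? j) →-dec (j <? x) →-dec (j + x <? r + r) →-dec
    (j * (small (suc x) * small r) + r * (small r * small x) ≤? r * (small (suc r) * small x) + j * (small x * small r))) 8) 8) 5)

  D-gap-small : ∀ r j x → r < 5 → 1 ≤ j → j < x → j + x < r + r → Gap D r r j x
  D-gap-small r j x r<5 1≤j j<x h = transport (m≤n⇒m≤1+n r<7) (s≤s r<7) (m≤n⇒m≤1+n x<7) (s≤s x<7)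
    where
    transport : r < 8 → suc r < 8 → x < 8 → suc x < 8 → Gap D r r j x
    transport r<8 r<7 x<8 x<7
      rewrite D-small r r<8 | D-small (suc r) r<7 | D-small x x<8 | D-small (suc x) x<7 =
      small-gap r<5 (<-trans j<x x<8) x<8 1≤j j<x h
    r<7 : r < 7
    r<7 = ≤-trans r<5 (≤ᵇ⇒≤ 5 7 tt)
    x<7 : x < 7
    x<7 = ≤-trans (+-monoˡ-≤ x 1≤j) (s≤s⁻¹ h′)
      where
      h′ : j + x < 8
      h′ = ≤-trans h (+-mono-≤ (s≤s⁻¹ r<5) (s≤s⁻¹ r<5))

  -- Below 4 the ratios of D are irregular: at x = 2 the ratio is 1 and the left side gains nothing,
  -- at x = 3 it is 4 and `D-ratio≥` is called in. From 4 on, r < 5 is left to the table and r ≥ 5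
  -- to `D-gap-large`.
  D-gap : ∀ r j x → 1 ≤ j → j < x → j + x < r + r → Gap D r r j x
  D-gap r j 0 _ () _
  D-gap r j 1 1≤j (s≤s j≤0) _ = ⊥-elim (<⇒≱ 1≤j j≤0)
  D-gap r j 2 1≤j j<2 j+2<2r = subst₂ (λ p q → j * (p * D r) + r * (D r * q) ≤ r * (D (suc r) * q) + j * (q * D r))
    (sym D3) (sym D2) (≤-from 0 (*-monoʳ-≤ r (D-mono r (1≤r r j+2<2r))) (e j r (D r) (D (suc r))))
    where
    1≤r : ∀ r → j + 2 < r + r → 1 ≤ r
    1≤r (suc r) _ = s≤s z≤n
    e : ∀ j r d d′ → r * (d′ * 1) + j * (1 * d) + r * d ≡ j * (1 * d) + r * (d * 1) + r * d′ + 0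
    e = solve-∀
  D-gap (suc (suc (suc (suc (suc u))))) j 3 1≤j (s≤s j≤2) _ =
    subst₂ (λ p q → j * (p * D r) + r * (D r * q) ≤ r * (D (suc r) * q) + j * (q * D r)) (sym D4) (sym D3)
      (*-cancelˡ-≤ 5 (≤-from ((6 * u) * D r) (+-mono-≤ (*-monoʳ-≤ r (D-ratio≥ u)) (*-monoˡ-≤ (15 * D r) j≤2)) (e u j (D r) (D (suc r)))))
    where
    r = 5 + u
    e : ∀ u j d d′ → 5 * ((5 + u) * (d′ * 1) + j * (1 * d)) + ((5 + u) * (11 * d) + j * (15 * d))
      ≡ 5 * (j * (4 * d) + (5 + u) * (d * 1)) + ((5 + u) * (5 * d′) + 2 * (15 * d)) + (6 * u) * d
    e = solve-∀
  D-gap (suc (suc (suc (suc (suc u))))) j (suc (suc (suc (suc x)))) 1≤j j<x h =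
    D-gap-large u j x j≤r (product≤ (4 + u) j (4 + x) (≤-trans (s≤s⁻¹ h) (≤-reflexive (+-suc (4 + u) (4 + u)))))
    where
    r = 5 + u
    j≤r : j ≤ r
    j≤r with j ≤? r
    ... | yes p = p
    ... | no ¬p = ⊥-elim (<⇒≱ h (+-mono-≤ (<⇒≤ (≰⇒> ¬p)) (<⇒≤ (<-trans (≰⇒> ¬p) j<x))))
  D-gap 0 j x@(suc (suc (suc _))) = D-gap-small 0 j x (≤ᵇ⇒≤ _ _ tt)
  D-gap 1 j x@(suc (suc (suc _))) = D-gap-small 1 j x (≤ᵇ⇒≤ _ _ tt)
  D-gap 2 j x@(suc (suc (suc _))) = D-gap-small 2 j x (≤ᵇ⇒≤ _ _ tt)
  D-gap 3 j x@(suc (suc (suc _))) = D-gap-small 3 j x (≤ᵇ⇒≤ _ _ tt)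
  D-gap 4 j x@(suc (suc (suc _))) = D-gap-small 4 j x (≤ᵇ⇒≤ _ _ tt)

  weight : ℕ → ℕ → ℕ
  weight zero    x = D x
  weight (suc h) x = weight h x + weight h (suc x)

  -- The first replacement turns D into the Bell numbers, and each later one is a factor X + 1 under
  -- the expectation, whence c = 1.
  weight-T : ∀ g x → weight (suc g) x ≡ T 1 g x
  weight-T zero    x = sym (B-split x)
  weight-T (suc g) x = trans (cong₂ _+_ (weight-T g x) (weight-T g (suc x)))
    (trans (+-comm (T 1 g x) _) (cong (T 1 g (suc x) +_) (sym (+-identityʳ _))))

  weight-mono : ∀ h x → 1 ≤ x → weight h x ≤ weight h (suc x)
  weight-mono zero    x       1≤x = D-mono x 1≤x
  weight-mono (suc g) (suc x) _   = subst₂ _≤_ (sym (weight-T g (suc x))) (sym (weight-T g (suc (suc x)))) (T-mono 1 g x)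

  weight>0 : ∀ h x → 2 ≤ x → 0 < weight h x
  weight>0 zero    x 2≤x = D>0 x 2≤x
  weight>0 (suc g) x _   = subst (0 <_) (sym (weight-T g x)) (T>0 1 g x)

  weight-gap : ∀ h r j x → 1 ≤ j → j < x → j + x < r + r → Gap (weight h) r r j x
  weight-gap zero    r       j x 1≤j j<x h = D-gap r j x 1≤j j<x h
  weight-gap (suc g) r@(suc s) j x 1≤j j<x h
    rewrite weight-T g r | weight-T g (suc r) | weight-T g x | weight-T g (suc x) =
    T-gap 1 g r r j x (s≤s z≤n) (≤-trans 1≤j (<⇒≤ j<x)) j≤r
      (≤-trans (product≤ s j x (≤-trans (s≤s⁻¹ h) (≤-reflexive (+-suc s s)))) (*-monoˡ-≤ r (n≤1+n s)))
    where
    j≤r : j ≤ r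
    j≤r with j ≤? r
    ... | yes p = p
    ... | no ¬p = ⊥-elim (<⇒≱ h (+-mono-≤ (<⇒≤ (≰⇒> ¬p)) (<⇒≤ (<-trans (≰⇒> ¬p) j<x))))

  -- The strict hypothesis is r (R r - 1) < t, so `Gap` yields j (R x - 1) < t.
  gap⇒< : ∀ (a : ℕ → ℕ) t r j x → Gap a r r j x → r * a (suc r) < (t + r) * a r → 0 < a x →
          j * a (suc x) < (t + j) * a x
  gap⇒< a t r j x gap lt 0<ax = *-cancelʳ-< (a r) _ _ (+-cancelʳ-< (r * (a r * a x)) _ _ (begin-strict
    j * a (suc x) * a r + r * (a r * a x) ≡⟨ cong (_+ r * (a r * a x)) (*-assoc j (a (suc x)) (a r)) ⟩
    j * (a (suc x) * a r) + r * (a r * a x) ≤⟨ gap ⟩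
    r * (a (suc r) * a x) + j * (a x * a r) ≡⟨ cong (_+ j * (a x * a r)) (*-assoc r (a (suc r)) (a x)) ⟨
    r * a (suc r) * a x + j * (a x * a r) <⟨ +-monoˡ-< (j * (a x * a r)) (*-monoˡ-< (a x) {{>-nonZero 0<ax}} lt) ⟩
    (t + r) * a r * a x + j * (a x * a r) ≡⟨ e t r j (a r) (a x) ⟩
    (t + j) * a x * a r + r * (a r * a x) ∎))
    where
    open ≤-Reasoning
    e : ∀ t r j b a → (t + r) * b * a + j * (a * b) ≡ (t + j) * a * b + r * (b * a)
    e = solve-∀

  -- The dichotomy of the induction, applied with t - 1 for t: the first case feeds `pivot-average`,
  -- the second `PushPull`. Failure of averaging at r is precisely what bounds all the pulling
  -- inequalities.
  weight-step : ∀ h t r → (t + r) * weight h r ≤ r * weight h (suc r)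
    ⊎ (r * weight h (suc r) < (t + r) * weight h r
       × ∀ j x → 1 ≤ j → j < x → j + x < r + r → j * weight h (suc x) < (t + j) * weight h x)
  weight-step h t r with (t + r) * weight h r ≤? r * weight h (suc r)
  ... | yes p = inj₁ p
  ... | no ¬p = inj₂ (≰⇒> ¬p , λ j x 1≤j j<x j+x<2r →
    gap⇒< (weight h) t r j x (weight-gap h r j x 1≤j j<x j+x<2r) (≰⇒> ¬p) (weight>0 h x (≤-trans (s≤s 1≤j) j<x)))

-- Boolean conditions and counting identities for intersections.

double-injective : ∀ {p q} → p + p ≡ q + q → p ≡ q
double-injective {p} {q} eq with <-cmp p q
... | tri< lt _ _  = ⊥-elim (<⇒≢ (+-mono-< lt lt) eq)
... | tri≈ _ p≡q _ = p≡q
... | tri> _ _ gt  = ⊥-elim (<⇒≢ (+-mono-< gt gt) (sym eq))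

≡true : ∀ {b} → Bool.T b → b ≡ true
≡true {true} _ = refl

true≡ : ∀ {b} → b ≡ true → Bool.T b
true≡ refl = tt

≢true : ∀ {b} → ¬ (b ≡ true) → b ≡ false
≢true {true}  h = ⊥-elim (h refl)
≢true {false} h = refl

≤ᵇ-true : ∀ {m n} → (m ≤ᵇ n) ≡ true → m ≤ n
≤ᵇ-true {m} {n} h = ≤ᵇ⇒≤ m n (true≡ h)

true-≤ᵇ : ∀ {m n} → m ≤ n → (m ≤ᵇ n) ≡ true
true-≤ᵇ h = ≡true (≤⇒≤ᵇ h)

≡ᵇ-true : ∀ m n → (m ≡ᵇ n) ≡ true → m ≡ n
≡ᵇ-true m n h = ≡ᵇ⇒≡ m n (true≡ h)

true-≡ᵇ : ∀ m n → m ≡ n → (m ≡ᵇ n) ≡ true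
true-≡ᵇ m n h = ≡true (≡⇒≡ᵇ m n h)

∧-intro : ∀ {a b} → a ≡ true → b ≡ true → a ∧ b ≡ true
∧-intro refl refl = refl

∨-split : ∀ {a b} → a ∨ b ≡ true → a ≡ true ⊎ b ≡ true
∨-split {true}  h = inj₁ refl
∨-split {false} h = inj₂ h

∨-introʳ : ∀ {a b} → b ≡ true → a ∨ b ≡ true
∨-introʳ {true}  h = refl
∨-introʳ {false} h = h

∨-introˡ : ∀ {a b} → a ≡ true → a ∨ b ≡ true
∨-introˡ refl = refl

not-true : ∀ {a} → not a ≡ true → a ≡ false
not-true {false} _ = refl

not-false : ∀ {a} → a ≡ false → not a ≡ true
not-false refl = refl

opaque

  anyᵇ : (Fin n → Bool) → Bool
  anyᵇ f = does (Fin.any? λ x → f x Bool.≟ true)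

  anyᵇ-true : (f : Fin n → Bool) → anyᵇ f ≡ true → ∃[ x ] f x ≡ true
  anyᵇ-true f h with Fin.any? (λ x → f x Bool.≟ true)
  ... | yes p = p

  true-anyᵇ : (f : Fin n → Bool) (x : Fin n) → f x ≡ true → anyᵇ f ≡ true
  true-anyᵇ f x h with Fin.any? (λ x → f x Bool.≟ true)
  ... | yes _ = refl
  ... | no ¬p = ⊥-elim (¬p (x , h))

opaque
  unfolding Σᶠ

  Σᶠ-one : (f : Fin n → ℕ) (i : Fin n) → 1 ≤ f i → 1 ≤ Σᶠ f
  Σᶠ-one f zero    h = ≤-trans h (m≤m+n _ _)
  Σᶠ-one f (suc i) h = ≤-trans (Σᶠ-one (f ∘ suc) i h) (m≤n+m _ _)

  Σᶠ-two : (f : Fin n → ℕ) (i j : Fin n) → i ≢ j → 1 ≤ f i → 1 ≤ f j → 2 ≤ Σᶠ f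
  Σᶠ-two f zero    zero    i≢j _ _ = ⊥-elim (i≢j refl)
  Σᶠ-two f zero    (suc j) _   p q = +-mono-≤ p (Σᶠ-one (f ∘ suc) j q)
  Σᶠ-two f (suc i) zero    _   p q = +-mono-≤ q (Σᶠ-one (f ∘ suc) i p)
  Σᶠ-two f (suc i) (suc j) i≢j p q = ≤-trans (Σᶠ-two (f ∘ suc) i j (i≢j ∘ cong suc) p q) (m≤n+m _ _)

opaque
  unfolding lin sz co I

  I-swap : {i j : Fin n} → i ≢ j → ∀ A B →
    I (swap i j A) B + (⟦ lookup A i ⟧ * ⟦ lookup B i ⟧ + ⟦ lookup A j ⟧ * ⟦ lookup B j ⟧)
      ≡ I A B + (⟦ lookup A j ⟧ * ⟦ lookup B i ⟧ + ⟦ lookup A i ⟧ * ⟦ lookup B j ⟧)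
  I-swap i≢j A B = lin-swap i≢j (λ e → ⟦ lookup B e ⟧) A

  co-two : (A : Subset n) (i j : Fin n) → i ≢ j → lookup A i ≡ false → lookup A j ≡ false → 2 ≤ co A
  co-two A i j i≢j p q = Σᶠ-two _ i j i≢j (subst (λ b → 1 ≤ ⟦ not b ⟧) (sym p) ≤-refl) (subst (λ b → 1 ≤ ⟦ not b ⟧) (sym q) ≤-refl)

  co-one : (A : Subset n) (i : Fin n) → lookup A i ≡ false → 1 ≤ co A
  co-one A i p = Σᶠ-one _ i (subst (λ b → 1 ≤ ⟦ not b ⟧) (sym p) ≤-refl)

  I-one : (A B : Subset n) (i : Fin n) → lookup A i ≡ true → lookup B i ≡ true → 1 ≤ I A B
  I-one A B i p q = Σᶠ-one _ i (subst₂ (λ a b → 1 ≤ ⟦ a ⟧ * ⟦ b ⟧) (sym p) (sym q) ≤-refl)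

  I-two : (A B : Subset n) (i j : Fin n) → i ≢ j → lookup A i ≡ true → lookup B i ≡ true →
          lookup A j ≡ true → lookup B j ≡ true → 2 ≤ I A B
  I-two A B i j i≢j p q p′ q′ = Σᶠ-two _ i j i≢j (subst₂ (λ a b → 1 ≤ ⟦ a ⟧ * ⟦ b ⟧) (sym p) (sym q) ≤-refl)
    (subst₂ (λ a b → 1 ≤ ⟦ a ⟧ * ⟦ b ⟧) (sym p′) (sym q′) ≤-refl)

  I-cong : (A B K : Subset n) → (∀ e → lookup K e ≡ true → lookup A e ≡ lookup B e) → I A K ≡ I B K
  I-cong A B K h = Σᶠ-cong λ e → f (lookup K e) (h e)
    where
    f : ∀ k {a b} → (k ≡ true → a ≡ b) → ⟦ a ⟧ * ⟦ k ⟧ ≡ ⟦ b ⟧ * ⟦ k ⟧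
    f true  h rewrite h refl = refl
    f false {a} {b} h = trans (*-zeroʳ ⟦ a ⟧) (sym (*-zeroʳ ⟦ b ⟧))

  I-cover : (A B K : Subset n) → (∀ e → lookup K e ≡ true → lookup A e ∨ lookup B e ≡ true) →
    (∀ e → lookup K e ≡ false → lookup A e ∧ lookup B e ≡ false) → I A K + I B K ≡ sz K + I A B
  I-cover A B K p q = Σᶠ-balance λ e → f (lookup A e) (lookup B e) (lookup K e) (p e) (q e)
    where
    f : ∀ a b k → (k ≡ true → a ∨ b ≡ true) → (k ≡ false → a ∧ b ≡ false) →
        ⟦ a ⟧ * ⟦ k ⟧ + ⟦ b ⟧ * ⟦ k ⟧ ≡ ⟦ k ⟧ + ⟦ a ⟧ * ⟦ b ⟧
    f true  true  true  p q = refl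
    f true  false true  p q = refl
    f false true  true  p q = refl
    f false false true  p q with () ← p refl
    f true  true  false p q with () ← q refl
    f true  false false p q = refl
    f false b     false p q = *-zeroʳ ⟦ b ⟧

  I-inclusion : (A B K : Subset n) → I A K + I B K ≤ I A B + sz K
  I-inclusion A B K = subst₂ _≤_ (Σᶠ-+ _ _) (Σᶠ-+ _ _) (Σᶠ-mono λ e → f (lookup A e) (lookup B e) (lookup K e))
    where
    f : ∀ a b k → ⟦ a ⟧ * ⟦ k ⟧ + ⟦ b ⟧ * ⟦ k ⟧ ≤ ⟦ a ⟧ * ⟦ b ⟧ + ⟦ k ⟧
    f true  true  true  = ≤-refl
    f true  false true  = ≤-refl
    f false true  true  = ≤-refl
    f false false true  = z≤n
    f true  true  false = z≤n
    f true  false false = z≤n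
    f false true  false = z≤n
    f false false false = z≤n

  I-⊑ : (A K : Subset n) → A ⊑ K → I A K ≡ sz A
  I-⊑ A K h = Σᶠ-cong λ e → f (lookup A e) (h e)
    where
    f : ∀ a {k} → (a ≡ true → k ≡ true) → ⟦ a ⟧ * ⟦ k ⟧ ≡ ⟦ a ⟧
    f true  h rewrite h refl = refl
    f false h = refl

  I-partition : (A K M : Subset n) → (∀ e → lookup A e ≡ true → ⟦ lookup K e ⟧ + ⟦ lookup M e ⟧ ≡ 1) → sz A ≡ I A K + I A M
  I-partition A K M h = trans (Σᶠ-cong λ e → f (lookup A e) (h e)) (Σᶠ-+ _ _)
    where
    f : ∀ a {k m} → (a ≡ true → k + m ≡ 1) → ⟦ a ⟧ ≡ ⟦ a ⟧ * k + ⟦ a ⟧ * m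
    f true  {k} {m} h = trans (sym (h refl)) (sym (cong₂ _+_ (+-identityʳ k) (+-identityʳ m)))
    f false h = refl

  I-complement : (A B M : Subset n) → (∀ e → lookup M e ≡ true → lookup B e ≡ not (lookup A e)) → I A M + I B M ≡ sz M
  I-complement A B M h = trans (sym (Σᶠ-+ _ _)) (Σᶠ-cong λ e → f (lookup A e) (lookup B e) (lookup M e) (h e))
    where
    f : ∀ a b m → (m ≡ true → b ≡ not a) → ⟦ a ⟧ * ⟦ m ⟧ + ⟦ b ⟧ * ⟦ m ⟧ ≡ ⟦ m ⟧
    f true  b true  h rewrite h refl = refl
    f false b true  h rewrite h refl = refl
    f a     b false h rewrite *-zeroʳ ⟦ a ⟧ | *-zeroʳ ⟦ b ⟧ = refl

  sz-full : (A : Subset n) → (∀ e → lookup A e ≡ true) → sz A ≡ n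
  sz-full {n} A h = trans (Σᶠ-cong λ e → cong ⟦_⟧ (h e)) (trans (Σᶠ-const n 1) (*-identityʳ n))

  Σ-K∖ : (B K : Subset n) → Σᶠ (λ x → ⟦ lookup K x ⟧ * ⟦ not (lookup B x) ⟧) + I B K ≡ sz K
  Σ-K∖ B K = trans (sym (Σᶠ-+ _ _)) (Σᶠ-cong λ e → f (lookup B e) (lookup K e))
    where
    f : ∀ b k → ⟦ k ⟧ * ⟦ not b ⟧ + ⟦ b ⟧ * ⟦ k ⟧ ≡ ⟦ k ⟧
    f true  true  = refl
    f true  false = refl
    f false true  = refl
    f false false = refl

  Σ-K∩ : (A K : Subset n) → Σᶠ (λ x → ⟦ lookup K x ⟧ * ⟦ lookup A x ⟧) ≡ I A K
  Σ-K∩ A K = Σᶠ-cong λ e → *-comm ⟦ lookup K e ⟧ _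

  I-exists : (A B : Subset n) → 1 ≤ I A B → ∃[ e ] lookup A e ≡ true × lookup B e ≡ true
  I-exists A B h with Fin.any? (λ e → (lookup A e ∧ lookup B e) Bool.≟ true)
  ... | yes (e , p) = e , ∧-split p
  ... | no ¬p = ⊥-elim (<⇒≢ h (sym (Σᶠ-0 λ e → trans (sym (⟦∧⟧ (lookup A e) _)) (cong ⟦_⟧ (≢true λ p → ¬p (e , p))))))

  I-<-exists : (A B K : Subset n) → I A K < I B K → ∃[ e ] lookup K e ≡ true × lookup B e ≡ true × lookup A e ≡ false
  I-<-exists A B K h with Fin.any? (λ e → (lookup K e ∧ lookup B e ∧ not (lookup A e)) Bool.≟ true)
  ... | yes (e , p) with ∧-split {lookup K e} p
  ...   | Ke , q with ∧-split {lookup B e} q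
  ...     | Be , Ae = e , Ke , Be , not-true Ae
  I-<-exists A B K h | no ¬p = ⊥-elim (<⇒≱ h (Σᶠ-mono λ e → f (lookup A e) (lookup B e) (lookup K e) (λ p → ¬p (e , p))))
    where
    f : ∀ a b k → ¬ (k ∧ b ∧ not a ≡ true) → ⟦ b ⟧ * ⟦ k ⟧ ≤ ⟦ a ⟧ * ⟦ k ⟧
    f true  true  k     p = ≤-refl
    f true  false k     p = z≤n
    f false true  true  p = ⊥-elim (p refl)
    f false true  false p = z≤n
    f false false k     p = z≤n

  I-upd : (A K : Subset n) (y : Fin n) → lookup K y ≡ false → I A (K [ y ]≔ true) ≡ I A K + ⟦ lookup A y ⟧
  I-upd A K y Ky = begin
    I A (K [ y ]≔ true) ≡⟨ I-comm A (K [ y ]≔ true) ⟩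
    I (K [ y ]≔ true) A ≡⟨ +-identityʳ _ ⟨
    I (K [ y ]≔ true) A + 0 ≡⟨ cong (λ b → I (K [ y ]≔ true) A + ⟦ b ⟧ * ⟦ lookup A y ⟧) Ky ⟨
    lin (λ e → ⟦ lookup A e ⟧) (K [ y ]≔ true) + ⟦ lookup K y ⟧ * ⟦ lookup A y ⟧ ≡⟨ lin-upd (λ e → ⟦ lookup A e ⟧) K y true ⟩
    I K A + 1 * ⟦ lookup A y ⟧ ≡⟨ cong₂ _+_ (I-comm K A) (*-identityˡ _) ⟩
    I A K + ⟦ lookup A y ⟧ ∎
    where open ≡-Reasoning

  Σ-out : (A : Subset n) → Σᶠ (λ x → ⟦ not (lookup A x) ⟧) ≡ co A
  Σ-out A = refl

I-move : {i j : Fin n} → i ≢ j → ∀ A B → lookup A i ≡ true → lookup A j ≡ false →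
         I (swap i j A) B + ⟦ lookup B i ⟧ ≡ I A B + ⟦ lookup B j ⟧
I-move {i = i} {j} i≢j A B p q with I-swap i≢j A B
... | eq rewrite p | q | +-identityʳ ⟦ lookup B i ⟧ | +-identityʳ ⟦ lookup B i ⟧ | +-identityʳ ⟦ lookup B j ⟧ = eq

I-move′ : {i j : Fin n} → i ≢ j → ∀ A B → lookup A i ≡ false → lookup A j ≡ true →
          I (swap i j A) B + ⟦ lookup B j ⟧ ≡ I A B + ⟦ lookup B i ⟧
I-move′ {i = i} {j} i≢j A B p q with I-swap i≢j A B
... | eq rewrite p | q | +-identityʳ ⟦ lookup B j ⟧ | +-identityʳ ⟦ lookup B i ⟧ | +-identityʳ ⟦ lookup B i ⟧ = eq

-- Weighted families and their compression.

Family : ℕ → Set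
Family n = Subset n → Bool

V : (Subset n → ℕ) → Family n → ℕ
V f ℱ = Σˢ λ A → ⟦ ℱ A ⟧ * f A

V-mono : (f : Subset n → ℕ) {ℱ 𝒢 : Family n} → (∀ A → ℱ A ≡ true → 𝒢 A ≡ true) → V f ℱ ≤ V f 𝒢
V-mono f h = Σˢ-mono λ A → *-monoˡ-≤ (f A) (⟦⟧-mono (h A))

V-pos : (f : Subset n → ℕ) (ℱ : Family n) (A : Subset n) → ℱ A ≡ true → 0 < f A → 0 < V f ℱ
V-pos f ℱ A h lt = ≤-trans (≤-trans lt (≤-reflexive (sym (trans (cong (λ b → ⟦ b ⟧ * f A) h) (+-identityʳ (f A))))))
  (Σˢ-term (λ A → ⟦ ℱ A ⟧ * f A) A)

V-nonempty : (f : Subset n → ℕ) (ℱ : Family n) → 0 < V f ℱ → ∃[ A ] ℱ A ≡ true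
V-nonempty f ℱ lt with Subset.anySubset? (λ A → ℱ A Bool.≟ true)
... | yes p = p
... | no ¬p = ⊥-elim (<⇒≢ lt (sym (Σˢ-0 λ A → cong (λ b → ⟦ b ⟧ * f A) (≢true (λ h → ¬p (A , h))))))

V-balance : (f : Subset n → ℕ) {ℱ 𝒢 ℋ 𝒦 : Family n} → (∀ A → ⟦ ℱ A ⟧ + ⟦ 𝒢 A ⟧ ≡ ⟦ ℋ A ⟧ + ⟦ 𝒦 A ⟧) →
            V f ℱ + V f 𝒢 ≡ V f ℋ + V f 𝒦
V-balance f {ℱ} {𝒢} {ℋ} {𝒦} h = trans (sym (Σˢ-+ _ _)) (trans (Σˢ-cong λ A →
  trans (sym (*-distribʳ-+ (f A) ⟦ ℱ A ⟧ _)) (trans (cong (_* f A) (h A)) (*-distribʳ-+ (f A) ⟦ ℋ A ⟧ _))) (Σˢ-+ _ _))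

V-* : (c : ℕ) (f : Subset n → ℕ) (ℱ : Family n) → V (λ A → c * f A) ℱ ≡ c * V f ℱ
V-* c f ℱ = trans (Σˢ-cong λ A → e ⟦ ℱ A ⟧ c (f A)) (Σˢ-*ˡ c _)
  where
  e : ∀ b c f → b * (c * f) ≡ c * (b * f)
  e = solve-∀

module _ (π : Subset n → Subset n) (inv : ∀ A → π (π A) ≡ A) (f g : Subset n → ℕ) {ℱ 𝒢 : Family n}
         (h : ∀ A → ℱ A ≡ true → 𝒢 (π A) ≡ true × f A < g (π A)) where

  private
    pointwise : ∀ A → ⟦ ℱ A ⟧ * f A ≤ ⟦ 𝒢 (π A) ⟧ * g (π A)
    pointwise A with ℱ A in eq
    ... | false = z≤n
    ... | true rewrite proj₁ (h A eq) = +-monoˡ-≤ 0 (<⇒≤ (proj₂ (h A eq)))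

  V-map-≤ : V f ℱ ≤ V g 𝒢
  V-map-≤ = subst (V f ℱ ≤_) (Σˢ-involution π inv (λ A → ⟦ 𝒢 A ⟧ * g A)) (Σˢ-mono pointwise)

  V-map-< : ∀ A → 𝒢 A ≡ true → 0 < g A → V f ℱ < V g 𝒢
  V-map-< A A∈𝒢 pos = subst (V f ℱ <_) (Σˢ-involution π inv (λ A → ⟦ 𝒢 A ⟧ * g A))
    (Σˢ-mono-< pointwise (π A) strict)
    where
    strict : ⟦ ℱ (π A) ⟧ * f (π A) < ⟦ 𝒢 (π (π A)) ⟧ * g (π (π A))
    strict with ℱ (π A) in eq
    ... | false rewrite inv A | A∈𝒢 = ≤-trans pos (≤-reflexive (sym (+-identityʳ (g A))))
    ... | true  rewrite proj₁ (h (π A) eq) = +-monoˡ-< 0 (proj₂ (h (π A) eq))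

W : (ℕ → ℕ) → Family n → ℕ
W a = V (a ∘ co)

Intersectingᶠ : ℕ → Family n → Set
Intersectingᶠ t ℱ = ∀ A B → ℱ A ≡ true → ℱ B ≡ true → t ≤ I A B

-- The Frankl family, for sets K of size t + 2 s.
F : ℕ → ℕ → Subset n → Family n
F t s K A = (t + s) ≤ᵇ I A K

odd≢even : ∀ s r → suc (s + s) ≢ r + r
odd≢even zero    (suc r) eq with () ← trans (suc-injective eq) (+-suc r r)
odd≢even (suc s) (suc r) eq = odd≢even s r (trans (sym (+-suc s s)) (suc-injective (trans (suc-injective eq) (+-suc r r))))

-- The set U is the complement of K ∪ {y}, the part of the ground set on which pulling takes
-- complements.
module Tail {n : ℕ} (K : Subset n) (y : Fin n) (Ky : lookup K y ≡ false) where

  private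
    full C : Subset n
    full = tabulate λ _ → true
    C = full [ y ]≔ false

    C-y : lookup C y ≡ false
    C-y = lookup-upd full y false

    C-o : ∀ {e} → e ≢ y → lookup C e ≡ true
    C-o {e} e≢y = trans (lookup-upd′ full false e≢y) (lookup∘tabulate _ e)

  opaque

    U : Subset n
    U = C ∖ K

    M-intro : ∀ {e} → lookup K e ≡ false → e ≢ y → lookup U e ≡ true
    M-intro {e} Ke e≢y = trans (lookup-∖ C K e) (∧-intro (C-o e≢y) (not-false Ke))

    M-elim : ∀ {e} → lookup U e ≡ true → lookup K e ≡ false × e ≢ y
    M-elim {e} Me with ∧-split {lookup C e} (trans (sym (lookup-∖ C K e)) Me)
    ... | Ce , Ke = not-true Ke , λ { refl → true≢false Ce C-y }

  M-not : ∀ {e} → lookup K e ≡ true ⊎ e ≡ y → lookup U e ≡ false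
  M-not (inj₁ Ke)   = ≢true λ Me → true≢false Ke (proj₁ (M-elim Me))
  M-not (inj₂ refl) = ≢true λ Me → proj₂ (M-elim Me) refl

  split : ∀ A → lookup A y ≡ false → sz A ≡ I A K + I A U
  split A Ay = I-partition A K U λ e Ae → f e (λ { refl → true≢false Ae Ay })
    where
    f : ∀ e → e ≢ y → ⟦ lookup K e ⟧ + ⟦ lookup U e ⟧ ≡ 1
    f e e≢y with lookup K e in Ke
    ... | true  rewrite M-not (inj₁ Ke) = refl
    ... | false rewrite M-intro Ke e≢y = refl

  private
    C-size : suc (sz C) ≡ n
    C-size = begin
      suc (sz C) ≡⟨ +-comm 1 (sz C) ⟩
      sz C + 1 ≡⟨ cong (_+ 1) (sz≡lin C) ⟨
      lin (λ _ → 1) C + 1 ≡⟨ cong (λ b → lin (λ _ → 1) C + ⟦ b ⟧ * 1) (lookup∘tabulate (λ _ → true) y) ⟨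
      lin (λ _ → 1) C + ⟦ lookup full y ⟧ * 1 ≡⟨ lin-upd (λ _ → 1) full y false ⟩
      lin (λ _ → 1) full + 0 ≡⟨ +-identityʳ _ ⟩
      lin (λ _ → 1) full ≡⟨ sz≡lin full ⟩
      sz full ≡⟨ sz-full full (lookup∘tabulate _) ⟩
      n ∎
      where open ≡-Reasoning

  M+K : suc (sz K + sz U) ≡ n
  M+K = trans (cong suc (trans (cong₂ _+_ (sym CK) (sym CM)) (sym (split C C-y)))) C-size
    where
    CK : I C K ≡ sz K
    CK = trans (I-comm C K) (I-⊑ K C (λ e Ke → C-o (λ { refl → true≢false Ke Ky })))
    CM : I C U ≡ sz U
    CM = trans (I-comm C U) (I-⊑ U C (λ e Me → C-o (proj₂ (M-elim Me))))

opaque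

  mix : Subset n → Subset n → Subset n → Subset n
  mix K A B = tabulate λ e → if lookup K e then lookup A e else lookup B e

  mix-in : (K A B : Subset n) {e : Fin n} → lookup K e ≡ true → lookup (mix K A B) e ≡ lookup A e
  mix-in K A B {e} Ke = trans (lookup∘tabulate (λ e → if lookup K e then lookup A e else lookup B e) e)
    (cong (λ b → if b then lookup A e else lookup B e) Ke)

  mix-out : (K A B : Subset n) {e : Fin n} → lookup K e ≡ false → lookup (mix K A B) e ≡ lookup B e
  mix-out K A B {e} Ke = trans (lookup∘tabulate (λ e → if lookup K e then lookup A e else lookup B e) e)
    (cong (λ b → if b then lookup A e else lookup B e) Ke)

opaque

  from : ℕ → Subset n
  from c = tabulate λ e → c ≤ᵇ toℕ e

  from-true : ∀ c (e : Fin n) → lookup (from c) e ≡ true → c ≤ toℕ e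
  from-true c e h = ≤ᵇ-true (trans (sym (lookup∘tabulate (λ e → c ≤ᵇ toℕ e) e)) h)

  true-from : ∀ c (e : Fin n) → c ≤ toℕ e → lookup (from c) e ≡ true
  true-from c e h = trans (lookup∘tabulate (λ e → c ≤ᵇ toℕ e) e) (true-≤ᵇ h)

false-from : ∀ c (e : Fin n) → lookup (from c) e ≡ false → toℕ e < c
false-from c e h = ≰⇒> λ le → true≢false (true-from c e le) h

from-false : ∀ c (e : Fin n) → toℕ e < c → lookup (from c) e ≡ false
from-false c e lt = ≢true λ h → <⇒≱ lt (from-true c e h)

-- Membership of A in the family shifted from j to i, where p and q tell whether A contains i and j,
-- and x and y whether A and its swap are members. If only one set of a pair is a member, the one
-- with i is kept.
shiftᵇ : Bool → Bool → Bool → Bool → Bool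
shiftᵇ true  false x y = x ∨ y
shiftᵇ false true  x y = x ∧ y
shiftᵇ true  true  x y = x
shiftᵇ false false x y = x

shiftᵇ-pair : ∀ p q x y (u v : ℕ) → (p ≡ true → q ≡ false → v ≤ u) → (p ≡ false → q ≡ true → u ≤ v) →
  (p ≡ q → u ≡ v) →
  ⟦ x ⟧ * u + ⟦ y ⟧ * v ≤ ⟦ shiftᵇ p q x y ⟧ * u + ⟦ shiftᵇ q p y x ⟧ * v
shiftᵇ-pair true  true  x     y     u v h k l = ≤-refl
shiftᵇ-pair false false x     y     u v h k l = ≤-refl
shiftᵇ-pair true  false true  true  u v h k l = ≤-refl
shiftᵇ-pair true  false true  false u v h k l = ≤-refl
shiftᵇ-pair true  false false true  u v h k l = ≤-trans (+-monoˡ-≤ 0 (h refl refl)) (≤-reflexive (sym (+-identityʳ (u + 0))))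
shiftᵇ-pair true  false false false u v h k l = ≤-refl
shiftᵇ-pair false true  true  true  u v h k l = ≤-refl
shiftᵇ-pair false true  true  false u v h k l = ≤-trans (≤-reflexive (+-identityʳ (u + 0))) (+-monoˡ-≤ 0 (k refl refl))
shiftᵇ-pair false true  false true  u v h k l = ≤-refl
shiftᵇ-pair false true  false false u v h k l = ≤-refl

outᶻ : Subset (suc n) → ℕ
outᶻ A = ⟦ not (lookup A zero) ⟧

position : Subset n → ℕ
position = lin toℕ

-- As D 1 = 0, a set may be weightless. Excluding such members guarantees that any set of the size
-- of a member can be added with a gain.
Supported : (ℕ → ℕ) → Family n → Set
Supported a ℱ = ∀ A → ℱ A ≡ true → 0 < a (co A)

-- A lexicographic comparison. Members without zero come second, so that an exchange of pivots
-- counts as progress even at equal weight; `position` comes last and forces compression. Shifts go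
-- to larger indices and so never reduce the number of members that avoid zero.
Better : (ℕ → ℕ) → (ℱ 𝒢 : Family (suc n)) → Set
Better a ℱ 𝒢 = W a ℱ < W a 𝒢
  ⊎ (W a ℱ ≤ W a 𝒢 × V outᶻ ℱ < V outᶻ 𝒢)
  ⊎ (W a ℱ ≤ W a 𝒢 × V outᶻ ℱ ≤ V outᶻ 𝒢 × V position ℱ < V position 𝒢)

-- The role of the largest point of the ground set is played by zero, and sets are
-- compressed towards larger indices.
module Extremal (n t′ : ℕ) (a : ℕ → ℕ)
  -- The lower bounds are those of a = D, where a 0 = 1 and a 1 = 0.
  (a-mono : ∀ x → 1 ≤ x → a x ≤ a (suc x))
  (a>0 : ∀ x → 2 ≤ x → 0 < a x)
  (ℱ : Family (suc n))
  (int : Intersectingᶠ (suc t′) ℱ)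
  (supp : Supported a ℱ)
  (no-F : ∀ K s → sz K ≡ suc t′ + (s + s) → (∀ A → ℱ A ≡ true → suc t′ + s ≤ I A K) → ⊥)
  (best : ∀ 𝒢 → Intersectingᶠ (suc t′) 𝒢 → Supported a 𝒢 → Better a ℱ 𝒢 → ⊥) where

  t : ℕ
  t = suc t′

  infix 4 _∈ℱ
  _∈ℱ : Subset (suc n) → Set
  A ∈ℱ = ℱ A ≡ true

  -- A member of size t would force ℱ into the Frankl family with s = 0.
  large : ∀ A → A ∈ℱ → t < sz A
  large A A∈ with m≤n⇒m<n∨m≡n (subst (t ≤_) (I-self A) (int A A A∈ A∈))
  ... | inj₁ lt = lt
  ... | inj₂ eq = ⊥-elim (no-F A 0 (trans (sym eq) (sym (+-identityʳ t)))
    λ B B∈ → subst (_≤ I B A) (sym (+-identityʳ t)) (int B A B∈ A∈))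

  module Shift (i j : Fin (suc n)) (i≢j : i ≢ j) (j<i : toℕ j < toℕ i) where

    σ : Subset (suc n) → Subset (suc n)
    σ = swap i j

    𝒢 : Family (suc n)
    𝒢 A = shiftᵇ (lookup A i) (lookup A j) (ℱ A) (ℱ (σ A))

    old-or-new : ∀ A → 𝒢 A ≡ true → A ∈ℱ ⊎ (lookup A i ≡ true × lookup A j ≡ false × ℱ (σ A) ≡ true)
    old-or-new A h with lookup A i | lookup A j
    ... | true  | true  = inj₁ h
    ... | false | false = inj₁ h
    ... | false | true  = inj₁ (proj₁ (∧-split h))
    ... | true  | false with ∨-split {ℱ A} h
    ...   | inj₁ p = inj₁ p
    ...   | inj₂ p = inj₂ (refl , refl , p)

    -- Against a B that contains both or none of i and j, A meets as much as its swap does. If B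
    -- contains only j, it survived because its swap is a member too, and swapping both sets keeps
    -- the intersection.
    new-any : ∀ A B → lookup A i ≡ true → lookup A j ≡ false → ℱ (σ A) ≡ true → 𝒢 B ≡ true → t ≤ I A B
    new-any A B Ai Aj σA∈ B∈ = go (lookup B i) (lookup B j) refl refl (I-move i≢j A B Ai Aj)
      where
      open ≡-Reasoning
      B∈′ : ∀ {p q} → lookup B i ≡ p → lookup B j ≡ q → shiftᵇ p q (ℱ B) (ℱ (σ B)) ≡ true
      B∈′ refl refl = B∈
      go : ∀ p q → lookup B i ≡ p → lookup B j ≡ q → I (σ A) B + ⟦ p ⟧ ≡ I A B + ⟦ q ⟧ → t ≤ I A B
      go true  true  Bi Bj eq = subst (t ≤_) (+-cancelʳ-≡ 1 _ _ eq) (int (σ A) B σA∈ (B∈′ Bi Bj))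
      go false false Bi Bj eq = subst (t ≤_) (+-cancelʳ-≡ 0 _ _ eq) (int (σ A) B σA∈ (B∈′ Bi Bj))
      go false true  Bi Bj eq = subst (t ≤_) (+-cancelʳ-≡ 1 _ _ (begin
        I (σ B) (σ A) + 1 ≡⟨ cong (λ b → I (σ B) (σ A) + ⟦ b ⟧) (trans (swap-j i≢j A) Ai) ⟨
        I (σ B) (σ A) + ⟦ lookup (σ A) j ⟧ ≡⟨ I-move′ i≢j B (σ A) Bi Bj ⟩
        I B (σ A) + ⟦ lookup (σ A) i ⟧ ≡⟨ cong₂ (λ x b → x + ⟦ b ⟧) (I-comm B (σ A)) (trans (swap-i i≢j A) Aj) ⟩
        I (σ A) B + 0 ≡⟨ eq ⟩
        I A B + 1 ∎)) (int (σ B) (σ A) (proj₂ (∧-split {ℱ B} (B∈′ Bi Bj))) σA∈)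
      go true  false Bi Bj eq with ∨-split {ℱ B} (B∈′ Bi Bj)
      ... | inj₁ B∈ℱ = ≤-trans (int (σ A) B σA∈ B∈ℱ) (≤-trans (m≤m+n _ 1) (≤-reflexive (trans eq (+-identityʳ _))))
      ... | inj₂ σB∈ = subst (t ≤_) (begin
        I (σ B) (σ A) ≡⟨ +-identityʳ _ ⟨
        I (σ B) (σ A) + 0 ≡⟨ cong (λ b → I (σ B) (σ A) + ⟦ b ⟧) (trans (swap-i i≢j A) Aj) ⟨
        I (σ B) (σ A) + ⟦ lookup (σ A) i ⟧ ≡⟨ I-move i≢j B (σ A) Bi Bj ⟩
        I B (σ A) + ⟦ lookup (σ A) j ⟧ ≡⟨ cong₂ (λ x b → x + ⟦ b ⟧) (I-comm B (σ A)) (trans (swap-j i≢j A) Ai) ⟩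
        I (σ A) B + 1 ≡⟨ eq ⟩
        I A B + 0 ≡⟨ +-identityʳ _ ⟩
        I A B ∎) (int (σ B) (σ A) σB∈ σA∈)

    𝒢-int : Intersectingᶠ t 𝒢
    𝒢-int A B A∈ B∈ with old-or-new A A∈ | old-or-new B B∈
    ... | inj₂ (Ai , Aj , σA∈) | _ = new-any A B Ai Aj σA∈ B∈
    ... | inj₁ A∈ℱ | inj₁ B∈ℱ = int A B A∈ℱ B∈ℱ
    ... | inj₁ A∈ℱ | inj₂ (Bi , Bj , σB∈) = subst (t ≤_) (I-comm B A) (new-any B A Bi Bj σB∈ A∈)

    𝒢-supp : Supported a 𝒢
    𝒢-supp A A∈ with old-or-new A A∈
    ... | inj₁ A∈ℱ          = supp A A∈ℱ
    ... | inj₂ (_ , _ , σA∈) = subst (λ x → 0 < a x) (co-swap i≢j A) (supp (σ A) σA∈)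

    module _ (f : Subset (suc n) → ℕ)
             (up : ∀ A → lookup A i ≡ true → lookup A j ≡ false → f (σ A) ≤ f A)
             (same : ∀ A → lookup A i ≡ lookup A j → f A ≡ f (σ A)) where

      σ-eq : ∀ A → 𝒢 (σ A) ≡ shiftᵇ (lookup A j) (lookup A i) (ℱ (σ A)) (ℱ A)
      σ-eq A rewrite swap-i i≢j A | swap-j i≢j A | swap-involutive i≢j A = refl

      pair : ∀ A → ⟦ ℱ A ⟧ * f A + ⟦ ℱ (σ A) ⟧ * f (σ A) ≤ ⟦ 𝒢 A ⟧ * f A + ⟦ 𝒢 (σ A) ⟧ * f (σ A)
      pair A rewrite σ-eq A = shiftᵇ-pair (lookup A i) (lookup A j) (ℱ A) (ℱ (σ A)) (f A) (f (σ A))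
        (up A)
        (λ p q → subst (λ x → f x ≤ f (σ A)) (swap-involutive i≢j A)
          (up (σ A) (trans (swap-i i≢j A) q) (trans (swap-j i≢j A) p)))
        (same A)

      V-up : V f ℱ ≤ V f 𝒢
      V-up = Σˢ-pair-mono σ (swap-involutive i≢j) pair

      V-up-< : ∀ A → A ∈ℱ → ℱ (σ A) ≡ false → lookup A i ≡ false → lookup A j ≡ true → f A < f (σ A) → V f ℱ < V f 𝒢
      V-up-< A A∈ σA∉ Ai Aj lt = Σˢ-pair-mono-< σ (swap-involutive i≢j) pair A strict
        where
        strict : ⟦ ℱ A ⟧ * f A + ⟦ ℱ (σ A) ⟧ * f (σ A) < ⟦ 𝒢 A ⟧ * f A + ⟦ 𝒢 (σ A) ⟧ * f (σ A)
        strict rewrite σ-eq A | A∈ | σA∉ | Ai | Aj | +-identityʳ (f A + 0) | +-identityʳ (f A) | +-identityʳ (f (σ A)) = lt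

  -- Otherwise the shifted family would keep the weight, lose no member that avoids zero, and have a
  -- larger position.
  shift : ∀ {i j} → toℕ j < toℕ i → ∀ A → A ∈ℱ → lookup A i ≡ false → lookup A j ≡ true → swap i j A ∈ℱ
  shift {i} {j} j<i A A∈ Ai Aj with ℱ (swap i j A) in eq
  ... | true  = refl
  ... | false = ⊥-elim (best 𝒢 𝒢-int 𝒢-supp (inj₂ (inj₂ (W≤ , O≤ , P<))))
    where
    i≢j : i ≢ j
    i≢j refl = <-irrefl refl j<i
    open Shift i j i≢j j<i
    W≤ : W a ℱ ≤ W a 𝒢
    W≤ = V-up (a ∘ co) (λ B _ _ → ≤-reflexive (cong a (co-swap i≢j B))) (λ B _ → cong a (sym (co-swap i≢j B)))
    i≢0 : zero ≢ i
    i≢0 eq = n≮0 (subst (λ i → toℕ j < toℕ i) (sym eq) j<i)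
    O≤ : V outᶻ ℱ ≤ V outᶻ 𝒢
    O≤ = V-up outᶻ up same
      where
      σ0 : ∀ A → zero ≢ j → outᶻ (σ A) ≡ outᶻ A
      σ0 A 0≢j = cong (λ b → ⟦ not b ⟧) (swap-o i≢j A i≢0 0≢j)
      up : ∀ A → lookup A i ≡ true → lookup A j ≡ false → outᶻ (σ A) ≤ outᶻ A
      up A p q with zero Fin.≟ j
      ... | no 0≢j = ≤-reflexive (σ0 A 0≢j)
      ... | yes refl rewrite swap-j i≢j A | p | q = z≤n
      same : ∀ A → lookup A i ≡ lookup A j → outᶻ A ≡ outᶻ (σ A)
      same A p with zero Fin.≟ j
      ... | no 0≢j = sym (σ0 A 0≢j)
      ... | yes refl rewrite swap-j i≢j A | p = refl
    P< : V position ℱ < V position 𝒢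
    P< = V-up-< position up same A A∈ eq Ai Aj
      (subst (λ x → position x < position A′) (swap-involutive i≢j A) (strict A′ A′i A′j))
      where
      A′ = σ A
      A′i : lookup A′ i ≡ true
      A′i = trans (swap-i i≢j A) Aj
      A′j : lookup A′ j ≡ false
      A′j = trans (swap-j i≢j A) Ai
      strict : ∀ A → lookup A i ≡ true → lookup A j ≡ false → position (σ A) < position A
      strict A p q = +-cancelʳ-< (toℕ i) _ _ (subst (_< position A + toℕ i) (sym (lin-move i≢j toℕ A p q)) (+-monoʳ-< (position A) j<i))
      up : ∀ A → lookup A i ≡ true → lookup A j ≡ false → position (σ A) ≤ position A
      up A p q = <⇒≤ (strict A p q)
      same : ∀ A → lookup A i ≡ lookup A j → position A ≡ position (σ A)
      same A p = +-cancelʳ-≡ _ _ _ (sym (subst (λ b → position (σ A) + (⟦ lookup A i ⟧ * toℕ i + ⟦ b ⟧ * toℕ j)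
        ≡ position A + (⟦ b ⟧ * toℕ i + ⟦ lookup A i ⟧ * toℕ j)) (sym p) (lin-swap i≢j toℕ A)))

  maximal : ∀ A → ℱ A ≡ false → 0 < a (co A) → t ≤ sz A → ∃[ B ] B ∈ℱ × I A B < t
  maximal A A∉ pos t≤ with Subset.anySubset? (λ B → (ℱ B Bool.≟ true) ×-dec (I A B <? t))
  ... | yes p = p
  ... | no ¬p = ⊥-elim (best 𝒢 𝒢-int 𝒢-supp (inj₁ (Σˢ-mono-< pointwise A strict)))
    where
    𝒢 : Family (suc n)
    𝒢 B = ℱ B ∨ (B == A)
    meets : ∀ B → B ∈ℱ → t ≤ I A B
    meets B B∈ = ≮⇒≥ (λ lt → ¬p (B , B∈ , lt))
    𝒢-int : Intersectingᶠ t 𝒢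
    𝒢-int B C B∈ C∈ with ∨-split {ℱ B} B∈ | ∨-split {ℱ C} C∈
    ... | inj₁ p | inj₁ q = int B C p q
    ... | inj₁ p | inj₂ q rewrite ==-sound C A q = subst (t ≤_) (I-comm A B) (meets B p)
    ... | inj₂ p | inj₁ q rewrite ==-sound B A p = meets C q
    ... | inj₂ p | inj₂ q rewrite ==-sound B A p | ==-sound C A q = subst (t ≤_) (sym (I-self A)) t≤
    𝒢-supp : Supported a 𝒢
    𝒢-supp B B∈ with ∨-split {ℱ B} B∈
    ... | inj₁ p = supp B p
    ... | inj₂ q rewrite ==-sound B A q = pos
    pointwise : ∀ B → ⟦ ℱ B ⟧ * a (co B) ≤ ⟦ 𝒢 B ⟧ * a (co B)
    pointwise B = *-monoˡ-≤ (a (co B)) (⟦⟧-mono {ℱ B} {𝒢 B} (λ h → ∨-introˡ h))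
    strict : ⟦ ℱ A ⟧ * a (co A) < ⟦ 𝒢 A ⟧ * a (co A)
    strict rewrite A∉ | ==-refl A = ≤-trans pos (≤-reflexive (sym (+-identityʳ _)))

  upward : ∀ A B → A ∈ℱ → A ⊑ B → 0 < a (co B) → B ∈ℱ
  upward A B A∈ A⊑B pos with ℱ B in eq
  ... | true  = refl
  ... | false with maximal B eq pos (≤-trans (<⇒≤ (large A A∈)) (sz-mono A⊑B))
  ...   | C , C∈ , lt = ⊥-elim (<⇒≱ lt (≤-trans (int A C A∈ C∈) (I-monoˡ C A⊑B)))

  -- Pivots and their exchange.

  -- A pivot, a member containing zero that cannot do without it, is given by the
  -- rest of the set.
  pivot : Family n
  pivot A = ℱ (inside ∷ A) ∧ not (ℱ (outside ∷ A))

  -- A point missing from both sets could, by compression, replace zero in B, and then B would meet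
  -- the pivot in fewer than t points. So the two rests cover everything; they share exactly t - 1
  -- points, and inclusion-exclusion gives the count.
  pivot-conflict : ∀ A B → pivot A ≡ true → B ∈ℱ → I (outside ∷ A) B < t →
    ∃[ B′ ] B ≡ inside ∷ B′ × pivot B′ ≡ true × co A + co B′ + t′ ≡ n × (∀ x → lookup A x ∨ lookup B′ x ≡ true)
  pivot-conflict A (false ∷ B) A-piv B∈ lt = ⊥-elim (<⇒≱ lt (subst (t ≤_) (trans (I-in-out A B) (sym (I-out A false B)))
    (int _ _ (proj₁ (∧-split A-piv)) B∈)))
  pivot-conflict A (true ∷ B) A-piv B∈ lt = B , refl , ∧-intro B∈ (not-false B∉) , count , full
    where
    A∈ = proj₁ (∧-split {ℱ (inside ∷ A)} A-piv)
    I≡ : I A B ≡ t′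
    I≡ = ≤-antisym (s≤s⁻¹ (subst (_< t) (I-out A true B) lt)) (s≤s⁻¹ (subst (t ≤_) (I-in-in A B) (int _ _ A∈ B∈)))
    B∉ : ℱ (outside ∷ B) ≡ false
    B∉ = ≢true λ h → <-irrefl (sym I≡) (subst (t ≤_) (I-in-out A B) (int _ _ A∈ h))
    full : ∀ x → lookup A x ∨ lookup B x ≡ true
    full x with lookup A x in Ax | lookup B x in Bx
    ... | true  | _    = refl
    ... | false | true = refl
    ... | false | false = ⊥-elim (<-irrefl refl (≤-trans (s≤s (int (swap (suc x) zero (inside ∷ B)) (inside ∷ A) B″∈ A∈))
        (≤-reflexive (trans (+-comm 1 _) eq))))
      where
      B″∈ : swap (suc x) zero (inside ∷ B) ∈ℱ
      B″∈ = shift {suc x} {zero} (s≤s z≤n) (inside ∷ B) B∈ Bx refl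
      eq : I (swap (suc x) zero (inside ∷ B)) (inside ∷ A) + 1 ≡ t
      eq = trans (I-move′ {i = suc x} {zero} (λ ()) (inside ∷ B) (inside ∷ A) Bx refl)
        (trans (cong (λ b → I (inside ∷ B) (inside ∷ A) + ⟦ b ⟧) Ax) (trans (+-identityʳ _)
          (trans (I-in-in B A) (cong suc (trans (I-comm B A) I≡)))))
    count : co A + co B + t′ ≡ n
    count = +-cancelˡ-≡ n _ _ (begin
      n + (co A + co B + t′) ≡⟨ e n (co A) (co B) t′ ⟩
      (n + t′) + (co A + co B) ≡⟨ cong (_+ (co A + co B)) szs ⟨
      (sz A + sz B) + (co A + co B) ≡⟨ interchange (sz A) (sz B) (co A) (co B) ⟩
      (sz A + co A) + (sz B + co B) ≡⟨ cong₂ _+_ (sz+co A) (sz+co B) ⟩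
      n + n ∎)
      where
      open ≡-Reasoning
      e : ∀ n a b t → n + (a + b + t) ≡ (n + t) + (a + b)
      e = solve-∀
      full-set : Subset n
      full-set = tabulate λ _ → true
      szs : sz A + sz B ≡ n + t′
      szs = trans (cong₂ _+_ (sym (I-⊑ A full-set (λ e _ → lookup∘tabulate _ e))) (sym (I-⊑ B full-set (λ e _ → lookup∘tabulate _ e))))
        (trans (I-cover A B full-set (λ e _ → full e) (λ e h → ⊥-elim (true≢false (lookup∘tabulate (λ _ → true) e) h)))
          (cong₂ _+_ (sz-full full-set (lookup∘tabulate _)) I≡))

  -- The pivots in `Rem` are deleted, and those in `Add` are entered without zero. By
  -- `pivot-conflict` a new set can only clash with covering pivots of complementary size, which
  -- `clash` places in `Rem` and outside `Add`. The condition 1 ≤ co A leaves a new set two missing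
  -- points, where weights are positive.
  module PivotMove (Add Rem : Family n)
    (Add⊆ : ∀ A → Add A ≡ true → pivot A ≡ true × 1 ≤ co A)
    (Rem⊆ : ∀ A → Rem A ≡ true → pivot A ≡ true)
    (clash : ∀ A B → Add A ≡ true → pivot B ≡ true → co A + co B + t′ ≡ n → (∀ x → lookup A x ∨ lookup B x ≡ true) →
             Rem B ≡ true × Add B ≡ false) where

    𝒢 : Family (suc n)
    𝒢 (true ∷ A)  = ℱ (inside ∷ A) ∧ not (Rem A)
    𝒢 (false ∷ A) = ℱ (outside ∷ A) ∨ Add A

    add-old : ∀ A B → Add A ≡ true → B ∈ℱ → (∀ B′ → B ≡ inside ∷ B′ → Rem B′ ≡ false) → t ≤ I (outside ∷ A) B
    add-old A B A+ B∈ keep with t ≤? I (outside ∷ A) B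
    ... | yes p = p
    ... | no ¬p with pivot-conflict A B (proj₁ (Add⊆ A A+)) B∈ (≰⇒> ¬p)
    ...   | B′ , B≡ , piv , c , f = ⊥-elim (true≢false (proj₁ (clash A B′ A+ piv c f)) (keep B′ B≡))

    add-add : ∀ A B → Add A ≡ true → Add B ≡ true → t ≤ I (outside ∷ A) (outside ∷ B)
    add-add A B A+ B+ with t ≤? I (outside ∷ A) (outside ∷ B)
    ... | yes p = p
    ... | no ¬p with pivot-conflict A (inside ∷ B) (proj₁ (Add⊆ A A+)) (proj₁ (∧-split (proj₁ (Add⊆ B B+))))
                       (subst (_< t) (trans (I-out A false B) (sym (I-out A true B))) (≰⇒> ¬p))
    ...   | B′ , refl , piv , c , f = ⊥-elim (true≢false B+ (proj₂ (clash A B′ A+ piv c f)))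

    𝒢-int : Intersectingᶠ t 𝒢
    𝒢-int (true ∷ A) (true ∷ B) A∈ B∈ = int _ _ (proj₁ (∧-split A∈)) (proj₁ (∧-split B∈))
    𝒢-int (true ∷ A) (false ∷ B) A∈ B∈ with ∨-split {ℱ (outside ∷ B)} B∈
    ... | inj₁ p = int _ _ (proj₁ (∧-split A∈)) p
    ... | inj₂ p = subst (t ≤_) (I-comm (outside ∷ B) (inside ∷ A))
      (add-old B (inside ∷ A) p (proj₁ (∧-split A∈)) (λ { B′ refl → not-true (proj₂ (∧-split {ℱ (inside ∷ A)} A∈)) }))
    𝒢-int (false ∷ A) (true ∷ B) A∈ B∈ with ∨-split {ℱ (outside ∷ A)} A∈
    ... | inj₁ p = int _ _ p (proj₁ (∧-split B∈))
    ... | inj₂ p = add-old A (inside ∷ B) p (proj₁ (∧-split B∈)) (λ { B′ refl → not-true (proj₂ (∧-split {ℱ (inside ∷ B)} B∈)) })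
    𝒢-int (false ∷ A) (false ∷ B) A∈ B∈ with ∨-split {ℱ (outside ∷ A)} A∈ | ∨-split {ℱ (outside ∷ B)} B∈
    ... | inj₁ p | inj₁ q = int _ _ p q
    ... | inj₂ p | inj₁ q = add-old A (outside ∷ B) p q (λ _ ())
    ... | inj₁ p | inj₂ q = subst (t ≤_) (I-comm (outside ∷ B) (outside ∷ A)) (add-old B (outside ∷ A) q p (λ _ ()))
    ... | inj₂ p | inj₂ q = add-add A B p q

    𝒢-supp : Supported a 𝒢
    𝒢-supp (true ∷ A)  A∈ = supp _ (proj₁ (∧-split A∈))
    𝒢-supp (false ∷ A) A∈ with ∨-split {ℱ (outside ∷ A)} A∈
    ... | inj₁ p = supp _ p
    ... | inj₂ p = subst (λ x → 0 < a x) (sym (co-out A)) (a>0 _ (s≤s (proj₂ (Add⊆ A p))))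

    V-change : ∀ (f : Subset (suc n) → ℕ) →
      V f 𝒢 + V (λ A → f (inside ∷ A)) Rem ≡ V f ℱ + V (λ A → f (outside ∷ A)) Add
    V-change f = begin
      V f 𝒢 + V fᵢ Rem ≡⟨ cong (_+ V fᵢ Rem) (Σˢ-suc (λ A → ⟦ 𝒢 A ⟧ * f A)) ⟩
      V fᵢ 𝒢ᵢ + V fₒ 𝒢ₒ + V fᵢ Rem ≡⟨ e₁ (V fᵢ 𝒢ᵢ) (V fₒ 𝒢ₒ) (V fᵢ Rem) ⟩
      (V fᵢ 𝒢ᵢ + V fᵢ Rem) + V fₒ 𝒢ₒ ≡⟨ cong₂ _+_ balᵢ balₒ ⟩
      V fᵢ ℱᵢ + (V fₒ ℱₒ + V fₒ Add) ≡⟨ +-assoc (V fᵢ ℱᵢ) _ _ ⟨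
      V fᵢ ℱᵢ + V fₒ ℱₒ + V fₒ Add ≡⟨ cong (_+ V fₒ Add) (Σˢ-suc (λ A → ⟦ ℱ A ⟧ * f A)) ⟨
      V f ℱ + V fₒ Add ∎
      where
      open ≡-Reasoning
      fᵢ fₒ : Subset n → ℕ
      fᵢ A = f (inside ∷ A)
      fₒ A = f (outside ∷ A)
      ℱᵢ ℱₒ 𝒢ᵢ 𝒢ₒ ∅ : Family n
      ℱᵢ A = ℱ (inside ∷ A)
      ℱₒ A = ℱ (outside ∷ A)
      𝒢ᵢ A = ℱ (inside ∷ A) ∧ not (Rem A)
      𝒢ₒ A = ℱ (outside ∷ A) ∨ Add A
      ∅ A = false
      e₁ : ∀ x y z → x + y + z ≡ (x + z) + y
      e₁ = solve-∀
      V∅ : ∀ g → V g ∅ ≡ 0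
      V∅ g = Σˢ-0 λ _ → refl
      balᵢ : V fᵢ 𝒢ᵢ + V fᵢ Rem ≡ V fᵢ ℱᵢ
      balᵢ = trans (V-balance fᵢ {𝒢ᵢ} {Rem} {ℱᵢ} {∅} λ A → g (ℱᵢ A) (Rem A) (λ h → proj₁ (∧-split (Rem⊆ A h)))) (trans (cong (V fᵢ ℱᵢ +_) (V∅ fᵢ)) (+-identityʳ _))
        where
        g : ∀ x r → (r ≡ true → x ≡ true) → ⟦ x ∧ not r ⟧ + ⟦ r ⟧ ≡ ⟦ x ⟧ + 0
        g true  true  h = refl
        g true  false h = refl
        g false true  h with () ← h refl
        g false false h = refl
      balₒ : V fₒ 𝒢ₒ ≡ V fₒ ℱₒ + V fₒ Add
      balₒ = trans (sym (trans (cong (V fₒ 𝒢ₒ +_) (V∅ fₒ)) (+-identityʳ _)))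
        (V-balance fₒ {𝒢ₒ} {∅} {ℱₒ} {Add} λ A → g (ℱₒ A) (Add A) (λ h → not-true (proj₂ (∧-split {ℱᵢ A} (proj₁ (Add⊆ A h))))))
        where
        g : ∀ x r → (r ≡ true → x ≡ false) → ⟦ x ∨ r ⟧ + 0 ≡ ⟦ x ⟧ + ⟦ r ⟧
        g true  true  h with () ← h refl
        g true  false h = refl
        g false true  h = refl
        g false false h = refl

    -- It is enough not to lose weight: a single new set already increases the number of members
    -- that avoid zero.
    contradict : V (λ A → a (co A)) Rem ≤ V (λ A → a (suc (co A))) Add → ∀ A → Add A ≡ true → ⊥
    contradict le A A+ = best 𝒢 𝒢-int 𝒢-supp (inj₂ (inj₁ (W≤ , O<)))
      where
      W≤ : W a ℱ ≤ W a 𝒢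
      W≤ = +-cancelʳ-≤ _ _ _ (≤-trans (+-monoʳ-≤ (W a ℱ) (≤-trans (≤-reflexive (Σˢ-cong λ B → cong (λ x → ⟦ Rem B ⟧ * a x) (co-in B)))
        (≤-trans le (≤-reflexive (Σˢ-cong λ B → cong (λ x → ⟦ Add B ⟧ * a x) (sym (co-out B)))))))
        (≤-reflexive (sym (V-change (a ∘ co)))))
      O< : V outᶻ ℱ < V outᶻ 𝒢
      O< = ≤-trans (subst (_≤ V outᶻ ℱ + V (λ _ → 1) Add) (+-comm (V outᶻ ℱ) 1) (+-monoʳ-≤ (V outᶻ ℱ) (V-pos (λ _ → 1) Add A A+ ≤-refl)))
        (≤-reflexive (trans (sym (V-change outᶻ)) (trans (cong (V outᶻ 𝒢 +_) (Σˢ-0 λ B → *-zeroʳ ⟦ Rem B ⟧)) (+-identityʳ _))))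

  pivotAt : ℕ → Family n
  pivotAt u A = pivot A ∧ (co A ≡ᵇ u)

  pivotAt-co : ∀ {u A} → pivotAt u A ≡ true → pivot A ≡ true × co A ≡ u
  pivotAt-co {u} {A} h with ∧-split {pivot A} h
  ... | p , q = p , ≡ᵇ-true (co A) u q

  count : ℕ → ℕ
  count u = V (λ _ → 1) (pivotAt u)

  V-level : (g : ℕ → ℕ) (𝒫 : Family n) (u : ℕ) → (∀ A → 𝒫 A ≡ true → co A ≡ u) → V (g ∘ co) 𝒫 ≡ g u * V (λ _ → 1) 𝒫
  V-level g 𝒫 u h = trans (Σˢ-cong λ A → f (𝒫 A) (h A)) (Σˢ-*ˡ (g u) (λ A → ⟦ 𝒫 A ⟧ * 1))
    where
    f : ∀ b {x} → (b ≡ true → x ≡ u) → ⟦ b ⟧ * g x ≡ g u * (⟦ b ⟧ * 1)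
    f true  {x} p rewrite p refl = trans (+-identityʳ (g u)) (sym (*-identityʳ (g u)))
    f false p = sym (*-zeroʳ (g u))

  -- Pivots that miss v points clash only with pivots that miss u points. As u and v differ, the
  -- whole level v can be entered and the whole level u deleted.
  exchange-levels : ∀ u v → u ≢ v → 1 ≤ u → u + v + t′ ≡ n → a u * count u ≤ a (suc v) * count v →
                    ∀ B → pivotAt v B ≡ true → 1 ≤ v → ⊥
  exchange-levels u v u≢v 1≤u eq le B B-piv 1≤v = PivotMove.contradict (pivotAt v) (pivotAt u)
    (λ A h → let (p , c) = pivotAt-co {v} {A} h in p , subst (1 ≤_) (sym c) 1≤v)
    (λ A h → proj₁ (pivotAt-co {u} {A} h))
    (λ A B A+ B-piv c _ → let B≡u = level A B (proj₂ (pivotAt-co {v} {A} A+)) c in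
      ∧-intro B-piv (true-≡ᵇ _ u B≡u) , ≢true (λ h → u≢v (trans (sym B≡u) (proj₂ (pivotAt-co {v} {B} h)))))
    (subst₂ _≤_ (sym (V-level a (pivotAt u) u (λ A h → proj₂ (pivotAt-co {u} {A} h))))
                (sym (V-level (a ∘ suc) (pivotAt v) v (λ A h → proj₂ (pivotAt-co {v} {A} h)))) le)
    B B-piv
    where
    level : ∀ A B → co A ≡ v → co A + co B + t′ ≡ n → co B ≡ u
    level A B refl c = +-cancelʳ-≡ t′ _ _ (+-cancelˡ-≡ (co A) _ _
      (trans (sym (+-assoc (co A) (co B) t′)) (trans c (trans (sym eq) (e u (co A) t′)))))
      where
      e : ∀ u v t → u + v + t ≡ v + (u + t)
      e = solve-∀

  pivot-co< : ∀ A → pivot A ≡ true → co A + t′ < n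
  pivot-co< A A-piv = subst (co A + t′ <_) (trans (+-comm (co A) (sz A)) (sz+co A))
    (+-monoʳ-< (co A) (s≤s⁻¹ (subst (t <_) (sz-in A) (large (inside ∷ A) (proj₁ (∧-split A-piv))))))

  -- With different levels u and v one of the two exchanges succeeds: if deleting v for u loses
  -- weight, then a(u + 1) count u < a(v) count v, and monotonicity of a at u and v makes deleting u
  -- for v harmless. `large` ensures v ≥ 1.
  pivot-central : ∀ A → pivot A ≡ true → 1 ≤ co A → co A + co A + t′ ≡ n
  pivot-central A A-piv 1≤u with (n ∸ t′ ∸ co A) ≟ co A
  ... | yes v≡u = trans (cong (λ v → co A + v + t′) (sym v≡u)) sum
    where
    v = n ∸ t′ ∸ co A
    u+t≤n = <⇒≤ (pivot-co< A A-piv)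
    sum : co A + v + t′ ≡ n
    sum = trans (cong (_+ t′) (m+[n∸m]≡n (m+n≤o⇒m≤o∸n (co A) u+t≤n))) (m∸n+n≡m (≤-trans (m≤n+m t′ (co A)) u+t≤n))
  ... | no v≢u = ⊥-elim (choose (a v * count v ≤? a (suc u) * count u))
    where
    u = co A
    v = n ∸ t′ ∸ co A
    u+t<n = pivot-co< A A-piv
    u+t≤n = <⇒≤ u+t<n
    sum : u + v + t′ ≡ n
    sum = trans (cong (_+ t′) (m+[n∸m]≡n (m+n≤o⇒m≤o∸n u u+t≤n))) (m∸n+n≡m (≤-trans (m≤n+m t′ u) u+t≤n))
    1≤v : 1 ≤ v
    1≤v = +-cancelˡ-≤ (u + t′) 1 v (subst₂ _≤_ (+-comm 1 (u + t′)) (trans (sym sum) (e u v t′)) u+t<n)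
      where
      e : ∀ u v t → u + v + t ≡ u + t + v
      e = solve-∀
    A-at : pivotAt u A ≡ true
    A-at = ∧-intro A-piv (true-≡ᵇ u u refl)
    choose : Dec (a v * count v ≤ a (suc u) * count u) → ⊥
    choose (yes le) = exchange-levels v u v≢u 1≤v (trans (cong (_+ t′) (+-comm v u)) sum) le A A-at 1≤u
    choose (no ¬le) with V-nonempty (λ _ → 1) (pivotAt v) (n≢0⇒n>0 λ z → ¬le (subst (λ c → a v * c ≤ a (suc u) * count u) (sym z) (≤-trans (≤-reflexive (*-zeroʳ (a v))) z≤n)))
    ... | B , B-at = exchange-levels u v (v≢u ∘ sym) 1≤u sum (begin
      a u * count u ≤⟨ *-monoˡ-≤ (count u) (a-mono u 1≤u) ⟩
      a (suc u) * count u ≤⟨ <⇒≤ (≰⇒> ¬le) ⟩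
      a v * count v ≤⟨ *-monoˡ-≤ (count v) (a-mono v 1≤v) ⟩
      a (suc v) * count v ∎) B B-at 1≤v
      where open ≤-Reasoning

  -- Some point x₀ is missed by at least the fraction r / n of the pivots. Clashing pivots cover x₀,
  -- so those that miss it may be entered if those that contain it are deleted. The latter are at
  -- most (n - r) / r times as many, and (n - r) / r = (t′ + r) / r is the factor in the hypothesis.
  pivot-average : ∀ A → pivot A ≡ true → 1 ≤ co A → (t′ + co A) * a (co A) ≤ co A * a (suc (co A)) → ⊥
  pivot-average A A-piv 1≤r le = PivotMove.contradict Add Rem
    (λ B h → let (p , c) = pivotAt-co {r} {B} (proj₁ (∧-split h)) in p , subst (1 ≤_) (sym c) 1≤r)
    (λ B h → proj₁ (pivotAt-co {r} {B} (proj₁ (∧-split h))))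
    clash weights (proj₁ nonempty) (proj₂ nonempty)
    where
    r = co A
    n≡ = pivot-central A A-piv 1≤r
    missing : Fin n → Family n
    missing x B = pivotAt r B ∧ not (lookup B x)
    point : ∀ {n} → 1 ≤ n → Fin n
    point (s≤s _) = zero
    total : Σᶠ (λ x → V (λ _ → 1) (missing x)) ≡ r * count r
    total = trans (sym (Σˢ-Σᶠ (λ B x → ⟦ missing x B ⟧ * 1))) (trans (Σˢ-cong per) (Σˢ-*ˡ r (λ B → ⟦ pivotAt r B ⟧ * 1)))
      where
      per : ∀ B → Σᶠ (λ x → ⟦ missing x B ⟧ * 1) ≡ r * (⟦ pivotAt r B ⟧ * 1)
      per B with pivotAt r B in eq
      ... | true  = trans (Σᶠ-cong λ x → *-identityʳ _) (trans (Σ-out B) (trans (proj₂ (pivotAt-co {r} {B} eq)) (sym (*-identityʳ r))))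
      ... | false = trans (Σᶠ-0 λ _ → refl) (sym (*-zeroʳ r))
    average = Σᶠ-average (point (≤-trans (≤-trans 1≤r (m≤m+n r r)) (≤-trans (m≤m+n _ t′) (≤-reflexive n≡)))) (λ x → V (λ _ → 1) (missing x))
    x₀ = proj₁ average
    Add Rem : Family n
    Add = missing x₀
    Rem B = pivotAt r B ∧ lookup B x₀
    T = V (λ _ → 1) Add
    R = V (λ _ → 1) Rem
    avg : r * count r ≤ n * T
    avg = subst (_≤ n * T) total (proj₂ average)
    T+R : T + R ≡ count r
    T+R = trans (V-balance (λ _ → 1) {Add} {Rem} {pivotAt r} {λ _ → false} λ B → g (pivotAt r B) (lookup B x₀))
      (trans (cong (count r +_) (Σˢ-0 λ _ → refl)) (+-identityʳ _))
      where
      g : ∀ p b → ⟦ p ∧ not b ⟧ + ⟦ p ∧ b ⟧ ≡ ⟦ p ⟧ + 0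
      g true  true  = refl
      g true  false = refl
      g false b     = refl
    count>0 : 0 < count r
    count>0 = V-pos (λ _ → 1) (pivotAt r) A (∧-intro A-piv (true-≡ᵇ r r refl)) ≤-refl
    nonempty : ∃[ B ] Add B ≡ true
    nonempty = V-nonempty (λ _ → 1) Add (n≢0⇒n>0 λ z → <⇒≢ (*-mono-≤ 1≤r count>0)
      (sym (n≤0⇒n≡0 (subst (λ T → r * count r ≤ n * T) z avg ∙ ≤-reflexive (*-zeroʳ n)))))
      where
      _∙_ : ∀ {a b c} → a ≤ b → b ≤ c → a ≤ c
      _∙_ = ≤-trans
    clash : ∀ B C → Add B ≡ true → pivot C ≡ true → co B + co C + t′ ≡ n → (∀ x → lookup B x ∨ lookup C x ≡ true) →
            Rem C ≡ true × Add C ≡ false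
    clash B C B+ C-piv c full = ∧-intro (∧-intro C-piv (true-≡ᵇ (co C) r C≡r)) Cx , ≢true λ h → true≢false Cx (not-true (proj₂ (∧-split {pivotAt r C} h)))
      where
      B≡r = proj₂ (pivotAt-co {r} {B} (proj₁ (∧-split B+)))
      C≡r : co C ≡ r
      C≡r = +-cancelˡ-≡ r _ _ (+-cancelʳ-≡ t′ _ _ (trans (cong (λ b → b + co C + t′) (sym B≡r)) (trans c (sym n≡))))
      Cx : lookup C x₀ ≡ true
      Cx with full x₀
      ... | h rewrite not-true (proj₂ (∧-split {pivotAt r B} B+)) = h
    core : a r * R ≤ a (suc r) * T
    core = *-cancelˡ-≤ n {{>-nonZero (≤-trans (≤-trans 1≤r (m≤m+n r r)) (≤-trans (m≤m+n _ t′) (≤-reflexive n≡)))}}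
      (subst (λ m → m * (a r * R) ≤ m * (a (suc r) * T)) n≡
        (≤-from 0 (+-mono-≤ (*-monoˡ-≤ (a (suc r) + a r) avg′) (*-monoˡ-≤ (T + R) le))
          (e r t′ (a r) (a (suc r)) T R)))
      where
      avg′ : r * (T + R) ≤ (r + r + t′) * T
      avg′ = subst₂ (λ c m → r * c ≤ m * T) (sym T+R) (sym n≡) avg
      e : ∀ r t x y T R → (r + r + t) * (y * T) + (r * (T + R) * (y + x) + (t + r) * x * (T + R))
        ≡ (r + r + t) * (x * R) + ((r + r + t) * T * (y + x) + r * y * (T + R)) + 0
      e = solve-∀
    weights : V (λ B → a (co B)) Rem ≤ V (λ B → a (suc (co B))) Add
    weights = subst₂ _≤_ (sym (V-level a Rem r (λ B h → proj₂ (pivotAt-co {r} {B} (proj₁ (∧-split h))))))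
      (sym (V-level (a ∘ suc) Add r (λ B h → proj₂ (pivotAt-co {r} {B} (proj₁ (∧-split h)))))) core

  -- Pushing and pulling: extending the symmetry point by point.

  module PushPull (r : ℕ) (1≤r : 1 ≤ r) (n≡ : r + r + t′ ≡ n)
    (t′≥1 : 1 ≤ t′)
    (gap : ∀ j x → 1 ≤ j → j < x → j + x < r + r → j * a (suc x) < (t′ + j) * a x)
    (spare-zero : ∀ A → (inside ∷ A) ∈ℱ → 1 ≤ co A → co A ≢ r → (outside ∷ A) ∈ℱ) where

    -- Invariance under all permutations of K, expressed without permutations: membership depends
    -- only on the part outside K and on the number of points inside.
    Symmetric : Subset (suc n) → Set
    Symmetric K = ∀ A B → (∀ e → lookup K e ≡ false → lookup A e ≡ lookup B e) → I A K ≡ I B K → A ∈ℱ → B ∈ℱ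

    -- K is a final segment and y the point just before it. Thus compression may move y into K as
    -- well as any other outside point to y.
    module Level (K : Subset (suc n)) (K-sym : Symmetric K) (y : Fin (suc n)) (Ky : lookup K y ≡ false)
      (below : ∀ z → lookup K z ≡ false → z ≢ y → toℕ z < toℕ y)
      (above : ∀ x → lookup K x ≡ true → toℕ y < toℕ x) where

      ≢y : ∀ {x} → lookup K x ≡ true → x ≢ y
      ≢y Kx refl = true≢false Kx Ky

      I-drop : ∀ {x} A → lookup K x ≡ true → lookup A x ≡ true → lookup A y ≡ false → suc (I (swap x y A) K) ≡ I A K
      I-drop {x} A Kx Ax Ay = trans (+-comm 1 _) (trans (cong (λ b → I (swap x y A) K + ⟦ b ⟧) (sym Kx))
        (trans (I-move (≢y Kx) A K Ax Ay) (trans (cong (λ b → I A K + ⟦ b ⟧) Ky) (+-identityʳ _))))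

      I-gain : ∀ {x} A → lookup K x ≡ true → lookup A x ≡ false → lookup A y ≡ true → I (swap x y A) K ≡ suc (I A K)
      I-gain {x} A Kx Ax Ay = trans (sym (+-identityʳ _)) (trans (cong (λ b → I (swap x y A) K + ⟦ b ⟧) (sym Ky))
        (trans (I-move′ (≢y Kx) A K Ax Ay) (trans (cong (λ b → I A K + ⟦ b ⟧) Kx) (+-comm _ 1))))

      swap-agree : ∀ {x x′} A B → lookup K x ≡ true → lookup K x′ ≡ true → lookup A x ≡ lookup B x′ →
        (∀ e → lookup K e ≡ false → e ≢ y → lookup A e ≡ lookup B e) →
        ∀ e → lookup K e ≡ false → lookup (swap x y A) e ≡ lookup (swap x′ y B) e
      swap-agree {x} {x′} A B Kx Kx′ eq agree e Ke with e Fin.≟ y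
      ... | yes refl = trans (swap-j (≢y Kx) A) (trans eq (sym (swap-j (≢y Kx′) B)))
      ... | no e≢y   = trans (swap-o (≢y Kx) A (λ { refl → true≢false Kx Ke }) e≢y)
        (trans (agree e Ke e≢y) (sym (swap-o (≢y Kx′) B (λ { refl → true≢false Kx′ Ke }) e≢y)))

      bad : Subset (suc n) → Fin (suc n) → Bool
      bad A x = lookup K x ∧ lookup A x ∧ not (ℱ (swap x y A))

      -- The members that prevent the symmetry from extending from K to K ∪ {y}.
      X : Family (suc n)
      X A = ℱ A ∧ not (lookup A y) ∧ anyᵇ (bad A)

      X-elim : ∀ {A} → X A ≡ true →
        A ∈ℱ × lookup A y ≡ false × ∃[ x ] lookup K x ≡ true × lookup A x ≡ true × ℱ (swap x y A) ≡ false
      X-elim {A} h with ∧-split {ℱ A} h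
      ... | A∈ , h′ with ∧-split {not (lookup A y)} h′
      ...   | Ay , h″ with anyᵇ-true (bad A) h″
      ...     | x , b with ∧-split {lookup K x} b
      ...       | Kx , b′ with ∧-split {lookup A x} b′
      ...         | Ax , b″ = A∈ , not-true Ay , x , Kx , Ax , not-true b″

      X-intro : ∀ {A} x → A ∈ℱ → lookup A y ≡ false → lookup K x ≡ true → lookup A x ≡ true → ℱ (swap x y A) ≡ false → X A ≡ true
      X-intro {A} x A∈ Ay Kx Ax bd = ∧-intro A∈ (∧-intro (not-false Ay) (true-anyᵇ (bad A) x (∧-intro Kx (∧-intro Ax (not-false bd)))))

      sym-swap : ∀ {x x′} A B → (∀ e → lookup K e ≡ false → lookup A e ≡ lookup B e) → I A K ≡ I B K →
        lookup K x ≡ true → lookup K x′ ≡ true → lookup A x ≡ true → lookup B x′ ≡ true → lookup A y ≡ false →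
        ℱ (swap x y A) ≡ true → ℱ (swap x′ y B) ≡ true
      sym-swap A B agree eq Kx Kx′ Ax Bx′ Ay = K-sym _ _ (swap-agree A B Kx Kx′ (trans Ax (sym Bx′)) (λ e Ke _ → agree e Ke))
        (suc-injective (trans (I-drop A Kx Ax Ay) (trans eq (sym (I-drop B Kx′ Bx′ (trans (sym (agree y Ky)) Ay))))))

      X-sym : ∀ A B → (∀ e → lookup K e ≡ false → lookup A e ≡ lookup B e) → I A K ≡ I B K → X A ≡ true → X B ≡ true
      X-sym A B agree eq XA with X-elim XA
      ... | A∈ , Ay , x , Kx , Ax , bd with I-exists B K (subst (1 ≤_) eq (I-one A K x Ax Kx))
      ...   | x′ , Bx′ , Kx′ = X-intro x′ (K-sym A B agree eq A∈) By Kx′ Bx′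
        (≢true λ h → true≢false (sym-swap B A (λ e Ke → sym (agree e Ke)) (sym eq) Kx′ Kx Bx′ Ax By h) bd)
        where
        By : lookup B y ≡ false
        By = trans (sym (agree y Ky)) Ay

      X-all : ∀ A x → X A ≡ true → lookup K x ≡ true → lookup A x ≡ true → ℱ (swap x y A) ≡ false
      X-all A x XA Kx Ax with X-elim XA
      ... | A∈ , Ay , x′ , Kx′ , Ax′ , bd = ≢true λ h →
        true≢false (sym-swap A A (λ _ _ → refl) refl Kx Kx′ Ax Ax′ Ay h) bd

      record Conflict (A B : Subset (suc n)) (x : Fin (suc n)) : Set where
        field
          Bx       : lookup B x ≡ true
          XB       : X B ≡ true
          I≡t      : I A B ≡ t
          disjoint : ∀ z → lookup K z ≡ false → lookup A z ∧ lookup B z ≡ false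
          levels   : I A K + I B K ≡ sz K + t

      -- The sets must meet in exactly t points, so replacing a common point of B by a point outside
      -- A is forbidden. A point of K missing from both would permit this by symmetry, a common
      -- point z outside K by compression from z to y. Hence the sets cover K and are disjoint off
      -- K.
      conflict : ∀ A x B → A ∈ℱ → lookup A y ≡ false → lookup K x ≡ true → lookup A x ≡ true →
                 B ∈ℱ → I (swap x y A) B < t → Conflict A B x
      conflict A x B A∈ Ay Kx Ax B∈ lt = record
        { Bx = Bx ; XB = X-intro x B∈ By Kx Bx (≢true λ h → <⇒≱ (clash (≢y Kx) Bx By Ax Ay) (int _ _ h A∈))
        ; I≡t = I≡t ; disjoint = disjoint
        ; levels = trans (I-cover A B K cover disjoint) (cong (sz K +_) I≡t) }
        where
        I-eq : I (swap x y A) B + ⟦ lookup B x ⟧ ≡ I A B + ⟦ lookup B y ⟧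
        I-eq = I-move (≢y Kx) A B Ax Ay
        both : lookup B x ≡ true × lookup B y ≡ false × I A B ≡ t
        both = go (lookup B x) (lookup B y) refl refl I-eq
          where
          go : ∀ p q → lookup B x ≡ p → lookup B y ≡ q → I (swap x y A) B + ⟦ p ⟧ ≡ I A B + ⟦ q ⟧ →
               lookup B x ≡ true × lookup B y ≡ false × I A B ≡ t
          go true  false p q eq = p , q , ≤-antisym (subst (_≤ t) (trans (+-comm 1 _) (trans eq (+-identityʳ _))) lt) (int A B A∈ B∈)
          go true  true  p q eq = ⊥-elim (<⇒≱ lt (subst (t ≤_) (sym (+-cancelʳ-≡ 1 _ _ eq)) (int A B A∈ B∈)))
          go false false p q eq = ⊥-elim (<⇒≱ lt (subst (t ≤_) (sym (+-cancelʳ-≡ 0 _ _ eq)) (int A B A∈ B∈)))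
          go false true  p q eq = ⊥-elim (<⇒≱ lt (≤-trans (int A B A∈ B∈) (≤-trans (m≤m+n _ 1) (≤-reflexive (trans (sym eq) (+-identityʳ _))))))
        Bx = proj₁ both
        By = proj₁ (proj₂ both)
        I≡t = proj₂ (proj₂ both)
        clash : ∀ {u v} → u ≢ v → lookup B u ≡ true → lookup B v ≡ false → lookup A u ≡ true → lookup A v ≡ false → I (swap u v B) A < t
        clash {u} {v} u≢v Bu Bv Au Av = ≤-reflexive (begin
          suc (I (swap u v B) A) ≡⟨ +-comm 1 _ ⟩
          I (swap u v B) A + 1 ≡⟨ cong (λ b → I (swap u v B) A + ⟦ b ⟧) Au ⟨
          I (swap u v B) A + ⟦ lookup A u ⟧ ≡⟨ I-move u≢v B A Bu Bv ⟩
          I B A + ⟦ lookup A v ⟧ ≡⟨ cong (λ b → I B A + ⟦ b ⟧) Av ⟩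
          I B A + 0 ≡⟨ +-identityʳ _ ⟩
          I B A ≡⟨ I-comm B A ⟩
          I A B ≡⟨ I≡t ⟩
          t ∎)
          where open ≡-Reasoning
        cover : ∀ z → lookup K z ≡ true → lookup A z ∨ lookup B z ≡ true
        cover z Kz with lookup A z in Az | lookup B z in Bz
        ... | true  | _     = refl
        ... | false | true  = refl
        ... | false | false = ⊥-elim (<⇒≱ (clash x≢z Bx Bz Ax Az) (int _ _ (K-sym B (swap x z B)
            (λ e Ke → sym (swap-o x≢z B (λ { refl → true≢false Kx Ke }) (λ { refl → true≢false Kz Ke })))
            (sym I-same) B∈) A∈))
          where
          x≢z : x ≢ z
          x≢z refl = true≢false Bx Bz
          I-same : I (swap x z B) K ≡ I B K
          I-same = +-cancelʳ-≡ 1 _ _ (subst₂ (λ p q → I (swap x z B) K + ⟦ p ⟧ ≡ I B K + ⟦ q ⟧) Kx Kz (I-move x≢z B K Bx Bz))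
        disjoint : ∀ z → lookup K z ≡ false → lookup A z ∧ lookup B z ≡ false
        disjoint z Kz with lookup A z in Az | lookup B z in Bz
        ... | false | _     = refl
        ... | true  | false = refl
        ... | true  | true  = ⊥-elim (<⇒≱ (clash z≢y Bz By Az Ay) (int _ _
            (subst (λ C → C ∈ℱ) (swap-sym z≢y B) (shift (below z Kz z≢y) B B∈ By Bz)) A∈))
          where
          z≢y : z ≢ y
          z≢y refl = true≢false Az Ay

      -- Deletes `Rem` and adds every set that arises from a member of `Add` by moving a point of K
      -- to y; `X-all` shows such sets to be new. By `conflict` they clash only with members of X at
      -- the complementary level and disjoint off K, which is why `clash` has this form.
      module Move (k m : ℕ) (k+m : k + m ≡ sz K) (Add Rem : Family (suc n))
        (Add⊆ : ∀ A → Add A ≡ true → X A ≡ true × I A K ≡ k)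
        (Add-sym : ∀ A B → (∀ e → lookup K e ≡ false → lookup A e ≡ lookup B e) → I A K ≡ I B K → Add A ≡ true → Add B ≡ true)
        (Rem⊆ : ∀ A → Rem A ≡ true → X A ≡ true)
        (clash : ∀ A B → Add A ≡ true → X B ≡ true → I A K + I B K ≡ sz K + t →
                 (∀ z → lookup K z ≡ false → lookup A z ∧ lookup B z ≡ false) → Rem B ≡ true × Add B ≡ false) where

        new : Subset (suc n) → Fin (suc n) → Bool
        new B x = lookup K x ∧ not (lookup B x) ∧ Add (swap x y B)

        Ãdd : Family (suc n)
        Ãdd B = lookup B y ∧ anyᵇ (new B)

        Ãdd-elim : ∀ {B} → Ãdd B ≡ true → lookup B y ≡ true × ∃[ x ] lookup K x ≡ true × lookup B x ≡ false × Add (swap x y B) ≡ true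
        Ãdd-elim {B} h with ∧-split {lookup B y} h
        ... | By , h′ with anyᵇ-true (new B) h′
        ...   | x , b with ∧-split {lookup K x} b
        ...     | Kx , b′ with ∧-split {not (lookup B x)} b′
        ...       | Bx , b″ = By , x , Kx , not-true Bx , b″

        Ãdd-intro : ∀ {B} x → lookup B y ≡ true → lookup K x ≡ true → lookup B x ≡ false → Add (swap x y B) ≡ true → Ãdd B ≡ true
        Ãdd-intro {B} x By Kx Bx h = ∧-intro By (true-anyᵇ (new B) x (∧-intro Kx (∧-intro (not-false Bx) h)))

        Ãdd-all : ∀ B x → Ãdd B ≡ true → lookup K x ≡ true → lookup B x ≡ false → Add (swap x y B) ≡ true
        Ãdd-all B x h Kx Bx with Ãdd-elim h
        ... | By , x′ , Kx′ , Bx′ , A+ = Add-sym (swap x′ y B) (swap x y B)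
          (swap-agree B B Kx′ Kx (trans Bx′ (sym Bx)) (λ _ _ _ → refl))
          (trans (I-gain B Kx′ Bx′ By) (sym (I-gain B Kx Bx By))) A+

        Ãdd-old : ∀ B → Ãdd B ≡ true → ℱ B ≡ false
        Ãdd-old B h with Ãdd-elim h
        ... | By , x , Kx , Bx , A+ = subst (λ C → ℱ C ≡ false) (swap-involutive (≢y Kx) B)
          (X-all (swap x y B) x (proj₁ (Add⊆ _ A+)) Kx (trans (swap-i (≢y Kx) B) By))

        w : Subset (suc n) → ℕ
        w = a ∘ co

        -- Both sides count the pairs (A, x) with A in Add and x ∈ A ∩ K.
        double-count : k * W a Add ≡ suc m * W a Ãdd
        double-count = begin
          k * W a Add ≡⟨ V-* k w Add ⟨
          Σˢ (λ A → ⟦ Add A ⟧ * (k * w A)) ≡⟨ Σˢ-cong left ⟨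
          Σˢ (λ A → Σᶠ (λ x → g A x)) ≡⟨ Σˢ-Σᶠ g ⟩
          Σᶠ (λ x → Σˢ (λ A → g A x)) ≡⟨ Σᶠ-cong per ⟩
          Σᶠ (λ x → Σˢ (λ B → h B x)) ≡⟨ Σˢ-Σᶠ h ⟨
          Σˢ (λ B → Σᶠ (λ x → h B x)) ≡⟨ Σˢ-cong right ⟩
          Σˢ (λ B → ⟦ Ãdd B ⟧ * (suc m * w B)) ≡⟨ V-* (suc m) w Ãdd ⟩
          suc m * W a Ãdd ∎
          where
          open ≡-Reasoning
          g h : Subset (suc n) → Fin (suc n) → ℕ
          g A x = ⟦ lookup K x ⟧ * ⟦ lookup A x ⟧ * (⟦ Add A ⟧ * w A)
          h B x = ⟦ lookup K x ⟧ * ⟦ not (lookup B x) ⟧ * (⟦ Ãdd B ⟧ * w B)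
          left : ∀ A → Σᶠ (λ x → g A x) ≡ ⟦ Add A ⟧ * (k * w A)
          left A = trans (Σᶠ-*ʳ (λ x → ⟦ lookup K x ⟧ * ⟦ lookup A x ⟧) _) (trans (cong (_* (⟦ Add A ⟧ * w A)) (Σ-K∩ A K)) (f (Add A) (λ p → proj₂ (Add⊆ A p))))
            where
            f : ∀ b → (b ≡ true → I A K ≡ k) → I A K * (⟦ b ⟧ * w A) ≡ ⟦ b ⟧ * (k * w A)
            f true  p rewrite p refl = trans (cong (k *_) (+-identityʳ (w A))) (sym (+-identityʳ _))
            f false p = *-zeroʳ (I A K)
          right : ∀ B → Σᶠ (λ x → h B x) ≡ ⟦ Ãdd B ⟧ * (suc m * w B)
          right B = trans (Σᶠ-*ʳ (λ x → ⟦ lookup K x ⟧ * ⟦ not (lookup B x) ⟧) _) (f (Ãdd B) outs)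
            where
            S = Σᶠ (λ x → ⟦ lookup K x ⟧ * ⟦ not (lookup B x) ⟧)
            outs : Ãdd B ≡ true → S ≡ suc m
            outs p with Ãdd-elim p
            ... | By , x , Kx , Bx , A+ = +-cancelʳ-≡ (I B K) _ _ (trans (Σ-K∖ B K) (trans (sym k+m)
              (trans (cong (_+ m) (trans (sym (proj₂ (Add⊆ _ A+))) (I-gain B Kx Bx By))) (cong suc (+-comm (I B K) m)))))
            f : ∀ b → (b ≡ true → S ≡ suc m) → S * (⟦ b ⟧ * w B) ≡ ⟦ b ⟧ * (suc m * w B)
            f true  p rewrite p refl = trans (cong (suc m *_) (+-identityʳ (w B))) (sym (+-identityʳ _))
            f false p = *-zeroʳ S
          per : ∀ x → Σˢ (λ A → g A x) ≡ Σˢ (λ B → h B x)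
          per x = go (lookup K x) refl
            where
            go : ∀ b → lookup K x ≡ b → Σˢ (λ A → g A x) ≡ Σˢ (λ B → h B x)
            go false Kx = trans (Σˢ-0 λ A → cong (λ b → ⟦ b ⟧ * ⟦ lookup A x ⟧ * (⟦ Add A ⟧ * w A)) Kx)
              (sym (Σˢ-0 λ B → cong (λ b → ⟦ b ⟧ * ⟦ not (lookup B x) ⟧ * (⟦ Ãdd B ⟧ * w B)) Kx))
            go true  Kx = trans (sym (Σˢ-involution (swap x y) (swap-involutive (≢y Kx)) (λ A → g A x))) (Σˢ-cong pointwise)
              where
              same : ∀ B → lookup B y ∧ Add (swap x y B) ≡ not (lookup B x) ∧ Ãdd B
              same B = Bool-ext to back
                where
                to : lookup B y ∧ Add (swap x y B) ≡ true → not (lookup B x) ∧ Ãdd B ≡ true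
                to p with ∧-split {lookup B y} p
                ... | By , A+ = ∧-intro (not-false Bx) (Ãdd-intro x By Kx Bx A+)
                  where
                  Bx : lookup B x ≡ false
                  Bx = trans (sym (swap-j (≢y Kx) B)) (proj₁ (proj₂ (X-elim (proj₁ (Add⊆ _ A+)))))
                back : not (lookup B x) ∧ Ãdd B ≡ true → lookup B y ∧ Add (swap x y B) ≡ true
                back p with ∧-split {not (lookup B x)} p
                ... | Bx , Ã = ∧-intro (proj₁ (Ãdd-elim Ã)) (Ãdd-all B x Ã Kx (not-true Bx))
              pointwise : ∀ B → g (swap x y B) x ≡ h B x
              pointwise B = begin
                ⟦ lookup K x ⟧ * ⟦ lookup (swap x y B) x ⟧ * (⟦ Add (swap x y B) ⟧ * w (swap x y B))
                  ≡⟨ cong₂ (λ u v → ⟦ lookup K x ⟧ * ⟦ u ⟧ * (⟦ Add (swap x y B) ⟧ * a v)) (swap-i (≢y Kx) B) (co-swap (≢y Kx) B) ⟩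
                ⟦ lookup K x ⟧ * ⟦ lookup B y ⟧ * (⟦ Add (swap x y B) ⟧ * w B)
                  ≡⟨ e ⟦ lookup K x ⟧ _ _ (w B) ⟩
                ⟦ lookup K x ⟧ * (⟦ lookup B y ⟧ * ⟦ Add (swap x y B) ⟧ * w B)
                  ≡⟨ cong (λ u → ⟦ lookup K x ⟧ * (u * w B)) (trans (sym (⟦∧⟧ (lookup B y) _)) (trans (cong ⟦_⟧ (same B)) (⟦∧⟧ (not (lookup B x)) _))) ⟩
                ⟦ lookup K x ⟧ * (⟦ not (lookup B x) ⟧ * ⟦ Ãdd B ⟧ * w B)
                  ≡⟨ e ⟦ lookup K x ⟧ _ _ (w B) ⟨
                ⟦ lookup K x ⟧ * ⟦ not (lookup B x) ⟧ * (⟦ Ãdd B ⟧ * w B) ∎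
                where
                e : ∀ k p q v → k * p * (q * v) ≡ k * (p * q * v)
                e = solve-∀

        𝒢 : Family (suc n)
        𝒢 B = (ℱ B ∧ not (Rem B)) ∨ Ãdd B

        new-old : ∀ B C → Ãdd B ≡ true → C ∈ℱ → Rem C ≡ false → t ≤ I B C
        new-old B C B+ C∈ C- with t ≤? I B C
        ... | yes p = p
        ... | no ¬p with Ãdd-elim B+
        ...   | By , x , Kx , Bx , A+ with X-elim (proj₁ (Add⊆ _ A+))
        ...     | A∈ , Ay , _ = ⊥-elim (true≢false (proj₁ (clash (swap x y B) C A+ (Conflict.XB c) (Conflict.levels c) (Conflict.disjoint c))) C-)
          where
          c : Conflict (swap x y B) C x
          c = conflict (swap x y B) x C A∈ Ay Kx (trans (swap-i (≢y Kx) B) By) C∈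
            (subst (λ D → I D C < t) (sym (swap-involutive (≢y Kx) B)) (≰⇒> ¬p))

        new-new : ∀ B C → Ãdd B ≡ true → Ãdd C ≡ true → t ≤ I B C
        new-new B C B+ C+ with t ≤? I B C
        ... | yes p = p
        ... | no ¬p with Ãdd-elim B+ | Ãdd-elim C+
        ...   | By , x , Kx , Bx , A+ | Cy , x′ , Kx′ , Cx′ , A′+ with X-elim (proj₁ (Add⊆ _ A+))
        ...     | A∈ , Ay , _ = ⊥-elim (true≢false A′+ (proj₂ (clash (swap x y B) C′ A+ (Conflict.XB c) (Conflict.levels c) (Conflict.disjoint c))))
          where
          C′ = swap x′ y C
          -- B contains y, so undoing the move that produced C loses a common point and regains at
          -- most one.
          I≤ : I B C′ ≤ I B C
          I≤ = subst₂ _≤_ (I-comm C′ B) (I-comm C B) (+-cancelʳ-≤ 1 _ _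
            (≤-trans (≤-reflexive (trans (cong (λ b → I C′ B + ⟦ b ⟧) (sym By)) (I-move′ (≢y Kx′) C B Cx′ Cy)))
              (+-monoʳ-≤ (I C B) (⟦⟧≤1 (lookup B x′)))))
          c : Conflict (swap x y B) C′ x
          c = conflict (swap x y B) x C′ A∈ Ay Kx (trans (swap-i (≢y Kx) B) By) (proj₁ (X-elim (proj₁ (Add⊆ _ A′+))))
            (subst (λ D → I D C′ < t) (sym (swap-involutive (≢y Kx) B)) (≤-trans (s≤s I≤) (≰⇒> ¬p)))

        𝒢-int : Intersectingᶠ t 𝒢
        𝒢-int B C B∈ C∈ with ∨-split {ℱ B ∧ not (Rem B)} B∈ | ∨-split {ℱ C ∧ not (Rem C)} C∈
        ... | inj₁ p | inj₁ q = int B C (proj₁ (∧-split p)) (proj₁ (∧-split q))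
        ... | inj₁ p | inj₂ q = subst (t ≤_) (I-comm C B) (new-old C B q (proj₁ (∧-split p)) (not-true (proj₂ (∧-split {ℱ B} p))))
        ... | inj₂ p | inj₁ q = new-old B C p (proj₁ (∧-split q)) (not-true (proj₂ (∧-split {ℱ C} q)))
        ... | inj₂ p | inj₂ q = new-new B C p q

        𝒢-supp : Supported a 𝒢
        𝒢-supp B B∈ with ∨-split {ℱ B ∧ not (Rem B)} B∈
        ... | inj₁ p = supp B (proj₁ (∧-split p))
        ... | inj₂ p with Ãdd-elim p
        ...   | By , x , Kx , Bx , A+ = subst (λ c → 0 < a c) (co-swap (≢y Kx) B) (supp _ (proj₁ (X-elim (proj₁ (Add⊆ _ A+)))))

        no-gain : W a Ãdd ≤ W a Rem
        no-gain = ≮⇒≥ λ lt → best 𝒢 𝒢-int 𝒢-supp (inj₁ (+-cancelʳ-< (W a Rem) _ _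
          (≤-trans (+-monoʳ-< (W a ℱ) lt) (≤-reflexive (sym balance)))))
          where
          balance : W a 𝒢 + W a Rem ≡ W a ℱ + W a Ãdd
          balance = V-balance w {𝒢} {Rem} {ℱ} {Ãdd} λ B → f (ℱ B) (Rem B) (Ãdd B) (λ h → proj₁ (X-elim (Rem⊆ B h))) (Ãdd-old B)
            where
            f : ∀ x r ã → (r ≡ true → x ≡ true) → (ã ≡ true → x ≡ false) → ⟦ (x ∧ not r) ∨ ã ⟧ + ⟦ r ⟧ ≡ ⟦ x ⟧ + ⟦ ã ⟧
            f true  r     true  p q with () ← q refl
            f true  true  false p q = refl
            f true  false false p q = refl
            f false true  ã     p q with () ← p refl
            f false false true  p q = refl
            f false false false p q = refl

      Xₖ : ℕ → Family (suc n)
      Xₖ k A = X A ∧ (I A K ≡ᵇ k)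

      Xₖ-elim : ∀ k A → Xₖ k A ≡ true → X A ≡ true × I A K ≡ k
      Xₖ-elim k A h with ∧-split {X A} h
      ... | p , q = p , ≡ᵇ-true _ k q

      Xₖ-sym : ∀ k A B → (∀ e → lookup K e ≡ false → lookup A e ≡ lookup B e) → I A K ≡ I B K → Xₖ k A ≡ true → Xₖ k B ≡ true
      Xₖ-sym k A B agree eq h with Xₖ-elim k A h
      ... | p , q = ∧-intro (X-sym A B agree eq p) (true-≡ᵇ _ k (trans (sym eq) q))

      I≤K : ∀ A → I A K ≤ sz K
      I≤K A = subst (_≤ sz K) (I-comm K A) (I≤sz K A)

      push-levels : ∀ k k′ m → k ≢ k′ → k + k′ ≡ sz K + t → k + m ≡ sz K →
        k * W a (Xₖ k) ≤ suc m * W a (Xₖ k′)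
      push-levels k k′ m k≢k′ k+k′ k+m = ≤-trans (≤-reflexive M.double-count) (*-monoʳ-≤ (suc m) M.no-gain)
        where
        Xₖ′⊆X : ∀ A → Xₖ k′ A ≡ true → X A ≡ true
        Xₖ′⊆X A h = proj₁ (Xₖ-elim k′ A h)
        clash : ∀ A B → Xₖ k A ≡ true → X B ≡ true → I A K + I B K ≡ sz K + t →
                (∀ z → lookup K z ≡ false → lookup A z ∧ lookup B z ≡ false) → Xₖ k′ B ≡ true × Xₖ k B ≡ false
        clash A B A+ XB levels _ = ∧-intro XB (true-≡ᵇ _ k′ B≡k′) , ≢true λ h → k≢k′ (trans (sym (proj₂ (Xₖ-elim k B h))) B≡k′)
          where
          B≡k′ : I B K ≡ k′
          B≡k′ = +-cancelˡ-≡ k _ _ (trans (cong (_+ I B K) (sym (proj₂ (Xₖ-elim k A A+)))) (trans levels (sym k+k′)))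
        module M = Move k m k+m (Xₖ k) (Xₖ k′) (Xₖ-elim k) (Xₖ-sym k) Xₖ′⊆X clash

      X-conflict : ∀ A → X A ≡ true → ∃[ B ] ∃[ x ] lookup K x ≡ true × lookup A x ≡ true × Conflict A B x
      X-conflict A XA with X-elim XA
      ... | A∈ , Ay , x , Kx , Ax , bd with maximal (swap x y A) bd (subst (λ c → 0 < a c) (sym (co-swap (≢y Kx) A)) (supp A A∈))
                                            (≤-trans (<⇒≤ (large A A∈)) (≤-reflexive (sym (sz-swap (≢y Kx) A))))
      ...   | B , B∈ , lt = B , x , Kx , Ax , conflict A x B A∈ Ay Kx Ax B∈ lt

      -- Between distinct levels k = m′ + t and k′ = m + t, pushing in both directions gives (m′ +
      -- t)(m + t) ≤ (m + 1)(m′ + 1), which is false for t ≥ 2.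
      central : ∀ A → X A ≡ true → I A K + I A K ≡ sz K + t
      central A XA with X-conflict A XA
      ... | B , x , Kx , Ax , c with I A K ≟ I B K
      ...   | yes eq = trans (cong (I A K +_) eq) (Conflict.levels c)
      ...   | no  k≢k′ = ⊥-elim (<⇒≱ too-big (begin
        (m′ + t) * (m + t) * w₁ ≡⟨ e₁ (m′ + t) (m + t) w₁ ⟩
        (m + t) * ((m′ + t) * w₁) ≡⟨ cong (λ k → (m + t) * (k * w₁)) k≡ ⟨
        (m + t) * (k * w₁) ≤⟨ *-monoʳ-≤ (m + t) (push-levels k k′ m k≢k′ levels k+m) ⟩
        (m + t) * (suc m * w₂) ≡⟨ e₂ (m + t) (suc m) w₂ ⟩
        suc m * ((m + t) * w₂) ≡⟨ cong (λ k → suc m * (k * w₂)) k′≡ ⟨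
        suc m * (k′ * w₂) ≤⟨ *-monoʳ-≤ (suc m) (push-levels k′ k m′ (k≢k′ ∘ sym) (trans (+-comm k′ k) levels) k′+m′) ⟩
        suc m * (suc m′ * w₁) ≡⟨ *-assoc (suc m) (suc m′) w₁ ⟨
        suc m * suc m′ * w₁ ∎))
        where
        open ≤-Reasoning
        levels = Conflict.levels c
        k k′ m m′ w₁ w₂ : ℕ
        k = I A K
        k′ = I B K
        m = sz K ∸ k
        m′ = sz K ∸ k′
        w₁ = W a (Xₖ k)
        w₂ = W a (Xₖ k′)
        k+m : k + m ≡ sz K
        k+m = m+[n∸m]≡n (I≤K A)
        k′+m′ : k′ + m′ ≡ sz K
        k′+m′ = m+[n∸m]≡n (I≤K B)
        k′≡ : k′ ≡ m + t
        k′≡ = +-cancelˡ-≡ k _ _ (trans levels (trans (cong (_+ t) (sym k+m)) (+-assoc k m t)))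
        k≡ : k ≡ m′ + t
        k≡ = +-cancelˡ-≡ k′ _ _ (trans (+-comm k′ k) (trans levels (trans (cong (_+ t) (sym k′+m′)) (+-assoc k′ m′ t))))
        w₁>0 : 0 < w₁
        w₁>0 = V-pos (a ∘ co) (Xₖ k) A (∧-intro XA (true-≡ᵇ k k refl)) (supp A (proj₁ (X-elim XA)))
        too-big : suc m * suc m′ * w₁ < (m′ + t) * (m + t) * w₁
        too-big = *-monoˡ-< w₁ {{>-nonZero w₁>0}} (≤-trans (s≤s (*-monoʳ-≤ (suc m) (m≤m+n (suc m′) 0)))
          (subst (λ t″ → suc (suc m * (suc m′ + 0)) ≤ (m′ + suc t″) * (m + suc t″)) (m+[n∸m]≡n t′≥1)
            (≤-from {p = 0} {q = 0} (m + m′ + 2 + (t′ ∸ 1) * (m + m′ + 4 + (t′ ∸ 1))) z≤n (e₃ m m′ (t′ ∸ 1)))))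
          where
          e₃ : ∀ m m′ u → (m′ + suc (1 + u)) * (m + suc (1 + u)) + 0 ≡ suc (suc m * (suc m′ + 0)) + 0 + (m + m′ + 2 + u * (m + m′ + 4 + u))
          e₃ = solve-∀
        e₁ : ∀ p q w → p * q * w ≡ q * (p * w)
        e₁ = solve-∀
        e₂ : ∀ p q w → p * (q * w) ≡ q * (p * w)
        e₂ = solve-∀

      -- Pulling.

      module Pull (A* : Subset (suc n)) (XA* : X A* ≡ true) where

        s : ℕ
        s = I A* K ∸ t

        t≤k : t ≤ I A* K
        t≤k = +-cancelˡ-≤ (sz K) _ _ (subst (_≤ sz K + I A* K) (central A* XA*) (+-monoˡ-≤ (I A* K) (I≤K A*)))

        k*≡ : I A* K ≡ t + s
        k*≡ = sym (m+[n∸m]≡n t≤k)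

        K≡ : sz K ≡ t + (s + s)
        K≡ = +-cancelʳ-≡ t _ _ (trans (sym (central A* XA*)) (trans (cong₂ _+_ k*≡ k*≡) (e t s)))
          where
          e : ∀ t s → (t + s) + (t + s) ≡ t + (s + s) + t
          e = solve-∀

        level : ∀ A → X A ≡ true → I A K ≡ t + s
        level A XA = double-injective (trans (central A XA) (trans (sym (central A* XA*)) (cong₂ _+_ k*≡ k*≡)))

        zero∉K : lookup K zero ≡ false
        zero∉K = ≢true λ h → n≮0 (above zero h)

        -- Otherwise K consists of all points but zero, and t + 2s = n = t′ + 2r contradicts parity.
        zero≢y : zero ≢ y
        zero≢y refl = odd≢even s r (+-cancelʳ-≡ t′ _ _ (trans (e t′ s) (trans (sym K≡) (trans K-size (sym n≡)))))
          where
          e : ∀ t s → suc (s + s) + t ≡ suc t + (s + s)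
          e = solve-∀
          others : ∀ e → e ≢ zero → lookup K e ≡ true
          others e e≢0 with lookup K e in Ke
          ... | true  = refl
          ... | false = ⊥-elim (n≮0 (below e Ke e≢0))
          K-size : sz K ≡ n
          K-size = size K zero∉K others
            where
            size : ∀ (L : Subset (suc n)) → lookup L zero ≡ false → (∀ e → e ≢ zero → lookup L e ≡ true) → sz L ≡ n
            size (b ∷ L) refl h = trans (sz-out L) (sz-full L (λ e → h (suc e) (λ ())))

        open Tail K y Ky

        M-size : suc (sz U + (s + s)) ≡ r + r
        M-size = +-cancelʳ-≡ t′ _ _ (trans (e (sz U) s t′) (trans (cong (_+ sz U) (sym K≡))
          (trans (suc-injective M+K) (sym n≡))))
          where
          e : ∀ m s t → suc (m + (s + s)) + t ≡ suc t + (s + s) + m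
          e = solve-∀

        co-count : ∀ A → X A ≡ true → co A + s + I A U ≡ r + r
        co-count A XA = +-cancelˡ-≡ t _ _ (begin
          t + (co A + s + I A U) ≡⟨ e t (co A) s (I A U) ⟩
          t + s + I A U + co A ≡⟨ cong (λ k → k + I A U + co A) (level A XA) ⟨
          I A K + I A U + co A ≡⟨ cong (_+ co A) (split A (proj₁ (proj₂ (X-elim XA)))) ⟨
          sz A + co A ≡⟨ sz+co A ⟩
          suc n ≡⟨ cong suc n≡ ⟨
          suc (r + r + t′) ≡⟨ cong suc (+-comm (r + r) t′) ⟩
          t + (r + r) ∎)
          where
          open ≡-Reasoning
          e : ∀ t c s i → t + (c + s + i) ≡ t + s + i + c
          e = solve-∀

        -- If some member of X lies inside K, symmetry forces ℱ into a Frankl family.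
        tail-nonempty : ∀ A → X A ≡ true → ∃[ z ] lookup U z ≡ true × lookup A z ≡ true
        tail-nonempty A XA = go (1 ≤? I A U)
          where
          A-off : ¬ (1 ≤ I A U) → ∀ e → lookup K e ≡ false → lookup A e ≡ false
          A-off ¬p e Ke with e Fin.≟ y
          ... | yes refl = proj₁ (proj₂ (X-elim XA))
          ... | no e≢y = ≢true λ Ae → ¬p (I-one A U e Ae (M-intro Ke e≢y))
          doubled : ∀ t s → t + s + (t + s) ≡ t + (t + (s + s))
          doubled = solve-∀
          small : ∀ B S → I B K < t + s → I S B ≡ 0 ⊎ I S B + sz K ≡ t + s + I B K → I S B < t
          small B S lt (inj₁ z)  = subst (_< t) (sym z) (s≤s z≤n)
          small B S lt (inj₂ eq) = +-cancelʳ-< (sz K) (I S B) t (begin-strict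
            I S B + sz K ≡⟨ eq ⟩
            t + s + I B K <⟨ +-monoʳ-< (t + s) lt ⟩
            t + s + (t + s) ≡⟨ doubled t s ⟩
            t + (t + (s + s)) ≡⟨ cong (t +_) K≡ ⟨
            t + sz K ∎)
            where open ≤-Reasoning
          inside-K : ¬ (1 ≤ I A U) → ∀ B → B ∈ℱ → t + s ≤ I B K
          inside-K ¬p B B∈ = ≮⇒≥ λ lt → clash lt (minimal-overlap K B (t + s) (subst (_≤ sz K) (level A XA) (I≤K A)))
            where
            clash : I B K < t + s → ∃[ S ] S ⊑ K × sz S ≡ t + s × (I S B ≡ 0 ⊎ I S B + sz K ≡ t + s + I B K) → ⊥
            clash lt (S , S⊑K , S-size , meets) = <⇒≱ (small B S lt meets) (int S B S∈ B∈)
              where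
              S∈ : S ∈ℱ
              S∈ = K-sym A S (λ e Ke → trans (A-off ¬p e Ke) (sym (≢true λ Se → true≢false (S⊑K e Se) Ke)))
                (trans (level A XA) (sym (trans (I-⊑ S K S⊑K) S-size))) (proj₁ (X-elim XA))
          go : Dec (1 ≤ I A U) → ∃[ z ] lookup U z ≡ true × lookup A z ≡ true
          go (yes p) = let (z , Az , Mz) = I-exists A U p in z , Mz , Az
          go (no ¬p) = ⊥-elim (no-F K s K≡ (inside-K ¬p))

        τ : Subset (suc n) → Subset (suc n)
        τ = flip U

        τ-K : ∀ A {e} → lookup K e ≡ true ⊎ e ≡ y → lookup (τ A) e ≡ lookup A e
        τ-K A {e} h = trans (lookup-flip U A e) (cong (_xor lookup A e) (M-not h))

        τ-M : ∀ A {e} → lookup U e ≡ true → lookup (τ A) e ≡ not (lookup A e)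
        τ-M A {e} Me = trans (lookup-flip U A e) (cong (_xor lookup A e) Me)

        zero∈M : lookup U zero ≡ true
        zero∈M = M-intro zero∉K zero≢y

        -- Take a set B in conflict with A and enlarge it, off K and y, to the complement of A. The
        -- result B⁺ still meets A in t points, is a member by upward closure, and differs from
        -- `τ A` only inside K, by equally many points. Symmetry passes membership on to `τ A`, and
        -- a successful move of x to y there would also succeed for B⁺, which then meets A in too
        -- few points.
        X-complement : ∀ A → X A ≡ true → X (τ A) ≡ true
        X-complement A XA with X-elim XA | X-conflict A XA | tail-nonempty A XA
        ... | A∈ , Ay , _ | B , x , Kx , Ax , c | z , Mz , Az =
          X-intro x Ā∈ Āy Kx (trans (τ-K A (inj₁ Kx)) Ax) (≢true λ h → <⇒≱ (B⁺-clash) (int _ _ (moved h) A∈))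
          where
          open Conflict c
          B⁺ : Subset (suc n)
          B⁺ = mix K B (τ A)
          B⁺-K : ∀ {e} → lookup K e ≡ true → lookup B⁺ e ≡ lookup B e
          B⁺-K = mix-in K B (τ A)
          B⁺-o : ∀ {e} → lookup K e ≡ false → lookup B⁺ e ≡ lookup (τ A) e
          B⁺-o = mix-out K B (τ A)
          Āy : lookup (τ A) y ≡ false
          Āy = trans (τ-K A (inj₂ refl)) Ay
          B⁺y : lookup B⁺ y ≡ false
          B⁺y = trans (B⁺-o Ky) Āy
          B⊑B⁺ : B ⊑ B⁺
          B⊑B⁺ e Be with lookup K e in Ke
          ... | true  = trans (B⁺-K Ke) Be
          ... | false = trans (B⁺-o Ke) (trans (τ-M A (M-intro Ke (λ { refl → true≢false Be (proj₁ (proj₂ (X-elim XB))) })))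
              (not-false (≢true λ Ae → true≢false (∧-intro Ae Be) (disjoint e Ke))))
          B⁺∈ : B⁺ ∈ℱ
          -- Besides y, B⁺ misses the point z that A has in the tail; two missing points ensure
          -- positive weight.
          B⁺∈ = upward B B⁺ (proj₁ (X-elim XB)) B⊑B⁺ (a>0 _ (co-two B⁺ y z (λ { refl → proj₂ (M-elim Mz) refl }) B⁺y
            (trans (B⁺-o (proj₁ (M-elim Mz))) (trans (τ-M A Mz) (cong not Az)))))
          agree : ∀ e → lookup K e ≡ false → lookup B⁺ e ≡ lookup (τ A) e
          agree e Ke = B⁺-o Ke
          I-eq : I B⁺ K ≡ I (τ A) K
          I-eq = trans (I-cong B⁺ B K (λ e Ke → B⁺-K Ke)) (trans (trans (level B XB) (sym (level A XA)))
            (sym (I-cong (τ A) A K (λ e Ke → τ-K A (inj₁ Ke)))))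
          Ā∈ : τ A ∈ℱ
          Ā∈ = K-sym B⁺ (τ A) agree I-eq B⁺∈
          B⁺x : lookup B⁺ x ≡ true
          B⁺x = trans (B⁺-K Kx) Bx
          moved : ℱ (swap x y (τ A)) ≡ true → ℱ (swap x y B⁺) ≡ true
          moved = sym-swap (τ A) B⁺ (λ e Ke → sym (agree e Ke)) (sym I-eq) Kx Kx (trans (τ-K A (inj₁ Kx)) Ax) B⁺x Āy
          I-B⁺A : I B⁺ A ≡ t
          I-B⁺A = trans (I-comm B⁺ A) (trans same I≡t)
            where
            same : I A B⁺ ≡ I A B
            same = trans (I-comm A B⁺) (trans (I-cong B⁺ B A on-A) (I-comm B A))
              where
              on-A : ∀ e → lookup A e ≡ true → lookup B⁺ e ≡ lookup B e
              on-A e Ae with lookup K e in Ke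
              ... | true  = B⁺-K Ke
              ... | false = trans (B⁺-o Ke) (trans (τ-M A (M-intro Ke (λ { refl → true≢false Ae Ay }))) (trans (cong not Ae)
                  (sym (≢true λ Be → true≢false (∧-intro Ae Be) (disjoint e Ke)))))
          B⁺-clash : I (swap x y B⁺) A < t
          B⁺-clash = ≤-reflexive (trans (+-comm 1 _) (trans (cong (λ b → I (swap x y B⁺) A + ⟦ b ⟧) (sym Ax))
            (trans (I-move (≢y Kx) B⁺ A B⁺x B⁺y) (trans (cong (λ b → I B⁺ A + ⟦ b ⟧) Ay) (trans (+-identityʳ _) I-B⁺A)))))

        headless : ∀ (b b′ : Bool) (A : Subset n) {e} → e ≢ zero → lookup (b ∷ A) e ≡ lookup (b′ ∷ A) e
        headless b b′ A {zero}  h = ⊥-elim (h refl)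
        headless b b′ A {suc e} h = refl

        K≢zero : ∀ {x} → lookup K x ≡ true → x ≢ zero
        K≢zero Kx refl = true≢false Kx zero∉K

        -- Only pivots need zero, and those with 1 ≤ co A have co A = r. If the smaller set could
        -- move x to y, so could the larger, by upward closure.
        X-drop-zero : ∀ A → X (inside ∷ A) ≡ true → co A ≢ r → X (outside ∷ A) ≡ true
        X-drop-zero A XA coA≢r with X-elim XA
        ... | A∈ , Ay , x , Kx , Ax , bd = X-intro x
          (spare-zero A A∈ (subst (1 ≤_) (co-in A) (co-one (inside ∷ A) y Ay)) coA≢r)
          (trans (headless false true A (zero≢y ∘ sym)) Ay) Kx (trans (headless false true A (K≢zero Kx)) Ax)
          (≢true λ h → true≢false (upward _ _ h ⊑-swap (subst (λ c → 0 < a c) (sym (co-swap (≢y Kx) (inside ∷ A))) (supp _ A∈))) bd)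
          where
          below-in : (outside ∷ A) ⊑ (inside ∷ A)
          below-in zero    ()
          below-in (suc e) h = h
          ⊑-swap : swap x y (outside ∷ A) ⊑ swap x y (inside ∷ A)
          ⊑-swap e h with e Fin.≟ x | e Fin.≟ y
          ... | yes refl | _        = trans (swap-i (≢y Kx) (inside ∷ A)) (below-in y (trans (sym (swap-i (≢y Kx) (outside ∷ A))) h))
          ... | no _     | yes refl = trans (swap-j (≢y Kx) (inside ∷ A)) (below-in x (trans (sym (swap-j (≢y Kx) (outside ∷ A))) h))
          ... | no e≢x   | no e≢y   = trans (swap-o (≢y Kx) (inside ∷ A) e≢x e≢y) (below-in e (trans (sym (swap-o (≢y Kx) (outside ∷ A) e≢x e≢y)) h))

        co-complement : ∀ A → X A ≡ true → co A + co (τ A) ≡ suc (r + r)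
        co-complement A XA = +-cancelʳ-≡ (s + s + sz U) _ _ (begin
          co A + co (τ A) + (s + s + sz U) ≡⟨ cong (λ m → co A + co (τ A) + (s + s + m)) (sym (I-complement A (τ A) U (λ e Me → τ-M A Me))) ⟩
          co A + co (τ A) + (s + s + (I A U + I (τ A) U)) ≡⟨ e₁ (co A) (co (τ A)) s (I A U) (I (τ A) U) ⟩
          (co A + s + I A U) + (co (τ A) + s + I (τ A) U) ≡⟨ cong₂ _+_ (co-count A XA) (co-count (τ A) (X-complement A XA)) ⟩
          (r + r) + (r + r) ≡⟨ cong ((r + r) +_) (sym M-size) ⟩
          (r + r) + suc (sz U + (s + s)) ≡⟨ e₂ r s (sz U) ⟩
          suc (r + r) + (s + s + sz U) ∎)
          where
          open ≡-Reasoning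
          e₁ : ∀ c d s i j → c + d + (s + s + (i + j)) ≡ (c + s + i) + (d + s + j)
          e₁ = solve-∀
          e₂ : ∀ r s m → (r + r) + suc (m + (s + s)) ≡ suc (r + r) + (s + s + m)
          e₂ = solve-∀

        -- The conjugate of `X-drop-zero` under complementing the tail, which exchanges having and
        -- lacking zero. By `co-complement` the exceptional size r is carried to itself.
        X-add-zero : ∀ A → X (outside ∷ A) ≡ true → co A ≢ r → X (inside ∷ A) ≡ true
        X-add-zero A XA coA≢r = go (τ (outside ∷ A)) refl
          where
          go : ∀ B → τ (outside ∷ A) ≡ B → X (inside ∷ A) ≡ true
          go (false ∷ B) eq = ⊥-elim (true≢false (τ-M (outside ∷ A) zero∈M) (cong (λ D → lookup D zero) eq))
          go (true ∷ B)  eq = subst (λ D → X D ≡ true) back (X-complement _ (X-drop-zero B XB coB≢r))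
            where
            XB : X (inside ∷ B) ≡ true
            XB = subst (λ D → X D ≡ true) eq (X-complement _ XA)
            coB≢r : co B ≢ r
            coB≢r h = coA≢r (+-cancelʳ-≡ r _ _ (suc-injective (trans (cong₂ (λ u v → u + v) (sym (co-out A))
              (trans (sym h) (trans (sym (co-in B)) (cong co (sym eq))))) (co-complement _ XA))))
            back : τ (outside ∷ B) ≡ inside ∷ A
            back = vec-ext point
              where
              point : ∀ e → lookup (τ (outside ∷ B)) e ≡ lookup (inside ∷ A) e
              point zero    = τ-M (outside ∷ B) zero∈M
              point (suc e) = trans (lookup-flip U (outside ∷ B) (suc e)) (trans (sym (lookup-flip U (inside ∷ B) (suc e)))
                (cong (λ D → lookup D (suc e)) (trans (cong τ (sym eq)) (flip-involutive U (outside ∷ A)))))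

        -- Sets in conflict are disjoint off K, so members of X with zero conflict only with those
        -- without it. This splits the single level that `central` has left.
        Add Rem : Family (suc n)
        Add A = X A ∧ lookup A zero
        Rem A = X A ∧ not (lookup A zero)

        Add⊆ : ∀ A → Add A ≡ true → X A ≡ true × I A K ≡ t + s
        Add⊆ A h = proj₁ (∧-split h) , level A (proj₁ (∧-split h))

        Add-sym : ∀ A B → (∀ e → lookup K e ≡ false → lookup A e ≡ lookup B e) → I A K ≡ I B K → Add A ≡ true → Add B ≡ true
        Add-sym A B agree eq h = ∧-intro (X-sym A B agree eq (proj₁ (∧-split h)))
          (trans (sym (agree zero zero∉K)) (proj₂ (∧-split {X A} h)))

        Rem⊆ : ∀ A → Rem A ≡ true → X A ≡ true
        Rem⊆ A h = proj₁ (∧-split h)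

        clash : ∀ A B → Add A ≡ true → X B ≡ true → I A K + I B K ≡ sz K + t →
                (∀ z → lookup K z ≡ false → lookup A z ∧ lookup B z ≡ false) → Rem B ≡ true × Add B ≡ false
        clash A B A+ XB _ dis = ∧-intro XB (not-false B0) , ≢true λ h → true≢false (proj₂ (∧-split {X B} h)) B0
          where
          B0 : lookup B zero ≡ false
          B0 = ≢true λ B0 → true≢false (∧-intro (proj₂ (∧-split {X A} A+)) B0) (dis zero zero∉K)

        module M′ = Move (t + s) s (trans (+-assoc t s s) (sym K≡)) Add Rem Add⊆ Add-sym Rem⊆ clash

        toggle : Subset (suc n) → Subset (suc n)
        toggle (b ∷ A) = not b ∷ A

        toggle-involutive : ∀ A → toggle (toggle A) ≡ A
        toggle-involutive (true ∷ A)  = refl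
        toggle-involutive (false ∷ A) = refl

        f g : Subset (suc n) → ℕ
        f A = suc s * a (co A)
        g A = (t + s) * a (co A)

        -- Toggling zero sends `Rem` into `Add` except for sets missing r + 1 points, where
        -- `X-add-zero` says nothing. These are sent by `τ` to the sets of `Add` missing r points,
        -- which toggling leaves free.
        Add₁ Add₂ Rem₁ Rem₂ : Family (suc n)
        Add₁ A = Add A ∧ not (co A ≡ᵇ r)
        Add₂ A = Add A ∧ (co A ≡ᵇ r)
        Rem₁ A = Rem A ∧ not (co A ≡ᵇ suc r)
        Rem₂ A = Rem A ∧ (co A ≡ᵇ suc r)

        V-split : ∀ (h : Subset (suc n) → ℕ) (𝒫 : Family (suc n)) (q : Subset (suc n) → Bool) →
                  V h 𝒫 ≡ V h (λ A → 𝒫 A ∧ not (q A)) + V h (λ A → 𝒫 A ∧ q A)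
        V-split h 𝒫 q = trans (sym (+-identityʳ _)) (trans (cong (V h 𝒫 +_) (sym (Σˢ-0 λ _ → refl)))
          (sym (V-balance h {λ A → 𝒫 A ∧ not (q A)} {λ A → 𝒫 A ∧ q A} {𝒫} {λ _ → false} λ A → i (𝒫 A) (q A))))
          where
          i : ∀ p b → ⟦ p ∧ not b ⟧ + ⟦ p ∧ b ⟧ ≡ ⟦ p ⟧ + 0
          i true  true  = refl
          i true  false = refl
          i false b     = refl

        -- The pulling inequality at j = s + 1, where t′ + j = t + s. Both side conditions express
        -- that a tail is nonempty: in `below-2r` that of the set, in `s<co` that of its complement.
        weights : ∀ x → suc s < x → suc s + x < r + r → suc s * a (suc x) < (t + s) * a x
        weights x s<x sx = subst (λ u → suc s * a (suc x) < u * a x) (+-suc t′ s) (gap (suc s) x (s≤s z≤n) s<x sx)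

        below-2r : ∀ A → X A ≡ true → ∀ x → co A ≡ suc x → suc s + x < r + r
        below-2r A XA x eq = go (tail-nonempty A XA)
          where
          open ≤-Reasoning
          e : ∀ s x → suc (suc s + x) ≡ suc x + s + 1
          e = solve-∀
          go : ∃[ z ] lookup U z ≡ true × lookup A z ≡ true → suc s + x < r + r
          go (z , Mz , Az) = begin
            suc (suc s + x) ≡⟨ e s x ⟩
            suc x + s + 1 ≡⟨ cong (λ c → c + s + 1) eq ⟨
            co A + s + 1 ≤⟨ +-monoʳ-≤ (co A + s) (I-one A U z Az Mz) ⟩
            co A + s + I A U ≡⟨ co-count A XA ⟩
            r + r ∎

        co-tail : ∀ A → X A ≡ true → co A ≡ I (τ A) U + suc s
        co-tail A XA = +-cancelʳ-≡ (s + I A U) (co A) (I (τ A) U + suc s) (begin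
          co A + (s + I A U) ≡⟨ +-assoc (co A) s (I A U) ⟨
          co A + s + I A U ≡⟨ co-count A XA ⟩
          r + r ≡⟨ M-size ⟨
          suc (sz U + (s + s)) ≡⟨ cong (λ m → suc (m + (s + s))) (I-complement A (τ A) U (λ e Me → τ-M A Me)) ⟨
          suc (I A U + I (τ A) U + (s + s)) ≡⟨ e (I A U) (I (τ A) U) s ⟩
          I (τ A) U + suc s + (s + I A U) ∎)
          where
          open ≡-Reasoning
          e : ∀ i j s → suc (i + j + (s + s)) ≡ j + suc s + (s + i)
          e = solve-∀

        s<co : ∀ A → X (outside ∷ A) ≡ true → X (inside ∷ A) ≡ true → suc s < co A
        s<co A XA XA⁺ = go (tail-nonempty (τ (inside ∷ A)) (X-complement (inside ∷ A) XA⁺))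
          where
          go : ∃[ z ] lookup U z ≡ true × lookup (τ (inside ∷ A)) z ≡ true → suc s < co A
          go (z , Mz , τz) = s≤s⁻¹ (begin
            2 + suc s ≤⟨ +-monoˡ-≤ (suc s) two ⟩
            I (τ (outside ∷ A)) U + suc s ≡⟨ co-tail (outside ∷ A) XA ⟨
            co (outside ∷ A) ≡⟨ co-out A ⟩
            suc (co A) ∎)
            where
            open ≤-Reasoning
            Az : lookup (inside ∷ A) z ≡ false
            Az = not-true (trans (sym (τ-M (inside ∷ A) Mz)) τz)
            z≢0 : zero ≢ z
            z≢0 0≡z = true≢false {lookup (inside ∷ A) zero} refl (subst (λ z → lookup (inside ∷ A) z ≡ false) (sym 0≡z) Az)
            two : 2 ≤ I (τ (outside ∷ A)) U
            two = I-two (τ (outside ∷ A)) U zero z z≢0 (τ-M (outside ∷ A) zero∈M) zero∈M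
              (trans (τ-M (outside ∷ A) Mz) (cong not (trans (headless false true A (z≢0 ∘ sym)) Az))) Mz

        map₁ : ∀ A → Rem₁ A ≡ true → Add₁ (toggle A) ≡ true × f A < g (toggle A)
        map₁ (true ∷ A)  h = ⊥-elim (true≢false (proj₂ (∧-split {X (inside ∷ A)} (proj₁ (∧-split {Rem (inside ∷ A)} h)))) refl)
        map₁ (false ∷ A) h = ∧-intro (∧-intro XA⁺ refl) (not-false (≢true λ p → coA≢r (trans (sym (co-in A)) (≡ᵇ-true (co (inside ∷ A)) r p)))) , lt
          where
          XA : X (outside ∷ A) ≡ true
          XA = proj₁ (∧-split (proj₁ (∧-split {Rem (outside ∷ A)} h)))
          coA≢r : co A ≢ r
          coA≢r p = true≢false (true-≡ᵇ (co (outside ∷ A)) (suc r) (trans (co-out A) (cong suc p)))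
            (not-true (proj₂ (∧-split {Rem (outside ∷ A)} h)))
          XA⁺ : X (inside ∷ A) ≡ true
          XA⁺ = X-add-zero A XA coA≢r
          lt : f (outside ∷ A) < g (inside ∷ A)
          lt = subst₂ (λ u v → suc s * a u < (t + s) * a v) (sym (co-out A)) (sym (co-in A))
            (weights (co A) (s<co A XA XA⁺) (below-2r (outside ∷ A) XA (co A) (co-out A)))

        map₂ : ∀ A → Rem₂ A ≡ true → Add₂ (τ A) ≡ true × f A < g (τ A)
        map₂ A h = ∧-intro (∧-intro (X-complement A XA) (trans (τ-M A zero∈M) (proj₂ (∧-split {X A} (proj₁ (∧-split {Rem A} h))))))
                           (true-≡ᵇ (co (τ A)) r co-τ) , lt
          where
          XA : X A ≡ true
          XA = proj₁ (∧-split (proj₁ (∧-split {Rem A} h)))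
          co-A : co A ≡ suc r
          co-A = ≡ᵇ-true (co A) (suc r) (proj₂ (∧-split {Rem A} h))
          co-τ : co (τ A) ≡ r
          co-τ = +-cancelˡ-≡ (suc r) (co (τ A)) r (trans (cong (_+ co (τ A)) (sym co-A)) (co-complement A XA))
          s<r : suc s < r
          s<r = +-cancelʳ-< r (suc s) r (below-2r A XA r co-A)
          lt : f A < g (τ A)
          lt = subst₂ (λ u v → suc s * a u < (t + s) * a v) (sym co-A) (sym co-τ)
            (weights r s<r (below-2r A XA r co-A))

        starred : ∃[ A ] Add A ≡ true
        starred = go (lookup A* zero) refl
          where
          go : ∀ b → lookup A* zero ≡ b → ∃[ A ] Add A ≡ true
          go true  A0 = A* , ∧-intro XA* A0
          go false A0 = τ A* , ∧-intro (X-complement A* XA*) (trans (τ-M A* zero∈M) (cong not A0))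

        -- Each image outweighs its preimage, and sets of `Add` that are not images add to the gain;
        -- so one set in `Add` makes the inequality strict, even if `Rem` is empty.
        gain : V f Rem < V g Add
        gain = subst₂ _<_ (sym (V-split f Rem (λ A → co A ≡ᵇ suc r))) (sym (V-split g Add (λ A → co A ≡ᵇ r))) (go starred)
          where
          positive : ∀ A → Add A ≡ true → 0 < g A
          positive A A+ = *-mono-≤ (s≤s (z≤n {t′ + s})) (supp A (proj₁ (X-elim (proj₁ (∧-split A+)))))
          go : ∃[ A ] Add A ≡ true → V f Rem₁ + V f Rem₂ < V g Add₁ + V g Add₂
          go (A , A+) = go′ (co A ≡ᵇ r) refl
            where
            go′ : ∀ b → (co A ≡ᵇ r) ≡ b → V f Rem₁ + V f Rem₂ < V g Add₁ + V g Add₂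
            go′ true  eq = +-mono-≤-< (V-map-≤ toggle toggle-involutive f g {Rem₁} {Add₁} map₁)
              (V-map-< τ (flip-involutive U) f g {Rem₂} {Add₂} map₂ A (∧-intro A+ eq) (positive A A+))
            go′ false eq = +-mono-<-≤ (V-map-< toggle toggle-involutive f g {Rem₁} {Add₁} map₁ A (∧-intro A+ (not-false eq)) (positive A A+))
              (V-map-≤ τ (flip-involutive U) f g {Rem₂} {Add₂} map₂)

        absurd : ⊥
        absurd = <⇒≱ (subst₂ _<_ (V-* (suc s) (a ∘ co) Rem) (trans (V-* (t + s) (a ∘ co) Add) M′.double-count) gain)
          (*-monoʳ-≤ (suc s) M′.no-gain)

      X-empty : ∀ A → X A ≡ true → ⊥
      X-empty A XA = Pull.absurd A XA

      K⁺ : Subset (suc n)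
      K⁺ = K [ y ]≔ true

      I-K⁺ : ∀ A → I A K⁺ ≡ I A K + ⟦ lookup A y ⟧
      I-K⁺ A = I-upd A K y Ky

      -- Replacing y by a point of K is compression; replacing a point of K by y is the emptiness of
      -- X. Everything else is the symmetry of K.
      K⁺-sym : Symmetric K⁺
      K⁺-sym A B agree I-eq A∈ = go (lookup A y) (lookup B y) refl refl
          (subst₂ _≡_ (I-K⁺ A) (I-K⁺ B) I-eq)
        where
        agree′ : ∀ e → lookup K e ≡ false → e ≢ y → lookup A e ≡ lookup B e
        agree′ e Ke e≢y = agree e (trans (lookup-upd′ K true e≢y) Ke)
        with-y : ∀ C → (∀ e → lookup K e ≡ false → e ≢ y → lookup C e ≡ lookup A e) → lookup C y ≡ lookup B y →
                 ∀ e → lookup K e ≡ false → lookup C e ≡ lookup B e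
        with-y C CA Cy e Ke with e Fin.≟ y
        ... | yes refl = Cy
        ... | no e≢y   = trans (CA e Ke e≢y) (agree′ e Ke e≢y)
        swapped : ∀ {x} → lookup K x ≡ true → ∀ e → lookup K e ≡ false → e ≢ y → lookup (swap x y A) e ≡ lookup A e
        swapped Kx e Ke e≢y = swap-o (≢y Kx) A (λ { refl → true≢false Kx Ke }) e≢y
        go : ∀ p q → lookup A y ≡ p → lookup B y ≡ q → I A K + ⟦ lookup A y ⟧ ≡ I B K + ⟦ lookup B y ⟧ → B ∈ℱ
        go true  true  Ay By eq = K-sym A B (with-y A (λ _ _ _ → refl) (trans Ay (sym By)))
          (+-cancelʳ-≡ 1 _ _ (subst₂ (λ p q → I A K + ⟦ p ⟧ ≡ I B K + ⟦ q ⟧) Ay By eq)) A∈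
        go false false Ay By eq = K-sym A B (with-y A (λ _ _ _ → refl) (trans Ay (sym By)))
          (+-cancelʳ-≡ 0 _ _ (subst₂ (λ p q → I A K + ⟦ p ⟧ ≡ I B K + ⟦ q ⟧) Ay By eq)) A∈
        go true  false Ay By eq with I-<-exists A B K (subst₂ _≤_ (+-comm (I A K) 1) (+-identityʳ _) (≤-reflexive (subst₂ (λ p q → I A K + ⟦ p ⟧ ≡ I B K + ⟦ q ⟧) Ay By eq)))
        ... | x , Kx , Bx , Ax = K-sym (swap x y A) B (with-y (swap x y A) (swapped Kx) (trans (swap-j (≢y Kx) A) (trans Ax (sym By))))
          (trans (I-gain A Kx Ax Ay) (trans (+-comm 1 _) (trans (subst₂ (λ p q → I A K + ⟦ p ⟧ ≡ I B K + ⟦ q ⟧) Ay By eq) (+-identityʳ _))))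
          (shift (above x Kx) A A∈ Ax Ay)
        go false true  Ay By eq with I-<-exists B A K (subst₂ _≤_ (+-comm (I B K) 1) (+-identityʳ _) (≤-reflexive (sym (subst₂ (λ p q → I A K + ⟦ p ⟧ ≡ I B K + ⟦ q ⟧) Ay By eq))))
        ... | x , Kx , Ax , Bx = K-sym (swap x y A) B (with-y (swap x y A) (swapped Kx) (trans (swap-j (≢y Kx) A) (trans Ax (sym By))))
          (suc-injective (trans (I-drop A Kx Ax Ay) (trans (sym (+-identityʳ _)) (trans (subst₂ (λ p q → I A K + ⟦ p ⟧ ≡ I B K + ⟦ q ⟧) Ay By eq) (+-comm _ 1)))))
          (moved (ℱ (swap x y A)) refl)
          where
          moved : ∀ b → ℱ (swap x y A) ≡ b → swap x y A ∈ℱ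
          moved true  p = p
          moved false p = ⊥-elim (X-empty A (X-intro x A∈ Ay Kx Ax p))

    -- Starts with the empty final segment, where agreement off it is equality, and ends with the
    -- whole ground set.
    from-symmetric : ∀ d c → d + c ≡ suc n → Symmetric (from c)
    from-symmetric zero    c refl A B agree _ A∈ = subst _∈ℱ (vec-ext λ e → agree e (from-false c e (Fin.toℕ<n e))) A∈
    from-symmetric (suc d) c eq = subst Symmetric (vec-ext same) L.K⁺-sym
      where
      c<n : c < suc n
      c<n = subst (c <_) eq (s≤s (m≤n+m c d))
      y : Fin (suc n)
      y = fromℕ< c<n
      y≡c : toℕ y ≡ c
      y≡c = Fin.toℕ-fromℕ< c<n
      below : ∀ z → lookup (from (suc c)) z ≡ false → z ≢ y → toℕ z < toℕ y
      below z Kz z≢y = ≤∧≢⇒< (subst (toℕ z ≤_) (sym y≡c) (s≤s⁻¹ (false-from (suc c) z Kz))) (λ h → z≢y (Fin.toℕ-injective h))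
      above : ∀ x → lookup (from (suc c)) x ≡ true → toℕ y < toℕ x
      above x Kx = subst (_< toℕ x) (sym y≡c) (from-true (suc c) x Kx)
      module L = Level (from (suc c)) (from-symmetric d (suc c) (trans (+-suc d c) eq)) y
        (from-false (suc c) y (s≤s (≤-reflexive y≡c))) below above
      same : ∀ e → lookup L.K⁺ e ≡ lookup (from c) e
      same e with e Fin.≟ y
      ... | yes refl = trans (lookup-upd (from (suc c)) y true) (sym (true-from c y (≤-reflexive (sym y≡c))))
      ... | no e≢y   = trans (lookup-upd′ (from (suc c)) true e≢y) (Bool-ext
        (λ h → true-from c e (<⇒≤ (from-true (suc c) e h)))
        (λ h → true-from (suc c) e (≤∧≢⇒< (from-true c e h) (λ c≡ → e≢y (Fin.toℕ-injective (trans (sym c≡) (sym y≡c)))))))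

    full : Subset (suc n)
    full = from 0

    I-full : ∀ A → I A full ≡ sz A
    I-full A = I-⊑ A full λ e _ → true-from 0 e z≤n

    sz-from-0 : sz full ≡ suc n
    sz-from-0 = sz-full full λ e → true-from 0 e z≤n

    -- With full symmetry, a member of size below t + r can be rearranged to meet itself in fewer
    -- than t points, the ground set having t + 2r points. So all members have size at least t + r:
    -- a Frankl family on the whole ground set.
    absurd : ⊥
    absurd = no-F full r (trans sz-from-0 (trans (cong suc (sym n≡)) (cong suc (+-comm (r + r) t′)))) big
      where
      big : ∀ A → A ∈ℱ → t + r ≤ I A full
      big A A∈ with t + r ≤? I A full
      ... | yes p = p
      ... | no ¬p with minimal-overlap full A (sz A) (subst (sz A ≤_) (sym sz-from-0) (sz≤n A))
      ...   | S , _ , S-size , meets = ⊥-elim (<⇒≱ (small meets) (int S A S∈ A∈))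
        where
        S∈ : S ∈ℱ
        S∈ = from-symmetric (suc n) 0 (+-identityʳ _) A S (λ e h → ⊥-elim (n≮0 (false-from 0 e h)))
          (trans (I-full A) (trans (sym S-size) (sym (I-full S)))) A∈
        size< : sz A < t + r
        size< = subst (_< t + r) (I-full A) (≰⇒> ¬p)
        small : I S A ≡ 0 ⊎ I S A + sz full ≡ sz A + I A full → I S A < t
        small (inj₁ z) = subst (_< t) (sym z) (s≤s z≤n)
        small (inj₂ eq) = +-cancelʳ-< (suc n) _ _ (subst₂ (λ p q → p < t + q)
          (sym (trans (cong (I S A +_) (sym sz-from-0)) (trans eq (cong (sz A +_) (I-full A))))) (cong suc n≡)
          (≤-trans (+-mono-<-≤ size< (<⇒≤ size<)) (≤-reflexive (e t′ r))))
          where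
          e : ∀ t′ r → suc t′ + r + (suc t′ + r) ≡ suc t′ + suc (r + r + t′)
          e = solve-∀

-- Descent by improvement and induction on the ground set.

lexicographic-< : ∀ N {a a′ b b′} → b ≤ N → a < a′ → a * suc N + b < a′ * suc N + b′
lexicographic-< N {a} {a′} {b} {b′} b≤N a<a′ = begin-strict
  a * suc N + b ≤⟨ +-monoʳ-≤ (a * suc N) b≤N ⟩
  a * suc N + N <⟨ n<1+n _ ⟩
  suc (a * suc N + N) ≡⟨ cong suc (+-comm (a * suc N) N) ⟩
  suc a * suc N ≤⟨ *-monoˡ-≤ (suc N) a<a′ ⟩
  a′ * suc N ≤⟨ m≤m+n _ b′ ⟩
  a′ * suc N + b′ ∎
  where open ≤-Reasoning

-- Encodes `Better` in one bounded number, with the totals over all sets as bases of the digits, so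
-- that improvement must end.
module Score (n : ℕ) (a : ℕ → ℕ) where

  private
    all : Family (suc n)
    all _ = true
    NW NO NP : ℕ
    NW = W {suc n} a all
    NO = V outᶻ all
    NP = V position all

    ≤all : ∀ f ℱ → V f ℱ ≤ V f all
    ≤all f ℱ = V-mono f {ℱ} {all} (λ _ _ → refl)

    WO : Family (suc n) → ℕ
    WO ℱ = W a ℱ * suc NO + V outᶻ ℱ

  score : Family (suc n) → ℕ
  score ℱ = WO ℱ * suc NP + V position ℱ

  maximum : ℕ
  maximum = (NW * suc NO + NO) * suc NP + NP

  score≤ : ∀ ℱ → score ℱ ≤ maximum
  score≤ ℱ = +-mono-≤ (*-monoˡ-≤ (suc NP) (+-mono-≤ (*-monoˡ-≤ (suc NO) (≤all (a ∘ co) ℱ)) (≤all outᶻ ℱ))) (≤all position ℱ)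

  score-< : ∀ (ℱ 𝒢 : Family (suc n)) → Better a ℱ 𝒢 → score ℱ < score 𝒢
  score-< ℱ 𝒢 (inj₁ W<) = lexicographic-< NP {WO ℱ} {WO 𝒢} (≤all position ℱ) (lexicographic-< NO {W a ℱ} {W a 𝒢} (≤all outᶻ ℱ) W<)
  score-< ℱ 𝒢 (inj₂ (inj₁ (W≤ , O<))) = lexicographic-< NP {WO ℱ} {WO 𝒢} (≤all position ℱ) (+-mono-≤-< (*-monoˡ-≤ (suc NO) W≤) O<)
  score-< ℱ 𝒢 (inj₂ (inj₂ (W≤ , O≤ , P<))) = +-mono-≤-< (*-monoˡ-≤ (suc NP) (+-mono-≤ (*-monoˡ-≤ (suc NO) W≤) O≤)) P<

  better⇒W≤ : ∀ (ℱ 𝒢 : Family (suc n)) → Better a ℱ 𝒢 → W a ℱ ≤ W a 𝒢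
  better⇒W≤ ℱ 𝒢 (inj₁ W<)              = <⇒≤ W<
  better⇒W≤ ℱ 𝒢 (inj₂ (inj₁ (W≤ , _))) = W≤
  better⇒W≤ ℱ 𝒢 (inj₂ (inj₂ (W≤ , _))) = W≤

module CompleteIntersection (weight : ℕ → ℕ → ℕ)
  (weight-suc : ∀ h x → weight (suc h) x ≡ weight h x + weight h (suc x))
  (weight-mono : ∀ h x → 1 ≤ x → weight h x ≤ weight h (suc x))
  (weight>0 : ∀ h x → 2 ≤ x → 0 < weight h x)
  (weight-step : ∀ h t r → (t + r) * weight h r ≤ r * weight h (suc r)
    ⊎ (r * weight h (suc r) < (t + r) * weight h r
       × ∀ j x → 1 ≤ j → j < x → j + x < r + r → j * weight h (suc x) < (t + j) * weight h x)) where

  FrankBound : ∀ n → ℕ → ℕ → ℕ → Set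
  FrankBound n h t Z = ∀ (K : Subset n) s → sz K ≡ t + (s + s) → W (weight h) (F t s K) ≤ Z

  -- If K lacks zero, the Frankl family ignores zero, and summing over its two states is the
  -- replacement of a(x) by a(x) + a(x + 1).
  frank-restrict : ∀ n h t Z → FrankBound (suc n) h t Z → FrankBound n (suc h) t Z
  frank-restrict n h t Z bound K s K≡ = subst (_≤ Z) (begin
    W (weight h) (F t s (outside ∷ K)) ≡⟨ Σˢ-suc _ ⟩
    Σˢ (λ A → ⟦ F t s (outside ∷ K) (inside ∷ A) ⟧ * weight h (co (inside ∷ A)))
      + Σˢ (λ A → ⟦ F t s (outside ∷ K) (outside ∷ A) ⟧ * weight h (co (outside ∷ A)))
                                                                  ≡⟨ Σˢ-+ _ _ ⟨
    Σˢ (λ A → ⟦ F t s (outside ∷ K) (inside ∷ A) ⟧ * weight h (co (inside ∷ A))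
      + ⟦ F t s (outside ∷ K) (outside ∷ A) ⟧ * weight h (co (outside ∷ A)))
                                                                  ≡⟨ Σˢ-cong per ⟩
    W (weight (suc h)) (F t s K) ∎)
    (bound (outside ∷ K) s (trans (sz-out K) K≡))
    where
    open ≡-Reasoning
    per : ∀ A → ⟦ F t s (outside ∷ K) (inside ∷ A) ⟧ * weight h (co (inside ∷ A))
      + ⟦ F t s (outside ∷ K) (outside ∷ A) ⟧ * weight h (co (outside ∷ A)) ≡ ⟦ F t s K A ⟧ * weight (suc h) (co A)
    per A rewrite I-in-out A K | I-out A false K | co-in A | co-out A | weight-suc h (co A) =
      sym (*-distribˡ-+ ⟦ F t s K A ⟧ (weight h (co A)) _)

  module Induction (n h t′ Z : ℕ)
    (bound : FrankBound (suc n) h (suc t′) Z)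
    (restricted : suc t′ ≤ n → ∀ (𝒫 : Family n) → Intersectingᶠ (suc t′) 𝒫 → W (weight (suc h)) 𝒫 ≤ Z) where

    a : ℕ → ℕ
    a = weight h

    open Score n a

    module Unimprovable (ℱ : Family (suc n)) (int : Intersectingᶠ (suc t′) ℱ) (supp : Supported a ℱ) (Z< : Z < W a ℱ)
      (best : ∀ 𝒢 → Intersectingᶠ (suc t′) 𝒢 → Supported a 𝒢 → Better a ℱ 𝒢 → ⊥) where

      no-F : ∀ K s → sz K ≡ suc t′ + (s + s) → (∀ A → ℱ A ≡ true → suc t′ + s ≤ I A K) → ⊥
      no-F K s K≡ h = <⇒≱ Z< (≤-trans (V-mono (a ∘ co) (λ A A∈ → true-≤ᵇ (h A A∈))) (bound K s K≡))

      open Extremal n t′ a (weight-mono h) (weight>0 h) ℱ int supp no-F best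

      central : ∀ A B → pivot A ≡ true → 1 ≤ co A → pivot B ≡ true → 1 ≤ co B → co B ≡ co A
      central A B pA 1≤A pB 1≤B = double-injective (+-cancelʳ-≡ t′ _ _ (trans (pivot-central B pB 1≤B) (sym (pivot-central A pA 1≤A))))

      no-pivot : ∀ A → pivot A ≡ true → 1 ≤ co A → ⊥
      no-pivot A pA 1≤r with weight-step h t′ (co A)
      ... | inj₁ le = pivot-average A pA 1≤r le
      ... | inj₂ (lt , gap) = PushPull.absurd (co A) 1≤r (pivot-central A pA 1≤r) (t′≥1 t′ lt) gap spare
        where
        -- For t = 1 averaging cannot fail, by monotonicity of the weights.
        t′≥1 : ∀ t′ → co A * a (suc (co A)) < (t′ + co A) * a (co A) → 1 ≤ t′
        t′≥1 zero    lt = ⊥-elim (<⇒≱ lt (*-monoʳ-≤ (co A) (weight-mono h (co A) 1≤r)))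
        t′≥1 (suc _) lt = s≤s z≤n
        spare : ∀ B → ℱ (inside ∷ B) ≡ true → 1 ≤ co B → co B ≢ co A → ℱ (outside ∷ B) ≡ true
        spare B B∈ 1≤B B≢A with ℱ (outside ∷ B) in eq
        ... | true  = refl
        ... | false = ⊥-elim (B≢A (central A B pA 1≤r (∧-intro B∈ (not-false eq)) 1≤B))

      -- A pivot that misses no other point escapes, since without zero it would miss exactly one,
      -- where the weight may vanish. Then A is full, so it does no harm to the intersections in
      -- `𝒫`.
      spare : ∀ A → ℱ (inside ∷ A) ≡ true → ℱ (outside ∷ A) ≡ true ⊎ co A ≡ 0
      spare A A∈ with ℱ (outside ∷ A) in eq
      ... | true  = inj₁ refl
      ... | false with co A in c
      ...   | zero  = inj₂ refl
      ...   | suc _ = ⊥-elim (no-pivot A (∧-intro A∈ (not-false eq)) (subst (1 ≤_) (sym c) (s≤s z≤n)))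

      member : ∃[ A ] ℱ A ≡ true
      member = V-nonempty (a ∘ co) ℱ (≤-trans (s≤s z≤n) Z<)

      t≤n : suc t′ ≤ n
      t≤n = s≤s⁻¹ (≤-trans (large (proj₁ member) (proj₂ member)) (sz≤n _))

      𝒫 : Family n
      𝒫 A = ℱ (inside ∷ A) ∨ ℱ (outside ∷ A)

      members : ∀ A → 𝒫 A ≡ true → ℱ (outside ∷ A) ≡ true ⊎ (ℱ (inside ∷ A) ≡ true × co A ≡ 0)
      members A h with ∨-split {ℱ (inside ∷ A)} h
      ... | inj₂ p = inj₁ p
      ... | inj₁ p with spare A p
      ...   | inj₁ q = inj₁ q
      ...   | inj₂ q = inj₂ (p , q)

      𝒫-int : Intersectingᶠ (suc t′) 𝒫
      𝒫-int A B A∈ B∈ with members A A∈ | members B B∈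
      ... | inj₁ p | inj₁ q = subst (suc t′ ≤_) (I-out A false B) (int _ _ p q)
      ... | inj₁ p | inj₂ (q , _) = subst (suc t′ ≤_) (I-out A true B) (int _ _ p q)
      ... | inj₂ (p , _) | inj₁ q = subst (suc t′ ≤_) (I-in-out A B) (int _ _ p q)
      ... | inj₂ (p , cA) | inj₂ (q , cB) = ≤-trans t≤n (≤-reflexive (sym (begin
        I A B ≡⟨ I-cong A B B (λ e Be → trans (full A cA e) (sym Be)) ⟩
        I B B ≡⟨ I-self B ⟩
        sz B ≡⟨ +-identityʳ _ ⟨
        sz B + 0 ≡⟨ cong (sz B +_) cB ⟨
        sz B + co B ≡⟨ sz+co B ⟩
        n ∎)))
        where
        open ≡-Reasoning
        full : ∀ A → co A ≡ 0 → ∀ e → lookup A e ≡ true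
        full A c e with lookup A e in Ae
        ... | true  = refl
        ... | false = ⊥-elim (<⇒≢ (co-one A e Ae) (sym c))

      absurd : ⊥
      absurd = <⇒≱ Z< (≤-trans W≤ (restricted t≤n 𝒫 𝒫-int))
        where
        open ≤-Reasoning
        per : ∀ A → ⟦ ℱ (inside ∷ A) ⟧ * a (co (inside ∷ A)) + ⟦ ℱ (outside ∷ A) ⟧ * a (co (outside ∷ A))
                  ≤ ⟦ 𝒫 A ⟧ * weight (suc h) (co A)
        per A rewrite co-in A | co-out A | weight-suc h (co A) | *-distribˡ-+ ⟦ 𝒫 A ⟧ (a (co A)) (a (suc (co A))) =
          +-mono-≤ (*-monoˡ-≤ (a (co A)) (⟦⟧-mono {ℱ (inside ∷ A)} {𝒫 A} ∨-introˡ))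
                   (*-monoˡ-≤ (a (suc (co A))) (⟦⟧-mono {ℱ (outside ∷ A)} {𝒫 A} (∨-introʳ {ℱ (inside ∷ A)})))
        W≤ : W a ℱ ≤ W (weight (suc h)) 𝒫
        W≤ = ≤-trans (≤-reflexive (trans (Σˢ-suc _) (sym (Σˢ-+ (λ A → ⟦ ℱ (inside ∷ A) ⟧ * a (co (inside ∷ A))) _)))) (Σˢ-mono per)

    -- No optimum is chosen: a better family obeys the bound by recursion on the missing score, and
    -- its weight is at least that of ℱ. Hence a counterexample may be taken to be unimprovable.
    improve : ∀ ℱ → Acc _<_ (maximum ∸ score ℱ) → Intersectingᶠ (suc t′) ℱ → Supported a ℱ → W a ℱ ≤ Z
    improve ℱ (acc rec) int supp = ≮⇒≥ λ Z< → Unimprovable.absurd ℱ int supp Z< λ 𝒢 𝒢-int 𝒢-supp better →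
      <⇒≱ Z< (≤-trans (better⇒W≤ ℱ 𝒢 better)
        (improve 𝒢 (rec (∸-monoʳ-< (score-< ℱ 𝒢 better) (score≤ 𝒢))) 𝒢-int 𝒢-supp))

    W≤Z : ∀ ℱ → Intersectingᶠ (suc t′) ℱ → W a ℱ ≤ Z
    W≤Z ℱ int = subst (_≤ Z) (Σˢ-cong λ A → drop (ℱ A) (a (co A)))
      (improve ℱ₀ (<-wellFounded _) (λ A B p q → int A B (proj₁ (∧-split p)) (proj₁ (∧-split q)))
        (λ A p → <ᵇ⇒< 0 (a (co A)) (true≡ (proj₂ (∧-split {ℱ A} p)))))
      where
      -- Discarding weightless members makes the family supported without changing its total.
      ℱ₀ : Family (suc n)
      ℱ₀ A = ℱ A ∧ (0 <ᵇ a (co A))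
      drop : ∀ b x → ⟦ b ∧ (0 <ᵇ x) ⟧ * x ≡ ⟦ b ⟧ * x
      drop true  zero    = refl
      drop true  (suc x) = refl
      drop false x       = refl

  -- The bound Z is left arbitrary because it passes unchanged to the smaller ground set.
  complete : ∀ n h t′ → suc t′ ≤ n → ∀ Z → FrankBound n h (suc t′) Z → ∀ (ℱ : Family n) → Intersectingᶠ (suc t′) ℱ → W (weight h) ℱ ≤ Z
  complete zero    h t′ ()
  complete (suc n) h t′ _ Z bound = Induction.W≤Z n h t′ Z bound
    λ t≤n → complete n (suc h) t′ t≤n Z (frank-restrict n h (suc t′) Z bound)


open module BlockMembership {n} = DecPropositionalMembership (_≟ˢ_ {n}) using (_∈?_)

-- Partitions given by a Boolean test for blocks

⁅⁆-self : (i : Fin n) → lookup ⁅ i ⁆ i ≡ true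
⁅⁆-self i = []=⇒lookup (Subset.x∈⁅x⁆ i)

⁅⁆-elim : {i j : Fin n} → lookup ⁅ i ⁆ j ≡ true → j ≡ i
⁅⁆-elim {i = i} {j} h = Subset.x∈⁅y⁆⇒x≡y i (lookup⇒[]= j ⁅ i ⁆ h)

⁅⁆-injective : {i j : Fin n} → ⁅ i ⁆ ≡ ⁅ j ⁆ → i ≡ j
⁅⁆-injective {i = i} {j} eq = ⁅⁆-elim (subst (λ b → lookup b i ≡ true) eq (⁅⁆-self i))

block-nonempty : (p : Partition n) {b : Subset n} → b ∈ blocks p → ∃[ i ] lookup b i ≡ true
block-nonempty p b∈ with All.lookup (Partition.nonempty p) b∈
... | i , i∈b = i , []=⇒lookup i∈b

block-unique : (p : Partition n) {b c : Subset n} {i : Fin n} → b ∈ blocks p → c ∈ blocks p →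
               lookup b i ≡ true → lookup c i ≡ true → b ≡ c
block-unique p {b} {c} {i} b∈ c∈ bi ci with b ≟ˢ c
... | yes eq = eq
... | no b≢c = ⊥-elim (AllPairs-lookup (λ {x} {y} → subst Empty (Subset.∩-comm x y)) (Partition.disjoint p) b∈ c∈ b≢c
  (i , Subset.x∈p∩q⁺ (lookup⇒[]= i b bi , lookup⇒[]= i c ci)))

block-of : (p : Partition n) (i : Fin n) → ∃[ b ] b ∈ blocks p × lookup b i ≡ true
block-of p i with find (Partition.covering p i)
... | b , b∈ , i∈b = b , b∈ , []=⇒lookup i∈b

fixed-true : (p : Partition n) {i : Fin n} → ⁅ i ⁆ ∈ blocks p → lookup (fixed p) i ≡ true
fixed-true p {i} h = trans (lookup∘tabulate (λ i → does (⁅ i ⁆ ∈? blocks p)) i) (go (⁅ i ⁆ ∈? blocks p))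
  where
  go : (d : Dec (⁅ i ⁆ ∈ blocks p)) → does d ≡ true
  go (yes _) = refl
  go (no ¬h) = ⊥-elim (¬h h)

true-fixed : (p : Partition n) {i : Fin n} → lookup (fixed p) i ≡ true → ⁅ i ⁆ ∈ blocks p
true-fixed p {i} h = go (⁅ i ⁆ ∈? blocks p) (trans (sym (lookup∘tabulate (λ i → does (⁅ i ⁆ ∈? blocks p)) i)) h)
  where
  go : (d : Dec (⁅ i ⁆ ∈ blocks p)) → does d ≡ true → ⁅ i ⁆ ∈ blocks p
  go (yes h) _ = h

⊑-antisym : {A B : Subset n} → A ⊑ B → B ⊑ A → A ≡ B
⊑-antisym A⊑B B⊑A = vec-ext λ e → Bool-ext (A⊑B e) (B⊑A e)

fixed-cong : (p q : Partition n) → p ≈ q → fixed p ≡ fixed q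
fixed-cong p q (p⊆q , q⊆p) = ⊑-antisym (λ e h → fixed-true q (p⊆q (true-fixed p h))) (λ e h → fixed-true p (q⊆p (true-fixed q h)))

module FromTest (P : Subset n → Bool)
  (P-nonempty : ∀ b → P b ≡ true → ∃[ i ] lookup b i ≡ true)
  (P-disjoint : ∀ b c i → P b ≡ true → P c ≡ true → lookup b i ≡ true → lookup c i ≡ true → b ≡ c)
  (P-cover : ∀ i → ∃[ b ] P b ≡ true × lookup b i ≡ true) where

  private
    P? : Decidable (λ b → P b ≡ true)
    P? b = P b Bool.≟ true

    bs : List (Subset n)
    bs = filter P? (subsets n)

    bs-true : ∀ {b} → b ∈ bs → P b ≡ true
    bs-true b∈ = proj₂ (∈-filter⁻ P? {xs = subsets n} b∈)

    true-bs : ∀ {b} → P b ≡ true → b ∈ bs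
    true-bs {b} h = ∈-filter⁺ P? (subsets-complete b) h

  partition : Partition n
  partition = mkPartition bs (mkIsPartition
    (All.tabulate λ {b} b∈ → let (i , bi) = P-nonempty b (bs-true b∈) in i , lookup⇒[]= i b bi)
    (AllPairs-∈ (λ {b} {c} b∈ c∈ b≢c (i , i∈) → let (i∈b , i∈c) = Subset.x∈p∩q⁻ b c i∈ in
        b≢c (P-disjoint b c i (bs-true b∈) (bs-true c∈) ([]=⇒lookup i∈b) ([]=⇒lookup i∈c)))
      (AllPairs.filter⁺ P? (subsets-unique n)))
    (λ i → let (b , Pb , bi) = P-cover i in lose (true-bs Pb) (lookup⇒[]= i b bi)))

  ∈⇒test : ∀ {b} → b ∈ blocks partition → P b ≡ true
  ∈⇒test = bs-true

  test⇒∈ : ∀ {b} → P b ≡ true → b ∈ blocks partition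
  test⇒∈ = true-bs

memᵇ : Subset n → Partition n → Bool
memᵇ b p = does (b ∈? blocks p)

memᵇ-true : (b : Subset n) (p : Partition n) → memᵇ b p ≡ true → b ∈ blocks p
memᵇ-true b p h with b ∈? blocks p
... | yes b∈ = b∈

true-memᵇ : (b : Subset n) (p : Partition n) → b ∈ blocks p → memᵇ b p ≡ true
true-memᵇ b p h with b ∈? blocks p
... | yes _ = refl
... | no b∉ = ⊥-elim (b∉ h)

singleᵇ : Subset n → Subset n → Bool
singleᵇ T c = anyᵇ λ i → lookup T i ∧ (c == ⁅ i ⁆)

singleᵇ-elim : (T c : Subset n) → singleᵇ T c ≡ true → ∃[ i ] lookup T i ≡ true × c ≡ ⁅ i ⁆
singleᵇ-elim T c h with anyᵇ-true (λ i → lookup T i ∧ (c == ⁅ i ⁆)) h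
... | i , q with ∧-split {lookup T i} q
...   | Ti , c≡ = i , Ti , ==-sound c ⁅ i ⁆ c≡

singleᵇ-intro : (T : Subset n) {i : Fin n} → lookup T i ≡ true → singleᵇ T ⁅ i ⁆ ≡ true
singleᵇ-intro T {i} Ti = true-anyᵇ (λ j → lookup T j ∧ (⁅ i ⁆ == ⁅ j ⁆)) i (∧-intro Ti (==-refl ⁅ i ⁆))

-- Breaking a block into singletons

module Break (b : Subset n) (p : Partition n) (b∈p : b ∈ blocks p) where

  test : Subset n → Bool
  test c = (memᵇ c p ∧ not (c == b)) ∨ singleᵇ b c

  test-elim : ∀ c → test c ≡ true → (c ∈ blocks p × c ≢ b) ⊎ (∃[ i ] lookup b i ≡ true × c ≡ ⁅ i ⁆)
  test-elim c h with ∨-split {memᵇ c p ∧ not (c == b)} h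
  ... | inj₁ q with ∧-split {memᵇ c p} q
  ...   | m , ≢ = inj₁ (memᵇ-true c p m , λ { refl → true≢false (==-refl c) (not-true ≢) })
  test-elim c h | inj₂ q = inj₂ (singleᵇ-elim b c q)

  keep : ∀ {c} → c ∈ blocks p → c ≢ b → test c ≡ true
  keep {c} c∈ c≢b = ∨-introˡ (∧-intro (true-memᵇ c p c∈) (not-false (≢true λ eq → c≢b (==-sound c b eq))))

  single : ∀ {i} → lookup b i ≡ true → test ⁅ i ⁆ ≡ true
  single {i} bi = ∨-introʳ {memᵇ ⁅ i ⁆ p ∧ not (⁅ i ⁆ == b)} (singleᵇ-intro b bi)

  test-disjoint : ∀ c d i → test c ≡ true → test d ≡ true → lookup c i ≡ true → lookup d i ≡ true → c ≡ d
  test-disjoint c d i tc td ci di with test-elim c tc | test-elim d td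
  ... | inj₁ (c∈ , _) | inj₁ (d∈ , _) = block-unique p c∈ d∈ ci di
  ... | inj₁ (c∈ , c≢b) | inj₂ (j , bj , refl) rewrite ⁅⁆-elim {i = j} {i} di = ⊥-elim (c≢b (block-unique p c∈ b∈p ci bj))
  ... | inj₂ (j , bj , refl) | inj₁ (d∈ , d≢b) rewrite ⁅⁆-elim {i = j} {i} ci = ⊥-elim (d≢b (block-unique p d∈ b∈p di bj))
  ... | inj₂ (j , _ , refl) | inj₂ (k , _ , refl) rewrite ⁅⁆-elim {i = j} {i} ci | ⁅⁆-elim {i = k} {j} di = refl

  test-cover : ∀ i → ∃[ c ] test c ≡ true × lookup c i ≡ true
  test-cover i with block-of p i
  ... | c , c∈ , ci with c ≟ˢ b
  ...   | yes refl = ⁅ i ⁆ , single ci , ⁅⁆-self i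
  ...   | no c≢b   = c , keep c∈ c≢b , ci

  test-nonempty : ∀ c → test c ≡ true → ∃[ i ] lookup c i ≡ true
  test-nonempty c tc with test-elim c tc
  ... | inj₁ (c∈ , _)       = block-nonempty p c∈
  ... | inj₂ (i , _ , refl) = i , ⁅⁆-self i

  open FromTest test test-nonempty test-disjoint test-cover public

common⁺ : (p q : Partition n) {b : Subset n} → b ∈ blocks p → b ∈ blocks q → b ∈ (p ∩ᵖ q)
common⁺ p q b∈p b∈q = ∈-filter⁺ (_∈? blocks q) b∈p b∈q

common⁻ : (p q : Partition n) {b : Subset n} → b ∈ (p ∩ᵖ q) → b ∈ blocks p × b ∈ blocks q
common⁻ p q = ∈-filter⁻ (_∈? blocks q) {xs = blocks p}

common-unique : (p q : Partition n) → Unique (p ∩ᵖ q)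
common-unique p q = AllPairs.filter⁺ (_∈? blocks q) (blocks-unique p)

unique-length≤ : {A : Set} {xs ys : List A} → Unique xs → (∀ {x} → x ∈ xs → x ∈ ys) → length xs ≤ length ys
unique-length≤ {A} = unique-⊆⇒length≤ (setoid A)

common-inject : (φ : Subset n → Subset n) (p q p′ q′ : Partition n) →
  (∀ {b} → b ∈ blocks p → b ∈ blocks q → φ b ∈ blocks p′ × φ b ∈ blocks q′) →
  (∀ {b c} → b ∈ blocks p → c ∈ blocks p → φ b ≡ φ c → b ≡ c) →
  length (p ∩ᵖ q) ≤ length (p′ ∩ᵖ q′)
common-inject φ p q p′ q′ into inj = subst (_≤ length (p′ ∩ᵖ q′)) (length-map φ (p ∩ᵖ q))
  (unique-length≤
    (AllPairs.map⁺ (AllPairs-∈ (λ b∈ c∈ b≢c eq → b≢c (inj (proj₁ (common⁻ p q b∈)) (proj₁ (common⁻ p q c∈)) eq)) (common-unique p q)))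
    λ x∈ → let (b , b∈ , eq) = ∈-map⁻ φ x∈ ; (b∈p , b∈q) = common⁻ p q b∈ ; (l , r) = into b∈p b∈q in
      subst (_∈ (p′ ∩ᵖ q′)) (sym eq) (common⁺ p′ q′ l r))

elements : Subset n → List (Fin n)
elements []          = []
elements (true ∷ S)  = zero ∷ map suc (elements S)
elements (false ∷ S) = map suc (elements S)

length-elements : (S : Subset n) → length (elements S) ≡ ∣ S ∣
length-elements []          = refl
length-elements (true ∷ S)  = cong suc (trans (length-map suc (elements S)) (length-elements S))
length-elements (false ∷ S) = trans (length-map suc (elements S)) (length-elements S)

∈-elements⁺ : (S : Subset n) {i : Fin n} → lookup S i ≡ true → i ∈ elements S
∈-elements⁺ (true ∷ S)  {zero}  h = here refl
∈-elements⁺ (true ∷ S)  {suc i} h = there (∈-map⁺ suc (∈-elements⁺ S h))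
∈-elements⁺ (false ∷ S) {suc i} h = ∈-map⁺ suc (∈-elements⁺ S h)

∈-elements⁻ : (S : Subset n) {i : Fin n} → i ∈ elements S → lookup S i ≡ true
∈-elements⁻ (true ∷ S)  (here refl) = refl
∈-elements⁻ (true ∷ S)  (there i∈) with ∈-map⁻ suc i∈
... | j , j∈ , refl = ∈-elements⁻ S j∈
∈-elements⁻ (false ∷ S) i∈ with ∈-map⁻ suc i∈
... | j , j∈ , refl = ∈-elements⁻ S j∈

elements-unique : (S : Subset n) → Unique (elements S)
elements-unique []          = []
elements-unique (true ∷ S)  = All.map⁺ (All.tabulate λ _ ()) ∷ AllPairs.map⁺ (AllPairs.map (λ i≢j eq → i≢j (Fin.suc-injective eq)) (elements-unique S))
elements-unique (false ∷ S) = AllPairs.map⁺ (AllPairs.map (λ i≢j eq → i≢j (Fin.suc-injective eq)) (elements-unique S))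

lookup-∩ : (A B : Subset n) (i : Fin n) → lookup (A ∩ B) i ≡ lookup A i ∧ lookup B i
lookup-∩ A B i = Vec.lookup-zipWith _∧_ i A B

length-singletons : (S : Subset n) → length (map ⁅_⁆ (elements S)) ≡ ∣ S ∣
length-singletons S = trans (length-map ⁅_⁆ (elements S)) (length-elements S)

fixed≤common : (p q : Partition n) → ∣ fixed p ∩ fixed q ∣ ≤ length (p ∩ᵖ q)
fixed≤common p q = subst (_≤ length (p ∩ᵖ q)) (length-singletons (fixed p ∩ fixed q))
  (unique-length≤ (AllPairs.map⁺ (AllPairs.map (λ i≢j eq → i≢j (⁅⁆-injective eq)) (elements-unique (fixed p ∩ fixed q)))) λ x∈ →
    let (i , i∈ , eq) = ∈-map⁻ ⁅_⁆ x∈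
        (ip , iq) = ∧-split {lookup (fixed p) i} (trans (sym (lookup-∩ (fixed p) (fixed q) i)) (∈-elements⁻ (fixed p ∩ fixed q) i∈)) in
    subst (_∈ (p ∩ᵖ q)) (sym eq) (common⁺ p q (true-fixed p ip) (true-fixed q iq)))

IsSingleton : Subset n → Set
IsSingleton b = ∃[ i ] b ≡ ⁅ i ⁆

isSingleton? : Decidable (IsSingleton {n})
isSingleton? b = Fin.any? λ i → b ≟ˢ ⁅ i ⁆

common≤fixed : (p q : Partition n) → (∀ {b} → b ∈ blocks p → b ∈ blocks q → IsSingleton b) →
               length (p ∩ᵖ q) ≤ ∣ fixed p ∩ fixed q ∣
common≤fixed p q single = subst (length (p ∩ᵖ q) ≤_) (length-singletons (fixed p ∩ fixed q))
  (unique-length≤ (common-unique p q) λ {b} b∈ → go b∈ (common⁻ p q b∈))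
  where
  go : ∀ {b} → b ∈ (p ∩ᵖ q) → b ∈ blocks p × b ∈ blocks q → b ∈ map ⁅_⁆ (elements (fixed p ∩ fixed q))
  go b∈ (b∈p , b∈q) with single b∈p b∈q
  ... | i , refl = ∈-map⁺ ⁅_⁆ (∈-elements⁺ (fixed p ∩ fixed q) (trans (lookup-∩ (fixed p) (fixed q) i) (∧-intro (fixed-true p b∈p) (fixed-true q b∈q))))

-- Compression: a family closed under breaking blocks

infix 4 _∈ˢ_ _∈ˢ?_
_∈ˢ_ : Partition n → List (Partition n) → Set
p ∈ˢ 𝒜 = Any (p ≈_) 𝒜

_∈ˢ?_ : (p : Partition n) (𝒜 : List (Partition n)) → Dec (p ∈ˢ 𝒜)
_∈ˢ?_ {n} p 𝒜 = Any.any? (λ q → DecSetoid._≟_ (Partition-decSetoid n) p q) 𝒜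

≈-sym : (p q : Partition n) → p ≈ q → q ≈ p
≈-sym _ _ (f , g) = g , f

≈-trans : (p q r : Partition n) → p ≈ q → q ≈ r → p ≈ r
≈-trans _ _ _ (f , g) (f′ , g′) = f′ ∘ f , g ∘ g′

opaque

  break : (b : Subset n) (p : Partition n) → Partition n
  break b p with b ∈? blocks p
  ... | yes b∈p = Break.partition b p b∈p
  ... | no  _   = p

module _ (b : Subset n) (p : Partition n) (b∈p : b ∈ blocks p) where

  opaque
    unfolding break

    break-elim : ∀ {c} → c ∈ blocks (break b p) → (c ∈ blocks p × c ≢ b) ⊎ (∃[ i ] lookup b i ≡ true × c ≡ ⁅ i ⁆)
    break-elim {c} c∈ with b ∈? blocks p
    ... | yes b∈ = Break.test-elim b p b∈ c (Break.∈⇒test b p b∈ c∈)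
    ... | no b∉  = ⊥-elim (b∉ b∈p)

    break-keep : ∀ {c} → c ∈ blocks p → c ≢ b → c ∈ blocks (break b p)
    break-keep c∈ c≢b with b ∈? blocks p
    ... | yes b∈ = Break.test⇒∈ b p b∈ (Break.keep b p b∈ c∈ c≢b)
    ... | no b∉  = ⊥-elim (b∉ b∈p)

    break-single : ∀ {i} → lookup b i ≡ true → ⁅ i ⁆ ∈ blocks (break b p)
    break-single bi with b ∈? blocks p
    ... | yes b∈ = Break.test⇒∈ b p b∈ (Break.single b p b∈ bi)
    ... | no b∉  = ⊥-elim (b∉ b∈p)

  break-fixed : fixed p ⊑ fixed (break b p)
  break-fixed i h with ⁅ i ⁆ ≟ˢ b
  ... | yes refl = fixed-true (break b p) (break-single (⁅⁆-self i))
  ... | no ≢b    = fixed-true (break b p) (break-keep (true-fixed p h) ≢b)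

  break-fixed-< : ¬ (break b p ≈ p) → sz (fixed p) < sz (fixed (break b p))
  break-fixed-< ≉ with block-nonempty p b∈p
  ... | i , bi with lookup (fixed p) i in fi
  ...   | false = sz-mono-< {A = fixed p} {fixed (break b p)} break-fixed i fi (fixed-true (break b p) (break-single bi))
  ...   | true  = ⊥-elim (≉ (fwd , bwd))
    where
    b≡ : b ≡ ⁅ i ⁆
    b≡ = block-unique p b∈p (true-fixed p fi) bi (⁅⁆-self i)
    fwd : ∀ {c} → c ∈ blocks (break b p) → c ∈ blocks p
    fwd c∈ with break-elim c∈
    ... | inj₁ (c∈p , _) = c∈p
    ... | inj₂ (j , bj , refl) rewrite ⁅⁆-elim {i = i} {j} (subst (λ b → lookup b j ≡ true) b≡ bj) = true-fixed p fi
    bwd : ∀ {c} → c ∈ blocks p → c ∈ blocks (break b p)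
    bwd {c} c∈ with c ≟ˢ b
    ... | yes refl = subst (_∈ blocks (break b p)) (sym b≡) (break-single bi)
    ... | no c≢b   = break-keep c∈ c≢b

break-injective : (b : Subset n) (p q : Partition n) → b ∈ blocks p → b ∈ blocks q →
  (∀ {c} → c ∈ blocks (break b p) → c ∈ blocks (break b q)) → ∀ {c} → c ∈ blocks p → c ∈ blocks q
break-injective b p q b∈p b∈q sub {c} c∈ with c ≟ˢ b
... | yes refl = b∈q
... | no c≢b with break-elim b q b∈q (sub (break-keep b p b∈p c∈ c≢b))
...   | inj₁ (c∈q , _)      = c∈q
...   | inj₂ (i , bi , refl) = ⊥-elim (c≢b (block-unique p c∈ b∈p (⁅⁆-self i) bi))

total : List (Partition n) → ℕ
total []      = 0
total (p ∷ 𝒜) = sz (fixed p) + total 𝒜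

total≤ : (𝒜 : List (Partition n)) → total 𝒜 ≤ length 𝒜 * n
total≤ []      = z≤n
total≤ (p ∷ 𝒜) = +-mono-≤ (sz≤n (fixed p)) (total≤ 𝒜)

module Compress (t : ℕ) (𝒜 : List (Partition n)) (𝒜! : UniqueFamily 𝒜) (𝒜-int : Intersecting t 𝒜) (b : Subset n) where

  Moved : Partition n → Set
  Moved p = b ∈ blocks p × ¬ (break b p ∈ˢ 𝒜)

  moved? : Decidable Moved
  moved? p = (b ∈? blocks p) ×-dec ¬? (break b p ∈ˢ? 𝒜)

  -- Keeping p when the broken partition is already present makes the map injective on 𝒜.
  op : Partition n → Partition n
  op p with moved? p
  ... | yes _ = break b p
  ... | no  _ = p

  op-moved : ∀ p → Moved p → op p ≡ break b p
  op-moved p m with moved? p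
  ... | yes _ = refl
  ... | no ¬m = ⊥-elim (¬m m)

  meet : ∀ {p q} → p ∈ 𝒜 → q ∈ 𝒜 → t ≤ length (p ∩ᵖ q)
  meet p∈ q∈ = All.lookup (All.lookup 𝒜-int p∈) q∈

  meetˢ : ∀ {p} q → p ∈ 𝒜 → q ∈ˢ 𝒜 → t ≤ length (p ∩ᵖ q)
  meetˢ {p} q p∈ q∈ with find q∈
  ... | q′ , q′∈ , q≈q′ = ≤-trans (meet p∈ q′∈) (∩ᵖ-mono {p = p} {p} {q′} {q} (id , id) (≈-sym q q′ q≈q′))

  ∩-comm : (p q : Partition n) → length (p ∩ᵖ q) ≤ length (q ∩ᵖ p)
  ∩-comm p q = common-inject id p q q p (λ l r → r , l) (λ _ _ eq → eq)

  -- If q keeps its block b, then `break b q` is also in 𝒜 and shares t blocks with p. A shared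
  -- singleton taken from b equals b, as p contains the block b; so these blocks are still common to
  -- `break b p` and q.
  moved-kept : ∀ p q → p ∈ 𝒜 → q ∈ 𝒜 → Moved p → ¬ Moved q → t ≤ length (break b p ∩ᵖ q)
  moved-kept p q p∈ q∈ (b∈p , _) ¬m with b ∈? blocks q
  ... | no b∉q = ≤-trans (meet p∈ q∈) (common-inject id p q (break b p) q
    (λ {c} c∈p c∈q → break-keep b p b∈p c∈p (λ { refl → b∉q c∈q }) , c∈q) (λ _ _ eq → eq))
  ... | yes b∈q = ≤-trans (meetˢ (break b q) p∈ broken∈) (common-inject id p (break b q) (break b p) q into (λ _ _ eq → eq))
    where
    broken∈ : break b q ∈ˢ 𝒜
    broken∈ with break b q ∈ˢ? 𝒜
    ... | yes h = h
    ... | no ¬h = ⊥-elim (¬m (b∈q , ¬h))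
    into : ∀ {c} → c ∈ blocks p → c ∈ blocks (break b q) → c ∈ blocks (break b p) × c ∈ blocks q
    into c∈p c∈q′ with break-elim b q b∈q c∈q′
    ... | inj₁ (c∈q , c≢b) = break-keep b p b∈p c∈p c≢b , c∈q
    ... | inj₂ (i , bi , refl) = break-single b p b∈p bi
      , subst (_∈ blocks q) (block-unique p b∈p c∈p bi (⁅⁆-self i)) b∈q

  -- The lost common block b is made up for by one of its singletons.
  moved-moved : ∀ p q → p ∈ 𝒜 → q ∈ 𝒜 → Moved p → Moved q → t ≤ length (break b p ∩ᵖ break b q)
  moved-moved p q p∈ q∈ (b∈p , _) (b∈q , _) with block-nonempty p b∈p
  ... | i , bi = ≤-trans (meet p∈ q∈) (common-inject φ p q (break b p) (break b q) into inj)
    where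
    φ : Subset n → Subset n
    φ c with c ≟ˢ b
    ... | yes _ = ⁅ i ⁆
    ... | no  _ = c
    into : ∀ {c} → c ∈ blocks p → c ∈ blocks q → φ c ∈ blocks (break b p) × φ c ∈ blocks (break b q)
    into {c} c∈p c∈q with c ≟ˢ b
    ... | yes _   = break-single b p b∈p bi , break-single b q b∈q bi
    ... | no  c≢b = break-keep b p b∈p c∈p c≢b , break-keep b q b∈q c∈q c≢b
    inj : ∀ {c d} → c ∈ blocks p → d ∈ blocks p → φ c ≡ φ d → c ≡ d
    inj {c} {d} c∈ d∈ eq with c ≟ˢ b | d ≟ˢ b
    ... | yes refl | yes refl = refl
    ... | no  _    | no  _    = eq
    ... | yes refl | no  d≢b  = ⊥-elim (d≢b (block-unique p d∈ b∈p (subst (λ e → lookup e i ≡ true) eq (⁅⁆-self i)) bi))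
    ... | no  c≢b  | yes refl = ⊥-elim (c≢b (block-unique p c∈ b∈p (subst (λ e → lookup e i ≡ true) (sym eq) (⁅⁆-self i)) bi))

  op-int : ∀ p q → p ∈ 𝒜 → q ∈ 𝒜 → t ≤ length (op p ∩ᵖ op q)
  op-int p q p∈ q∈ with moved? p | moved? q
  ... | yes m | yes m′ = moved-moved p q p∈ q∈ m m′
  ... | yes m | no ¬m′ = moved-kept p q p∈ q∈ m ¬m′
  ... | no ¬m | yes m′ = ≤-trans (moved-kept q p q∈ p∈ m′ ¬m) (∩-comm (break b q) p)
  ... | no _  | no _   = meet p∈ q∈

  op-injective : ∀ p q → p ∈ 𝒜 → q ∈ 𝒜 → op p ≈ op q → p ≈ q
  op-injective p q p∈ q∈ eq with moved? p | moved? q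
  ... | no _ | no _ = eq
  ... | yes (b∈p , _) | yes (b∈q , _) = break-injective b p q b∈p b∈q (proj₁ eq) , break-injective b q p b∈q b∈p (proj₂ eq)
  ... | yes (_ , ∉) | no _ = ⊥-elim (∉ (lose q∈ eq))
  ... | no _ | yes (_ , ∉) = ⊥-elim (∉ (lose p∈ (≈-sym p (break b q) eq)))

  𝒜′ : List (Partition n)
  𝒜′ = map op 𝒜

  𝒜′! : UniqueFamily 𝒜′
  𝒜′! = AllPairs.map⁺ (AllPairs-∈ (λ {p} {q} p∈ q∈ p≉q eq → p≉q (op-injective p q p∈ q∈ eq)) 𝒜!)

  𝒜′-int : Intersecting t 𝒜′
  𝒜′-int = All.map⁺ (All.tabulate λ {p} p∈ → All.map⁺ (All.tabulate λ {q} q∈ → op-int p q p∈ q∈))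

  op-fixed : ∀ p → sz (fixed p) ≤ sz (fixed (op p))
  op-fixed p with moved? p
  ... | yes (b∈p , _) = sz-mono {A = fixed p} {fixed (break b p)} (break-fixed b p b∈p)
  ... | no _          = ≤-refl

  total-< : ∀ ps → (∀ {p} → p ∈ ps → p ∈ 𝒜) → ∀ {p} → p ∈ ps → Moved p → total ps < total (map op ps)
  total-< (p ∷ ps) sub (here refl) m rewrite op-moved p m =
    +-mono-<-≤ (break-fixed-< b p (proj₁ m) (λ eq → proj₂ m (lose (sub (here refl)) eq))) (rest ps)
    where
    rest : ∀ ps → total ps ≤ total (map op ps)
    rest []       = z≤n
    rest (p ∷ ps) = +-mono-≤ (op-fixed p) (rest ps)
  total-< (p ∷ ps) sub (there p∈) m = +-mono-≤-< (op-fixed p) (total-< ps (sub ∘ there) p∈ m)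

Stable : List (Partition n) → Set
Stable 𝒜 = ∀ {p b} → p ∈ 𝒜 → b ∈ blocks p → break b p ∈ˢ 𝒜

-- Each effective round raises the total number of fixed points, which is at most n for each member.
compress : ∀ t (𝒜 : List (Partition n)) → UniqueFamily 𝒜 → Intersecting t 𝒜 →
  ∃[ ℬ ] UniqueFamily ℬ × Intersecting t ℬ × length ℬ ≡ length 𝒜 × Stable ℬ
compress {n} t 𝒜 𝒜! 𝒜-int = go 𝒜 𝒜! 𝒜-int (<-wellFounded _)
  where
  go : ∀ 𝒜 → UniqueFamily 𝒜 → Intersecting t 𝒜 → Acc _<_ (length 𝒜 * n ∸ total 𝒜) →
       ∃[ ℬ ] UniqueFamily ℬ × Intersecting t ℬ × length ℬ ≡ length 𝒜 × Stable ℬ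
  go 𝒜 𝒜! 𝒜-int (acc rec) with Any.any? (λ p → Any.any? (λ b → ¬? (break b p ∈ˢ? 𝒜)) (blocks p)) 𝒜
  ... | no stable = 𝒜 , 𝒜! , 𝒜-int , refl , λ {p} {b} p∈ b∈ → decided p b p∈ b∈ (break b p ∈ˢ? 𝒜)
    where
    decided : ∀ p b → p ∈ 𝒜 → b ∈ blocks p → Dec (break b p ∈ˢ 𝒜) → break b p ∈ˢ 𝒜
    decided p b p∈ b∈ (yes h) = h
    decided p b p∈ b∈ (no ¬h) = ⊥-elim (stable (lose p∈ (lose b∈ ¬h)))
  ... | yes unstable with find unstable
  ...   | p , p∈ , h with find h
  ...     | b , b∈ , ¬h = let (ℬ , ℬ! , ℬ-int , len , st) = go 𝒜′ 𝒜′! 𝒜′-int (rec smaller) in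
      ℬ , ℬ! , ℬ-int , trans len (length-map op 𝒜) , st
    where
    open Compress t 𝒜 𝒜! 𝒜-int b
    smaller : length 𝒜′ * n ∸ total 𝒜′ < length 𝒜 * n ∸ total 𝒜
    smaller rewrite length-map op 𝒜 = ∸-monoʳ-< (total-< 𝒜 id p∈ (b∈ , ¬h))
      (subst (λ l → total 𝒜′ ≤ l * n) (length-map op 𝒜) (total≤ 𝒜′))

-- In a stable family the common non-singleton blocks can be broken one after the other.
stable-fixed : ∀ t (𝒜 : List (Partition n)) → Intersecting t 𝒜 → Stable 𝒜 →
  ∀ {p q} → p ∈ 𝒜 → q ∈ 𝒜 → t ≤ ∣ fixed p ∩ fixed q ∣
stable-fixed {n} t 𝒜 int stable {p} p∈ q∈ = go _ (<-wellFounded _) q∈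
  where
  go : ∀ q → Acc _<_ (length (p ∩ᵖ q)) → q ∈ 𝒜 → t ≤ ∣ fixed p ∩ fixed q ∣
  go q (acc rec) q∈ with Any.any? (λ b → ¬? (isSingleton? b)) (p ∩ᵖ q)
  ... | no all-single = ≤-trans (All.lookup (All.lookup int p∈) q∈) (common≤fixed p q λ {b} b∈p b∈q → decided b b∈p b∈q (isSingleton? b))
    where
    decided : ∀ b → b ∈ blocks p → b ∈ blocks q → Dec (IsSingleton b) → IsSingleton b
    decided b b∈p b∈q (yes h) = h
    decided b b∈p b∈q (no ¬h) = ⊥-elim (all-single (lose (common⁺ p q b∈p b∈q) ¬h))
  ... | yes some with find some
  ...   | b , b∈ , ¬single with common⁻ p q b∈
  ...     | b∈p , b∈q with find (stable q∈ b∈q)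
  ...       | q′ , q′∈ , ≈q′ = ≤-trans (go q′ (rec fewer) q′∈) (Subset.p⊆q⇒∣p∣≤∣q∣ fixed⊆)
    where
    common⇒ : ∀ {c} → c ∈ blocks p → c ∈ blocks q′ → c ∈ blocks q × c ≢ b
    common⇒ c∈p c∈q′ with break-elim b q b∈q (proj₂ ≈q′ c∈q′)
    ... | inj₁ r = r
    ... | inj₂ (i , bi , refl) = ⊥-elim (¬single (i , block-unique p b∈p c∈p bi (⁅⁆-self i)))
    fewer : length (p ∩ᵖ q′) < length (p ∩ᵖ q)
    fewer = unique-length≤ {xs = b ∷ (p ∩ᵖ q′)}
      (All.tabulate (λ {c} c∈ b≡c → proj₂ (common⇒ (proj₁ (common⁻ p q′ c∈)) (proj₂ (common⁻ p q′ c∈))) (sym b≡c)) ∷ common-unique p q′)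
      λ { (here refl) → b∈ ; (there c∈) → let (l , r) = common⁻ p q′ c∈ in common⁺ p q l (proj₁ (common⇒ l r)) }
    fixed⊆ : (fixed p ∩ fixed q′) Subset.⊆ (fixed p ∩ fixed q)
    fixed⊆ {i} i∈ = let (ip , iq′) = Subset.x∈p∩q⁻ (fixed p) (fixed q′) i∈
                        s∈p = true-fixed p ([]=⇒lookup ip) in
      Subset.x∈p∩q⁺ (ip , lookup⇒[]= i (fixed q) (fixed-true q (proj₁ (common⇒ s∈p (true-fixed q′ ([]=⇒lookup iq′))))))

-- Counting partitions by their fixed points

length-filter-∷ : {A : Set} {P : A → Set} (P? : Decidable P) (x : A) (xs : List A) →
                  length (filter P? (x ∷ xs)) ≡ ⟦ does (P? x) ⟧ + length (filter P? xs)
length-filter-∷ P? x xs with does (P? x)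
... | true  = refl
... | false = refl

count : Subset n → List (Partition n) → ℕ
count S xs = length (filter (λ p → fixed p ≟ˢ S) xs)

does-≟ˢ : (A S : Subset n) → does (A ≟ˢ S) ≡ S == A
does-≟ˢ A S = go (A ≟ˢ S)
  where
  go : (d : Dec (A ≡ S)) → does d ≡ S == A
  go (yes refl) = sym (==-refl A)
  go (no A≢S)   = sym (≢true λ h → A≢S (sym (==-sound S A h)))

fibers : {Q : Partition n → Set} (Q? : Decidable Q) (Qᵇ : Subset n → Bool) → (∀ p → does (Q? p) ≡ Qᵇ (fixed p)) →
  ∀ xs → length (filter Q? xs) ≡ Σˢ (λ S → ⟦ Qᵇ S ⟧ * count S xs)
fibers Q? Qᵇ h [] = sym (Σˢ-0 λ S → *-zeroʳ ⟦ Qᵇ S ⟧)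
fibers Q? Qᵇ h (p ∷ xs) = begin
  length (filter Q? (p ∷ xs)) ≡⟨ length-filter-∷ Q? p xs ⟩
  ⟦ does (Q? p) ⟧ + length (filter Q? xs) ≡⟨ cong₂ (λ b l → ⟦ b ⟧ + l) (h p) (fibers Q? Qᵇ h xs) ⟩
  ⟦ Qᵇ (fixed p) ⟧ + Σˢ (λ S → ⟦ Qᵇ S ⟧ * count S xs) ≡⟨ cong (_+ Σˢ (λ S → ⟦ Qᵇ S ⟧ * count S xs)) (Σˢ-select (λ S → ⟦ Qᵇ S ⟧) (fixed p)) ⟨
  Σˢ (λ S → ⟦ S == fixed p ⟧ * ⟦ Qᵇ S ⟧) + Σˢ (λ S → ⟦ Qᵇ S ⟧ * count S xs) ≡⟨ Σˢ-+ (λ S → ⟦ S == fixed p ⟧ * ⟦ Qᵇ S ⟧) (λ S → ⟦ Qᵇ S ⟧ * count S xs) ⟨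
  Σˢ (λ S → ⟦ S == fixed p ⟧ * ⟦ Qᵇ S ⟧ + ⟦ Qᵇ S ⟧ * count S xs) ≡⟨ Σˢ-cong per ⟩
  Σˢ (λ S → ⟦ Qᵇ S ⟧ * count S (p ∷ xs)) ∎
  where
  open ≡-Reasoning
  per : ∀ S → ⟦ S == fixed p ⟧ * ⟦ Qᵇ S ⟧ + ⟦ Qᵇ S ⟧ * count S xs ≡ ⟦ Qᵇ S ⟧ * count S (p ∷ xs)
  per S = trans (cong (_+ ⟦ Qᵇ S ⟧ * count S xs) (*-comm ⟦ S == fixed p ⟧ ⟦ Qᵇ S ⟧))
    (trans (sym (*-distribˡ-+ ⟦ Qᵇ S ⟧ ⟦ S == fixed p ⟧ (count S xs)))
      (cong (⟦ Qᵇ S ⟧ *_) (sym (trans (length-filter-∷ (λ p → fixed p ≟ˢ S) p xs) (cong (λ b → ⟦ b ⟧ + count S xs) (does-≟ˢ (fixed p) S))))))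

d : Subset n → ℕ
d {n} S = count S (partitions n)

filter-injection : ∀ {m} {P : Partition m → Set} (P? : Decidable P) {Q : Partition n → Set} (Q? : Decidable Q)
  (φ : Partition m → Partition n) → (∀ p → P p → Q (φ p)) → (∀ p q → P p → P q → φ p ≈ φ q → p ≈ q) →
  (∀ p q → p ≈ q → Q p → Q q) → length (filter P? (partitions m)) ≤ length (filter Q? (partitions n))
filter-injection {n} {m} P? Q? φ PQ inj Q-resp = subst (_≤ length (filter Q? (partitions n))) (length-map φ (filter P? (partitions m)))
  (unique-⊆⇒length≤ (Partition-setoid n) {map φ (filter P? (partitions m))} {filter Q? (partitions n)}
    (AllPairs.map⁺ (AllPairs-∈ (λ {p} {q} p∈ q∈ p≉q eq → p≉q (inj p q (P-of p∈) (P-of q∈) eq))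
      (AllPairs.filter⁺ P? (partitions-unique m))))
    λ {q} q∈ → into q q∈)
  where
  P-of : ∀ {p} → p ∈ filter P? (partitions m) → _
  P-of p∈ = proj₂ (∈-filter⁻ P? {xs = partitions m} p∈)
  into : ∀ q → q ∈ˢ map φ (filter P? (partitions m)) → q ∈ˢ filter Q? (partitions n)
  into q q∈ with find q∈
  ... | r , r∈ , q≈r with ∈-map⁻ φ r∈
  ...   | p , p∈ , refl = SetoidMembershipₚ.∈-filter⁺ (Partition-setoid n) Q? (λ {x} {y} → Q-resp x y) {q}
    (partitions-complete q) (Q-resp (φ p) q (≈-sym q (φ p) q≈r) (PQ p (P-of p∈)))

fixed-resp : (G : Subset n → Set) (p q : Partition n) → p ≈ q → G (fixed p) → G (fixed q)
fixed-resp G p q eq = subst G (fixed-cong p q eq)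

-- Partitions of n + 1 points correspond to partitions of n points with a
-- distinguished set T of fixed points: the block of the new point zero is
-- {zero} ∪ T.

module Gather {n : ℕ} (S : Subset n) (p : Partition n) where

  T : Subset n
  T = fixed p ∖ S

  T-elim : ∀ {i} → lookup T i ≡ true → lookup (fixed p) i ≡ true × lookup S i ≡ false
  T-elim {i} h with ∧-split {lookup (fixed p) i} (trans (sym (lookup-∖ (fixed p) S i)) h)
  ... | f , s = f , not-true s

  T-intro : ∀ {i} → lookup (fixed p) i ≡ true → lookup S i ≡ false → lookup T i ≡ true
  T-intro {i} f s = trans (lookup-∖ (fixed p) S i) (∧-intro f (not-false s))

  test : Subset (suc n) → Bool
  test (true ∷ c)  = c == T
  test (false ∷ c) = memᵇ c p ∧ not (singleᵇ T c)

  old : ∀ c → test (false ∷ c) ≡ true → c ∈ blocks p × singleᵇ T c ≡ false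
  old c h with ∧-split {memᵇ c p} h
  ... | m , s = memᵇ-true c p m , not-true s

  in-T : ∀ c i → c ∈ blocks p → lookup T i ≡ true → lookup c i ≡ true → singleᵇ T c ≡ true
  in-T c i c∈ Ti ci = subst (λ c → singleᵇ T c ≡ true) (block-unique p (true-fixed p (proj₁ (T-elim Ti))) c∈ (⁅⁆-self i) ci) (singleᵇ-intro T Ti)

  disjoint : ∀ b c i → test b ≡ true → test c ≡ true → lookup b i ≡ true → lookup c i ≡ true → b ≡ c
  disjoint (true ∷ b) (true ∷ c) i tb tc _ _ = cong (true ∷_) (trans (==-sound b T tb) (sym (==-sound c T tc)))
  disjoint (true ∷ b) (false ∷ c) (suc i) tb tc bi ci with old c tc
  ... | c∈ , s = ⊥-elim (true≢false (in-T c i c∈ (subst (λ b → lookup b i ≡ true) (==-sound b T tb) bi) ci) s)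
  disjoint (false ∷ b) (true ∷ c) (suc i) tb tc bi ci with old b tb
  ... | b∈ , s = ⊥-elim (true≢false (in-T b i b∈ (subst (λ c → lookup c i ≡ true) (==-sound c T tc) ci) bi) s)
  disjoint (false ∷ b) (false ∷ c) (suc i) tb tc bi ci = cong (false ∷_) (block-unique p (proj₁ (old b tb)) (proj₁ (old c tc)) bi ci)
  disjoint (false ∷ b) c zero tb tc () ci
  disjoint (true ∷ b) (false ∷ c) zero tb tc bi ()

  cover : ∀ i → ∃[ b ] test b ≡ true × lookup b i ≡ true
  cover zero = true ∷ T , ==-refl T , refl
  cover (suc i) with block-of p i
  ... | c , c∈ , ci with singleᵇ T c in s
  ...   | false = false ∷ c , ∧-intro (true-memᵇ c p c∈) (not-false s) , ci
  ...   | true with singleᵇ-elim T c s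
  ...     | j , Tj , refl = true ∷ T , ==-refl T , subst (λ k → lookup T k ≡ true) (sym (⁅⁆-elim {i = j} {i} ci)) Tj

  nonempty : ∀ b → test b ≡ true → ∃[ i ] lookup b i ≡ true
  nonempty (true ∷ b)  tb = zero , refl
  nonempty (false ∷ b) tb with block-nonempty p (proj₁ (old b tb))
  ... | i , bi = suc i , bi

  open FromTest test nonempty disjoint cover public renaming (partition to gathered)

  gathered-fixed-tail : ∀ i → lookup (fixed gathered) (suc i) ≡ lookup (fixed p) i ∧ lookup S i
  gathered-fixed-tail i = Bool-ext to back
    where
    to : lookup (fixed gathered) (suc i) ≡ true → lookup (fixed p) i ∧ lookup S i ≡ true
    to h with old ⁅ i ⁆ (∈⇒test {outside ∷ ⁅ i ⁆} (true-fixed gathered {suc i} h))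
    ... | i∈ , s = ∧-intro (fixed-true p i∈) (Si (lookup S i) refl)
      where
      Si : ∀ b → lookup S i ≡ b → b ≡ true
      Si true  _ = refl
      Si false e = ⊥-elim (true≢false (singleᵇ-intro T (T-intro (fixed-true p i∈) e)) s)
    back : lookup (fixed p) i ∧ lookup S i ≡ true → lookup (fixed gathered) (suc i) ≡ true
    back h with ∧-split {lookup (fixed p) i} h
    ... | fi , Si = fixed-true gathered {suc i} (test⇒∈ {outside ∷ ⁅ i ⁆} (∧-intro (true-memᵇ ⁅ i ⁆ p (true-fixed p fi)) (not-false (≢true single))))
      where
      single : singleᵇ T ⁅ i ⁆ ≡ true → ⊥
      single s with singleᵇ-elim T ⁅ i ⁆ s
      ... | j , Tj , eq = true≢false Si (trans (cong (lookup S) (⁅⁆-injective eq)) (proj₂ (T-elim Tj)))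

gather : Subset n → Partition n → Partition (suc n)
gather S p = Gather.gathered S p

gather-fixed : (S : Subset n) (p : Partition n) → S ⊑ fixed p → ∀ i → lookup (fixed (gather S p)) (suc i) ≡ lookup S i
gather-fixed S p S⊑ i = trans (Gather.gathered-fixed-tail S p i) (Bool-ext (λ h → proj₂ (∧-split {lookup (fixed p) i} h)) (λ h → ∧-intro (S⊑ i h) h))

gather-fixed-zero : (S : Subset n) (p : Partition n) → fixed p ≡ S → lookup (fixed (gather S p)) zero ≡ true
gather-fixed-zero S p refl = fixed-true (gather S p) {zero} (Gather.test⇒∈ S p {inside ∷ Subset.⊥} (subst (λ b → b == Gather.T S p ≡ true) T≡ (==-refl (Gather.T S p))))
  where
  T≡ : Gather.T S p ≡ Subset.⊥
  T≡ = vec-ext λ e → trans (≢true λ h → let (a , b) = Gather.T-elim S p h in true≢false a b) (sym (Vec.lookup-replicate e false))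

gather-injective : (S : Subset n) (p q : Partition n) → gather S p ≈ gather S q → ∀ {c} → c ∈ blocks p → c ∈ blocks q
gather-injective S p q (sub , _) {c} c∈ with singleᵇ (Gather.T S p) c in s
... | false = proj₁ (Gather.old S q c (Gather.∈⇒test S q {outside ∷ c} (sub (Gather.test⇒∈ S p {outside ∷ c} (∧-intro (true-memᵇ c p c∈) (not-false s))))))
... | true with singleᵇ-elim (Gather.T S p) c s
...   | i , Ti , refl = true-fixed q (proj₁ (Gather.T-elim S q (subst (λ T → lookup T i ≡ true)
  (==-sound (Gather.T S p) (Gather.T S q) (Gather.∈⇒test S q {true ∷ Gather.T S p} (sub {true ∷ Gather.T S p} (Gather.test⇒∈ S p {true ∷ Gather.T S p} (==-refl (Gather.T S p)))))) Ti)))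

-- The reverse of `Gather`: the block of zero loses zero and falls into singletons.
module Dissolve {n : ℕ} (p : Partition (suc n)) where

  zero-block : ∃[ T ] (true ∷ T) ∈ blocks p
  zero-block with block-of p zero
  ... | (true ∷ T) , b∈ , _ = T , b∈

  T : Subset n
  T = proj₁ zero-block

  T∈ : (true ∷ T) ∈ blocks p
  T∈ = proj₂ zero-block

  T-unique : ∀ {c} → (true ∷ c) ∈ blocks p → c ≡ T
  T-unique c∈ = Vec.∷-injectiveʳ (block-unique p {i = zero} c∈ T∈ refl refl)

  T-disjoint : ∀ {c i} → (false ∷ c) ∈ blocks p → lookup c i ≡ true → lookup T i ≡ false
  T-disjoint {c} {i} c∈ ci = ≢true λ Ti → case-⊥ (Vec.∷-injectiveˡ (block-unique p {i = suc i} c∈ T∈ ci Ti))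
    where
    case-⊥ : false ≡ true → ⊥
    case-⊥ ()

  test : Subset n → Bool
  test c = memᵇ (false ∷ c) p ∨ singleᵇ T c

  test-elim : ∀ c → test c ≡ true → (false ∷ c) ∈ blocks p ⊎ (∃[ i ] lookup T i ≡ true × c ≡ ⁅ i ⁆)
  test-elim c h with ∨-split {memᵇ (false ∷ c) p} h
  ... | inj₁ m = inj₁ (memᵇ-true (false ∷ c) p m)
  ... | inj₂ s = inj₂ (singleᵇ-elim T c s)

  keep : ∀ {c} → (false ∷ c) ∈ blocks p → test c ≡ true
  keep {c} c∈ = ∨-introˡ (true-memᵇ (false ∷ c) p c∈)

  single : ∀ {i} → lookup T i ≡ true → test ⁅ i ⁆ ≡ true
  single {i} Ti = ∨-introʳ {memᵇ (false ∷ ⁅ i ⁆) p} (singleᵇ-intro T Ti)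

  disjoint : ∀ b c i → test b ≡ true → test c ≡ true → lookup b i ≡ true → lookup c i ≡ true → b ≡ c
  disjoint b c i tb tc bi ci with test-elim b tb | test-elim c tc
  ... | inj₁ b∈ | inj₁ c∈ = Vec.∷-injectiveʳ (block-unique p {i = suc i} b∈ c∈ bi ci)
  ... | inj₁ b∈ | inj₂ (j , Tj , refl) rewrite ⁅⁆-elim {i = j} {i} ci = ⊥-elim (true≢false Tj (T-disjoint b∈ bi))
  ... | inj₂ (j , Tj , refl) | inj₁ c∈ rewrite ⁅⁆-elim {i = j} {i} bi = ⊥-elim (true≢false Tj (T-disjoint c∈ ci))
  ... | inj₂ (j , _ , refl) | inj₂ (k , _ , refl) rewrite ⁅⁆-elim {i = j} {i} bi | ⁅⁆-elim {i = k} {j} ci = refl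

  cover : ∀ i → ∃[ b ] test b ≡ true × lookup b i ≡ true
  cover i with block-of p (suc i)
  ... | (false ∷ c) , c∈ , ci = c , keep c∈ , ci
  ... | (true ∷ c)  , c∈ , ci = ⁅ i ⁆ , single (subst (λ c → lookup c i ≡ true) (T-unique c∈) ci) , ⁅⁆-self i

  nonempty : ∀ b → test b ≡ true → ∃[ i ] lookup b i ≡ true
  nonempty b tb with test-elim b tb
  ... | inj₂ (i , _ , refl) = i , ⁅⁆-self i
  ... | inj₁ b∈ with block-nonempty p b∈
  ...   | suc i , bi = i , bi

  open FromTest test nonempty disjoint cover public renaming (partition to dissolved)

  fixed-elim : ∀ {i} → lookup (fixed dissolved) i ≡ true → lookup (fixed p) (suc i) ≡ true ⊎ lookup T i ≡ true
  fixed-elim {i} h with test-elim ⁅ i ⁆ (∈⇒test (true-fixed dissolved h))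
  ... | inj₁ i∈ = inj₁ (fixed-true p {suc i} i∈)
  ... | inj₂ (j , Tj , eq) = inj₂ (subst (λ k → lookup T k ≡ true) (sym (⁅⁆-injective eq)) Tj)

  fixed-tail : ∀ {i} → lookup (fixed p) (suc i) ≡ true → lookup (fixed dissolved) i ≡ true
  fixed-tail {i} h = fixed-true dissolved (test⇒∈ (keep (true-fixed p {suc i} h)))

  T-fixed : ∀ {i} → lookup T i ≡ true → lookup (fixed dissolved) i ≡ true × lookup (fixed p) (suc i) ≡ false
  T-fixed {i} Ti = fixed-true dissolved (test⇒∈ (single Ti)) , ≢true λ h → true≢false Ti (T-disjoint (true-fixed p {suc i} h) (⁅⁆-self i))

dissolve : Partition (suc n) → Partition n
dissolve p = Dissolve.dissolved p

dissolve-injective : (p q : Partition (suc n)) → (∀ i → lookup (fixed p) (suc i) ≡ lookup (fixed q) (suc i)) →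
  dissolve p ≈ dissolve q → ∀ {b} → b ∈ blocks p → b ∈ blocks q
dissolve-injective p q same eq@(sub , _) {b} b∈ = go b b∈
  where
  T⊑ : ∀ p q → (∀ i → lookup (fixed p) (suc i) ≡ lookup (fixed q) (suc i)) → dissolve p ≈ dissolve q → Dissolve.T p ⊑ Dissolve.T q
  T⊑ p q same eq i Ti with Dissolve.T-fixed p Ti
  ... | f , ¬f with Dissolve.fixed-elim q (subst (λ A → lookup A i ≡ true) (fixed-cong (dissolve p) (dissolve q) eq) f)
  ...   | inj₂ h = h
  ...   | inj₁ h = ⊥-elim (true≢false h (trans (sym (same i)) ¬f))
  T≡ : Dissolve.T p ≡ Dissolve.T q
  T≡ = ⊑-antisym (T⊑ p q same eq) (T⊑ q p (sym ∘ same) (≈-sym (dissolve p) (dissolve q) eq))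
  go : ∀ b → b ∈ blocks p → b ∈ blocks q
  go (true ∷ c) c∈ = subst (λ c → (true ∷ c) ∈ blocks q) (sym (trans (Dissolve.T-unique p c∈) T≡)) (Dissolve.T∈ q)
  go (false ∷ c) c∈ with Dissolve.test-elim q c (Dissolve.∈⇒test q (sub (Dissolve.test⇒∈ p (Dissolve.keep p c∈))))
  ... | inj₁ c∈q = c∈q
  ... | inj₂ (i , Ti , refl) = ⊥-elim (true≢false (subst (λ T → lookup T i ≡ true) (sym T≡) Ti) (Dissolve.T-disjoint p c∈ (⁅⁆-self i)))

module _ (S : Subset n) where

  -- Injections in both directions. `P-tail` makes `dissolve` injective, because a fixed point of
  -- `dissolve p` comes from the block of zero exactly when p does not fix it.
  gather-dissolve : {P : Partition (suc n) → Set} (P? : Decidable P) {Q : Partition n → Set} (Q? : Decidable Q) →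
    (∀ p q → p ≈ q → P p → P q) → (∀ p q → p ≈ q → Q p → Q q) →
    (∀ p → P p → (∀ i → lookup (fixed p) (suc i) ≡ lookup S i)) →
    (∀ p → P p → Q (dissolve p)) → (∀ p → Q p → P (gather S p)) →
    length (filter P? (partitions (suc n))) ≡ length (filter Q? (partitions n))
  gather-dissolve P? Q? P-resp Q-resp P-tail PQ QP = ≤-antisym
    (filter-injection P? Q? dissolve PQ (λ p q Pp Pq eq →
        let same = λ i → trans (P-tail p Pp i) (sym (P-tail q Pq i)) in
        dissolve-injective p q same eq , dissolve-injective q p (sym ∘ same) (≈-sym (dissolve p) (dissolve q) eq)) Q-resp)
    (filter-injection Q? P? (gather S) QP (λ p q _ _ eq →
        gather-injective S p q eq , gather-injective S q p (≈-sym (gather S p) (gather S q) eq)) P-resp)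

  d-inside : d (inside ∷ S) ≡ d S
  d-inside = gather-dissolve (λ p → fixed p ≟ˢ (inside ∷ S)) (λ p → fixed p ≟ˢ S)
    (fixed-resp (_≡ inside ∷ S)) (fixed-resp (_≡ S))
    (λ p eq i → cong (λ A → lookup A (suc i)) eq)
    (λ p eq → vec-ext λ i → Bool-ext
      (λ h → to p eq i (Dissolve.fixed-elim p h))
      (λ h → Dissolve.fixed-tail p (trans (cong (λ A → lookup A (suc i)) eq) h)))
    (λ p eq → vec-ext λ { zero → gather-fixed-zero S p eq ; (suc i) → gather-fixed S p (λ e h → trans (cong (λ A → lookup A e) eq) h) i })
    where
    to : ∀ p → fixed p ≡ inside ∷ S → ∀ i → lookup (fixed p) (suc i) ≡ true ⊎ lookup (Dissolve.T p) i ≡ true → lookup S i ≡ true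
    to p eq i (inj₁ h) = trans (sym (cong (λ A → lookup A (suc i)) eq)) h
    to p eq i (inj₂ h) = ⊥-elim (true≢false h (trans (cong (λ T → lookup T i) T≡) (Vec.lookup-replicate i false)))
      where
      T≡ : Dissolve.T p ≡ Subset.⊥
      T≡ = sym (Dissolve.T-unique p (true-fixed p {zero} (cong (λ A → lookup A zero) eq)))

-- The recurrence for partitions without singletons.

sub : Subset n → Subset n → Bool
sub []          []      = true
sub (true ∷ S)  (a ∷ A) = a ∧ sub S A
sub (false ∷ S) (a ∷ A) = sub S A

sub-sound : (S A : Subset n) → sub S A ≡ true → S ⊑ A
sub-sound (true ∷ S)  (a ∷ A) h zero    _ = proj₁ (∧-split {a} h)
sub-sound (true ∷ S)  (a ∷ A) h (suc e) q = sub-sound S A (proj₂ (∧-split {a} h)) e q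
sub-sound (false ∷ S) (a ∷ A) h (suc e) q = sub-sound S A h e q

sub-complete : (S A : Subset n) → S ⊑ A → sub S A ≡ true
sub-complete []          []      h = refl
sub-complete (true ∷ S)  (a ∷ A) h = ∧-intro (h zero refl) (sub-complete S A (h ∘ suc))
sub-complete (false ∷ S) (a ∷ A) h = sub-complete S A (h ∘ suc)

-- What a superset of S misses is an arbitrary subset of what S misses.
Σ-sub : (f : ℕ → ℕ) (S : Subset n) → Σˢ (λ A → ⟦ sub S A ⟧ * f (co A)) ≡ bt f (co S)
Σ-sub f []          = trans (Σˢ-[] _) (trans (+-identityʳ _) (sym (cong (bt f) co-[] ∙ cong f (sym co-[]))))
  where
  _∙_ : {A : Set} {x y z : A} → x ≡ y → y ≡ z → x ≡ z
  _∙_ = trans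
Σ-sub f (true ∷ S)  = begin
  Σˢ (λ A → ⟦ sub (true ∷ S) A ⟧ * f (co A)) ≡⟨ Σˢ-suc _ ⟩
  Σˢ (λ A → ⟦ sub S A ⟧ * f (co (inside ∷ A))) + Σˢ (λ A → 0) ≡⟨ cong₂ _+_ (Σˢ-cong λ A → cong (λ c → ⟦ sub S A ⟧ * f c) (co-in A)) (Σˢ-0 λ _ → refl) ⟩
  Σˢ (λ A → ⟦ sub S A ⟧ * f (co A)) + 0 ≡⟨ +-identityʳ _ ⟩
  Σˢ (λ A → ⟦ sub S A ⟧ * f (co A)) ≡⟨ Σ-sub f S ⟩
  bt f (co S) ≡⟨ cong (bt f) (co-in S) ⟨
  bt f (co (inside ∷ S)) ∎
  where open ≡-Reasoning
Σ-sub f (false ∷ S) = begin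
  Σˢ (λ A → ⟦ sub (false ∷ S) A ⟧ * f (co A)) ≡⟨ Σˢ-suc _ ⟩
  Σˢ (λ A → ⟦ sub S A ⟧ * f (co (inside ∷ A))) + Σˢ (λ A → ⟦ sub S A ⟧ * f (co (outside ∷ A)))
    ≡⟨ cong₂ _+_ (Σˢ-cong λ A → cong (λ c → ⟦ sub S A ⟧ * f c) (co-in A)) (Σˢ-cong λ A → cong (λ c → ⟦ sub S A ⟧ * f c) (co-out A)) ⟩
  Σˢ (λ A → ⟦ sub S A ⟧ * f (co A)) + Σˢ (λ A → ⟦ sub S A ⟧ * f (suc (co A))) ≡⟨ cong₂ _+_ (Σ-sub f S) (Σ-sub (f ∘ suc) S) ⟩
  bt f (suc (co S)) ≡⟨ cong (bt f) (co-out S) ⟨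
  bt f (co (outside ∷ S)) ∎
  where open ≡-Reasoning

==-comm : (A B : Subset n) → (A == B) ≡ (B == A)
==-comm A B = Bool-ext (λ h → subst (λ C → C == A ≡ true) (==-sound A B h) (==-refl A)) (λ h → subst (λ C → C == B ≡ true) (==-sound B A h) (==-refl B))

lookup-tail : (A : Subset (suc n)) (i : Fin n) → lookup (tail A) i ≡ lookup A (suc i)
lookup-tail (a ∷ A) i = refl

does-≟-true : ∀ b → does (b Bool.≟ true) ≡ b
does-≟-true true  = refl
does-≟-true false = refl

-- Both sides count the partitions of n + 1 points whose fixed points other than zero form S.
-- Dissolving the block of zero yields partitions that fix at least S, the surplus fixed points
-- being those gathered with zero.
d-sum : (S : Subset n) → d (inside ∷ S) + d (outside ∷ S) ≡ Σˢ (λ A → ⟦ sub S A ⟧ * d A)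
d-sum {n} S = begin
  d (inside ∷ S) + d (outside ∷ S)
    ≡⟨ cong₂ _+_ (Σˢ-select (λ A → d (inside ∷ A)) S) (Σˢ-select (λ A → d (outside ∷ A)) S) ⟨
  Σˢ (λ A → ⟦ A == S ⟧ * d (inside ∷ A)) + Σˢ (λ A → ⟦ A == S ⟧ * d (outside ∷ A))
    ≡⟨ cong₂ _+_ (Σˢ-cong λ A → cong (λ b → ⟦ b ⟧ * d (inside ∷ A)) (==-comm A S)) (Σˢ-cong λ A → cong (λ b → ⟦ b ⟧ * d (outside ∷ A)) (==-comm A S)) ⟩
  Σˢ (λ A → ⟦ S == A ⟧ * d (inside ∷ A)) + Σˢ (λ A → ⟦ S == A ⟧ * d (outside ∷ A))
    ≡⟨ Σˢ-suc (λ A → ⟦ S == tail A ⟧ * d A) ⟨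
  Σˢ (λ A → ⟦ S == tail A ⟧ * d A)
    ≡⟨ fibers tail? (λ A → S == tail A) (λ p → does-≟ˢ (tail (fixed p)) S) (partitions (suc n)) ⟨
  length (filter tail? (partitions (suc n)))
    ≡⟨ gather-dissolve S tail? sub? (fixed-resp (λ A → tail A ≡ S)) (fixed-resp (λ A → sub S A ≡ true))
         (λ p eq i → trans (sym (lookup-tail (fixed p) i)) (cong (λ A → lookup A i) eq))
         (λ p eq → sub-complete S _ (λ i h → Dissolve.fixed-tail p (trans (sym (lookup-tail (fixed p) i)) (trans (cong (λ A → lookup A i) eq) h))))
         (λ p h → vec-ext (λ i → trans (lookup-tail (fixed (gather S p)) i) (gather-fixed S p (sub-sound S _ h) i))) ⟩
  length (filter sub? (partitions n))
    ≡⟨ fibers sub? (sub S) (λ p → does-≟-true (sub S (fixed p))) (partitions n) ⟩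
  Σˢ (λ A → ⟦ sub S A ⟧ * d A) ∎
  where
  open ≡-Reasoning
  tail? : Decidable (λ (p : Partition (suc n)) → tail (fixed p) ≡ S)
  tail? p = tail (fixed p) ≟ˢ S
  sub? : Decidable (λ (p : Partition n) → sub S (fixed p) ≡ true)
  sub? p = sub S (fixed p) Bool.≟ true

D : ℕ → ℕ
D x = d (⊥ˢ {x})

co-⊥ : ∀ n → co (⊥ˢ {n}) ≡ n
co-⊥ zero    = co-[]
co-⊥ (suc n) = trans (co-out ⊥ˢ) (cong suc (co-⊥ n))

D-rec-from : ∀ x → (∀ (S : Subset x) → d S ≡ D (co S)) → D (suc x) + D x ≡ bt D x
D-rec-from x IH = begin
  D (suc x) + D x ≡⟨ +-comm (D (suc x)) (D x) ⟩
  D x + D (suc x) ≡⟨ cong (_+ D (suc x)) (d-inside (⊥ˢ {x})) ⟨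
  d (inside ∷ ⊥ˢ {x}) + d (outside ∷ ⊥ˢ {x}) ≡⟨ d-sum (⊥ˢ {x}) ⟩
  Σˢ (λ A → ⟦ sub (⊥ˢ {x}) A ⟧ * d A) ≡⟨ Σˢ-cong (λ A → cong (⟦ sub ⊥ˢ A ⟧ *_) (IH A)) ⟩
  Σˢ (λ A → ⟦ sub (⊥ˢ {x}) A ⟧ * D (co A)) ≡⟨ Σ-sub D ⊥ˢ ⟩
  bt D (co (⊥ˢ {x})) ≡⟨ cong (bt D) (co-⊥ x) ⟩
  bt D x ∎
  where open ≡-Reasoning

-- For `outside ∷ S`, `d-sum` at S is compared with the recurrence at `co S`; the other summand is
-- known on both sides. The recurrence itself uses the claim for `co S` points, fewer than n + 1.
d≡D : ∀ n (S : Subset n) → d S ≡ D (co S)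
d≡D = <-rec (λ n → ∀ (S : Subset n) → d S ≡ D (co S)) go
  where
  go : ∀ n → (∀ {m} → m < n → ∀ (S : Subset m) → d S ≡ D (co S)) → ∀ (S : Subset n) → d S ≡ D (co S)
  go zero    rec []          = cong D (sym co-[])
  go (suc n) rec (true ∷ S)  = trans (d-inside S) (trans (rec ≤-refl S) (cong D (sym (co-in S))))
  go (suc n) rec (false ∷ S) = trans (+-cancelˡ-≡ (D (co S)) _ _ (begin
    D (co S) + d (outside ∷ S) ≡⟨ cong (_+ d (outside ∷ S)) (trans (d-inside S) (rec ≤-refl S)) ⟨
    d (inside ∷ S) + d (outside ∷ S) ≡⟨ d-sum S ⟩
    Σˢ (λ A → ⟦ sub S A ⟧ * d A) ≡⟨ Σˢ-cong (λ A → cong (⟦ sub S A ⟧ *_) (rec ≤-refl A)) ⟩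
    Σˢ (λ A → ⟦ sub S A ⟧ * D (co A)) ≡⟨ Σ-sub D S ⟩
    bt D (co S) ≡⟨ D-rec-from (co S) (rec (s≤s (subst (co S ≤_) (sz+co S) (m≤n+m _ _)))) ⟨
    D (suc (co S)) + D (co S) ≡⟨ +-comm (D (suc (co S))) (D (co S)) ⟩
    D (co S) + D (suc (co S)) ∎)) (cong D (sym (co-out S)))
    where open ≡-Reasoning

D-rec : ∀ x → D (suc x) + D x ≡ bt D x
D-rec x = D-rec-from x (d≡D x)

D0 : D 0 ≡ 1
D0 = refl

-- The total of g over all sets, classified by their points in K and their missing points, and
-- computed from the sizes k of K and m of its complement alone. It replaces a permutation of the
-- ground set in `frank-size`.
profile : ℕ → ℕ → (ℕ → ℕ → ℕ) → ℕ
profile zero    zero    g = g 0 0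
profile zero    (suc m) g = profile zero m g + profile zero m (λ i c → g i (suc c))
profile (suc k) m       g = profile k m (λ i c → g (suc i) c) + profile k m (λ i c → g i (suc c))

profile-suc : ∀ k m g → profile k (suc m) g ≡ profile k m g + profile k m (λ i c → g i (suc c))
profile-suc zero    m g = refl
profile-suc (suc k) m g = trans (cong₂ _+_ (profile-suc k m (λ i c → g (suc i) c)) (profile-suc k m (λ i c → g i (suc c))))
  (interchange (profile k m (λ i c → g (suc i) c)) (profile k m (λ i c → g (suc i) (suc c))) _ _)

Σ-profile : (g : ℕ → ℕ → ℕ) (K : Subset n) → Σˢ (λ A → g (I A K) (co A)) ≡ profile (sz K) (co K) g
Σ-profile g [] = trans (Σˢ-[] _) (trans (cong₂ g (n≤0⇒n≡0 (≤-trans (I≤sz [] []) (sz≤n []))) co-[])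
  (cong₂ (λ k m → profile k m g) (sym (n≤0⇒n≡0 (sz≤n []))) (sym co-[])))
Σ-profile g (true ∷ K) = begin
  Σˢ (λ A → g (I A (true ∷ K)) (co A)) ≡⟨ Σˢ-suc _ ⟩
  Σˢ (λ A → g (I (inside ∷ A) (true ∷ K)) (co (inside ∷ A))) + Σˢ (λ A → g (I (outside ∷ A) (true ∷ K)) (co (outside ∷ A)))
    ≡⟨ cong₂ _+_ (Σˢ-cong λ A → cong₂ g (I-in-in A K) (co-in A)) (Σˢ-cong λ A → cong₂ g (I-out A true K) (co-out A)) ⟩
  Σˢ (λ A → g (suc (I A K)) (co A)) + Σˢ (λ A → g (I A K) (suc (co A)))
    ≡⟨ cong₂ _+_ (Σ-profile (λ i c → g (suc i) c) K) (Σ-profile (λ i c → g i (suc c)) K) ⟩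
  profile (suc (sz K)) (co K) g ≡⟨ cong₂ (λ k m → profile k m g) (sz-in K) (co-in K) ⟨
  profile (sz (true ∷ K)) (co (true ∷ K)) g ∎
  where open ≡-Reasoning
Σ-profile g (false ∷ K) = begin
  Σˢ (λ A → g (I A (false ∷ K)) (co A)) ≡⟨ Σˢ-suc _ ⟩
  Σˢ (λ A → g (I (inside ∷ A) (false ∷ K)) (co (inside ∷ A))) + Σˢ (λ A → g (I (outside ∷ A) (false ∷ K)) (co (outside ∷ A)))
    ≡⟨ cong₂ _+_ (Σˢ-cong λ A → cong₂ g (I-in-out A K) (co-in A)) (Σˢ-cong λ A → cong₂ g (I-out A false K) (co-out A)) ⟩
  Σˢ (λ A → g (I A K) (co A)) + Σˢ (λ A → g (I A K) (suc (co A)))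
    ≡⟨ cong₂ _+_ (Σ-profile g K) (Σ-profile (λ i c → g i (suc c)) K) ⟩
  profile (sz K) (co K) g + profile (sz K) (co K) (λ i c → g i (suc c)) ≡⟨ profile-suc (sz K) (co K) g ⟨
  profile (sz K) (suc (co K)) g ≡⟨ cong₂ (λ k m → profile k m g) (sz-out K) (co-out K) ⟨
  profile (sz (false ∷ K)) (co (false ∷ K)) g ∎
  where open ≡-Reasoning

frank-size : (a : ℕ → ℕ) (t s : ℕ) (K L : Subset n) → sz K ≡ sz L → W a (F t s K) ≡ W a (F t s L)
frank-size a t s K L eq = trans (Σ-profile g K) (trans (cong₂ (λ k m → profile k m g) eq co-eq) (sym (Σ-profile g L)))
  where
  g : ℕ → ℕ → ℕ
  g i c = ⟦ (t + s) ≤ᵇ i ⟧ * a c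
  co-eq : co K ≡ co L
  co-eq = +-cancelˡ-≡ (sz K) _ _ (trans (sz+co K) (trans (sym (sz+co L)) (cong (_+ co L) (sym eq))))

sz-initial : ∀ n k → k ≤ n → sz (initial {n} k) ≡ k
sz-initial zero    zero    _         = n≤0⇒n≡0 (sz≤n [])
sz-initial (suc n) zero    _         = trans (sz-out (initial {n} zero)) (sz-initial n zero z≤n)
sz-initial (suc n) (suc k) (s≤s k≤n) = trans (sz-in (initial {n} k)) (cong suc (sz-initial n k k≤n))

sz-initial≤ : ∀ n k → sz (initial {n} k) ≤ k
sz-initial≤ zero    k       = ≤-trans (sz≤n []) z≤n
sz-initial≤ (suc n) zero    = ≤-trans (≤-reflexive (sz-out (initial {n} zero))) (sz-initial≤ n zero)
sz-initial≤ (suc n) (suc k) = ≤-trans (≤-reflexive (sz-in (initial {n} k))) (s≤s (sz-initial≤ n k))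

FixesMany-weight : ∀ n t s → ∣FixesMany∣ n t s ≡ W D (F t s (initial {n} (t + 2 * s)))
FixesMany-weight n t s = trans
  (fibers (fixesMany? t s) (F t s K) (λ p → cong (t + s ≤ᵇ_) (trans (∣∩∣≡I K (fixed p)) (I-comm K (fixed p)))) (partitions n))
  (Σˢ-cong λ S → cong (⟦ F t s K S ⟧ *_) (d≡D n S))
  where
  K = initial {n} (t + 2 * s)

-- The two inequalities.

module Upper (n t : ℕ) (𝒜 : List (Partition n)) (𝒜! : UniqueFamily 𝒜) (stable-int : ∀ {p q} → p ∈ 𝒜 → q ∈ 𝒜 → t ≤ ∣ fixed p ∩ fixed q ∣) where

  ℱ : Family n
  ℱ S = does (Any.any? (λ p → fixed p ≟ˢ S) 𝒜)

  ℱ-elim : ∀ S → ℱ S ≡ true → ∃[ p ] p ∈ 𝒜 × fixed p ≡ S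
  ℱ-elim S h with Any.any? (λ p → fixed p ≟ˢ S) 𝒜
  ... | yes any = find any

  ℱ-int : Intersectingᶠ t ℱ
  ℱ-int A B A∈ B∈ with ℱ-elim A A∈ | ℱ-elim B B∈
  ... | p , p∈ , refl | q , q∈ , refl = subst (t ≤_) (∣∩∣≡I (fixed p) (fixed q)) (stable-int p∈ q∈)

  length≤ : length 𝒜 ≤ W D ℱ
  length≤ = begin
    length 𝒜 ≡⟨ everything ⟨
    length (filter all? 𝒜) ≡⟨ fibers all? (λ _ → true) (λ _ → refl) 𝒜 ⟩
    Σˢ (λ S → 1 * count S 𝒜) ≤⟨ Σˢ-mono per ⟩
    W D ℱ ∎
    where
    open ≤-Reasoning
    all? : Decidable (λ (_ : Partition n) → ⊤)
    all? _ = yes tt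
    everything : length (filter all? 𝒜) ≡ length 𝒜
    everything = cong length {x = filter all? 𝒜} {y = 𝒜} (filter-all all? (All.tabulate λ _ → tt))
    per : ∀ S → 1 * count S 𝒜 ≤ ⟦ ℱ S ⟧ * D (co S)
    per S with Any.any? (λ p → fixed p ≟ˢ S) 𝒜
    ... | yes _ = *-monoʳ-≤ 1 (subst (count S 𝒜 ≤_) (d≡D n S)
      (unique-⊆⇒length≤ (Partition-setoid n) {filter (λ p → fixed p ≟ˢ S) 𝒜} {filter (λ p → fixed p ≟ˢ S) (partitions n)}
        (AllPairs.filter⁺ (λ p → fixed p ≟ˢ S) 𝒜!) λ {q} q∈ → into q q∈))
      where
      into : ∀ q → q ∈ˢ filter (λ p → fixed p ≟ˢ S) 𝒜 → q ∈ˢ filter (λ p → fixed p ≟ˢ S) (partitions n)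
      into q q∈ with find q∈
      ... | r , r∈ , q≈r = SetoidMembershipₚ.∈-filter⁺ (Partition-setoid n) (λ p → fixed p ≟ˢ S) (λ {x} {y} → fixed-resp (_≡ S) x y) {q}
        (partitions-complete q) (trans (fixed-cong q r q≈r) (proj₂ (∈-filter⁻ (λ p → fixed p ≟ˢ S) {xs = 𝒜} r∈)))
    ... | no none = ≤-reflexive (trans (+-identityʳ _) (cong length (filter-none (λ p → fixed p ≟ˢ S) (All.¬Any⇒All¬ 𝒜 none))))

open Sequences D D0 D-rec hiding (D1; D2; D3; D4; D5; D6; D7)
open CompleteIntersection weight (λ _ _ → refl) weight-mono weight>0 weight-step

module _ (n t′ : ℕ) (t≤n : suc t′ ≤ n) where

  private
    t : ℕ
    t = suc t′

    bound : ℕ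
    bound = max 0 (map (∣FixesMany∣ n t) (upTo (suc ⌊ n ∸ t /2⌋)))

    double : ∀ s → 2 * s ≡ s + s
    double s = cong (s +_) (+-identityʳ s)

    half : ∀ s → ⌊ s + s /2⌋ ≡ s
    half zero    = refl
    half (suc s) = trans (cong (λ m → ⌊ suc m /2⌋) (+-suc s s)) (cong suc (half s))

    -- K may be replaced by an initial segment of its size, and t + 2s = |K| ≤ n puts s into the
    -- range of the maximum.
    frank≤bound : FrankBound n 0 t bound
    frank≤bound K s K≡ = subst (_≤ bound) (trans (FixesMany-weight n t s)
        (frank-size D t s (initial (t + 2 * s)) K (trans (sz-initial n (t + 2 * s) t+2s≤n) (trans (cong (t +_) (double s)) (sym K≡)))))
      (All.lookup (Extrema.xs≤max 0 (map (∣FixesMany∣ n t) (upTo (suc ⌊ n ∸ t /2⌋)))) (∈-map⁺ (∣FixesMany∣ n t) (∈-upTo⁺ (s≤s s≤))))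
      where
      t+2s≤n : t + 2 * s ≤ n
      t+2s≤n = subst (_≤ n) (trans K≡ (cong (t +_) (sym (double s)))) (sz≤n K)
      s≤ : s ≤ ⌊ n ∸ t /2⌋
      s≤ = subst (_≤ ⌊ n ∸ t /2⌋) (half s) (⌊n/2⌋-mono (m+n≤o⇒m≤o∸n (s + s) (subst (_≤ n) (trans K≡ (+-comm t (s + s))) (sz≤n K))))

  upper : M n t ≤ bound
  upper with M-attained n t
  ... | 𝒜 , 𝒜! , 𝒜-int , size with compress t 𝒜 𝒜! 𝒜-int
  ...   | ℬ , ℬ! , ℬ-int , same , stable = begin
    M n t ≡⟨ size ⟨
    length 𝒜 ≡⟨ same ⟨
    length ℬ ≤⟨ U.length≤ ⟩
    W D U.ℱ ≤⟨ complete n 0 t′ t≤n bound frank≤bound U.ℱ U.ℱ-int ⟩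
    bound ∎
    where
    open ≤-Reasoning
    module U = Upper n t ℬ ℬ! (stable-fixed t ℬ ℬ-int stable)

  -- Two sets with at least t + r points each in a set of at most t + 2r points share t of them, and
  -- a common fixed point is a common block.
  FixesMany≤M : ∀ r → ∣FixesMany∣ n t r ≤ M n t
  FixesMany≤M r = M-upper n t {filter (fixesMany? t r) (partitions n)} (AllPairs.filter⁺ (fixesMany? t r) (partitions-unique n))
    (All.tabulate λ {p} p∈ → All.tabulate λ {q} q∈ → meet p q (many p∈) (many q∈))
    where
    K : Subset n
    K = initial (t + 2 * r)
    many : ∀ {p} → p ∈ filter (fixesMany? t r) (partitions n) → FixesMany t r p
    many p∈ = proj₂ (∈-filter⁻ (fixesMany? t r) {xs = partitions n} p∈)
    meet : ∀ p q → FixesMany t r p → FixesMany t r q → t ≤ length (p ∩ᵖ q)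
    meet p q hp hq = ≤-trans (+-cancelʳ-≤ (r + r) t ∣ fixed p ∩ fixed q ∣ (begin
      t + (r + r) ≤⟨ +-cancelʳ-≤ t _ _ (begin
        t + (r + r) + t ≡⟨ e t r ⟩
        (t + r) + (t + r) ≤⟨ +-mono-≤ hp hq ⟩
        ∣ K ∩ fixed p ∣ + ∣ K ∩ fixed q ∣ ≡⟨ cong₂ _+_ (trans (∣∩∣≡I K (fixed p)) (I-comm K (fixed p))) (trans (∣∩∣≡I K (fixed q)) (I-comm K (fixed q))) ⟩
        I (fixed p) K + I (fixed q) K ≤⟨ I-inclusion (fixed p) (fixed q) K ⟩
        I (fixed p) (fixed q) + sz K ≤⟨ +-monoʳ-≤ _ (sz-initial≤ n (t + 2 * r)) ⟩
        I (fixed p) (fixed q) + (t + 2 * r) ≡⟨ cong (λ m → I (fixed p) (fixed q) + (t + m)) (double r) ⟩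
        I (fixed p) (fixed q) + (t + (r + r)) ≡⟨ e′ (I (fixed p) (fixed q)) t (r + r) ⟩
        I (fixed p) (fixed q) + (r + r) + t ∎) ⟩
      I (fixed p) (fixed q) + (r + r) ≡⟨ cong (_+ (r + r)) (∣∩∣≡I (fixed p) (fixed q)) ⟨
      ∣ fixed p ∩ fixed q ∣ + (r + r) ∎)) (fixed≤common p q)
      where
      open ≤-Reasoning
      e : ∀ t r → t + (r + r) + t ≡ (t + r) + (t + r)
      e = solve-∀
      e′ : ∀ i t r → i + (t + r) ≡ i + r + t
      e′ = solve-∀

  lower : bound ≤ M n t
  lower = Extrema.max≤v⁺ {xs = map (∣FixesMany∣ n t) (upTo (suc ⌊ n ∸ t /2⌋))} z≤n (All.map⁺ (All.tabulate λ {r} _ → FixesMany≤M r))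

theorem1 : ∀ (n t : ℕ) → 1 ≤ t → t ≤ n →
    M n t ≡ max 0 (map (∣FixesMany∣ n t) (upTo (suc ⌊ n ∸ t /2⌋)))
theorem1 n (suc t′) _ t≤n = ≤-antisym (upper n t′ t≤n) (lower n t′ t≤n)
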